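{- Let $n\ge2$ and let $q$ be a prime power. Let $G=\operatorname{Unip}_{n+1}(\mathbb{F}_q)$ and for $0\le i\le n-1$ let $K_{\{i\}}=\langle e_{j,j+1}(a): j\in\{1,\dots,n\}\setminus\{i+1\},a\in\mathbb{F}_q\rangle$; let $R_i$ be the set of all relations $g_1g_2g_3=e$ with $g_1,g_2,g_3\in K_{\{i\}}\setminus\{e\}$. If $n\ge4$ or $q$ is odd, then $G=\langle\bigcup_iK_{\{i\}}\mid\bigcup_iR_i\rangle$, and the Dehn function of this presentation is bounded independently of $q$ (i.e., for fixed $n$ and every $m$, $\operatorname{Dehn}(m)$ is bounded by a constant depending only on $n$ and $m$, uniformly over all prime powers $q$ satisfying the hypothesis).
   Context: $e_{i,j}(a)$ is the $(n+1)\times(n+1)$ matrix with $1$'s on the diagonal, $a$ in entry $(i,j)$ and $0$ elsewhere; $\operatorname{Unip}_{n+1}(\mathbb{F}_q)$ is the group of upper triangular $(n+1)\times(n+1)$ matrices over $\mathbb{F}_q$ with $1$'s on the diagonal (generated by $e_{i,j}(a)$, $i<j$). Dehn function: for generating set $S=\bigcup_iK_{\{i\}}$ and relators $R=\bigcup_iR_i$, the area of a freely reduced word $w$ trivial in $G$ is the least number of conjugates of elements of $R\cup R^{ -1}$ whose product in $\operatorname{Free}(S)$ equals $w$; $\operatorname{Dehn}(m)$ is the maximal area of trivial words of length $\le m$.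
   Formalization: n≥3 replaces n≥2: for n=2 the presentation gives the infinite free product of K_{0} and K_{1}, not the finite group G. Generators are the non-identity elements of the K_{i}, with formal inverse of s identified with the letter s⁻¹, since otherwise all letters could map to 1 in Z/3. -}

module Defs where

open import Level using (Level; _⊔_; 0ℓ)
open import Algebra.Bundles using (CommutativeRing; Group)
open import Algebra.Structures using (IsCommutativeRing)
import Algebra.Properties.Group as GroupProperties
import Algebra.Properties.Semiring.Sum as Sum
open import Data.Nat.Base as ℕ using (ℕ; zero; suc)
import Data.Nat.Properties as ℕₚ
open import Data.Nat.Primality using (Prime)
open import Data.Fin.Base as Fin using (Fin; zero; suc; inject₁; toℕ)
import Data.Fin.Properties as Finₚ
open import Data.Bool.Base using (if_then_else_)
open import Data.List.Base using (List; []; _∷_; _++_; length; map; reverse; foldr; concatMap)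
open import Data.List.Relation.Binary.Pointwise using (Pointwise)
open import Data.List.Relation.Unary.All using (All)
open import Data.List.Relation.Unary.Linked using (Linked)
open import Data.Product.Base using (Σ; ∃; ∃₂; _×_; _,_; proj₁; proj₂)
open import Data.Sum.Base using (_⊎_; inj₁; inj₂)
open import Function.Base using (_∘_; _on_)
open import Function.Bundles using (_↔_; _⇔_)
open import Relation.Binary.Core using (Rel)
open import Relation.Binary.Definitions using (tri<; tri≈; tri>)
open import Relation.Binary.PropositionalEquality as ≡ using (_≡_; _≢_)
open import Relation.Nullary using (¬_; yes; no; does; contradiction)
open import Relation.Nullary.Decidable using (_×-dec_)
open import Relation.Unary using (Pred)

private
  variable
    a ℓ k s r : Level

------------------------------------------------------------------------
-- Finite fields

PrimePower : ℕ → Set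
PrimePower q = ∃₂ λ p e → Prime p × q ≡ p ℕ.^ suc e

record FiniteField (q : ℕ) : Set₁ where
  infixl 7 _*_
  infixl 6 _+_
  infix  8 -_
  field
    Carrier           : Set
    _+_ _*_           : Carrier → Carrier → Carrier
    -_                : Carrier → Carrier
    0# 1#             : Carrier
    isCommutativeRing : IsCommutativeRing _≡_ _+_ _*_ -_ 0# 1#
    0≢1               : 0# ≢ 1#
    inverse           : ∀ x → x ≢ 0# → ∃ λ y → x * y ≡ 1#
    cardinality       : Carrier ↔ Fin q

  commutativeRing : CommutativeRing 0ℓ 0ℓ
  commutativeRing = record { isCommutativeRing = isCommutativeRing }

------------------------------------------------------------------------
-- Unitriangular matrices

module Matrices (R : CommutativeRing a ℓ) where
  open CommutativeRing R hiding (zero)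
  open Sum semiring
  open import Relation.Binary.Reasoning.Setoid setoid

  Mat : ℕ → Set a
  Mat d = Fin d → Fin d → Carrier

  infix 4 _≈ᴹ_
  _≈ᴹ_ : ∀ {d} → Rel (Mat d) ℓ
  M ≈ᴹ N = ∀ i j → M i j ≈ N i j

  1ᴹ : ∀ {d} → Mat d
  1ᴹ i j = if does (i Finₚ.≟ j) then 1# else 0#

  infixl 7 _*ᴹ_
  _*ᴹ_ : ∀ {d} → Mat d → Mat d → Mat d
  _*ᴹ_ {d} M N i j = ∑[ l < d ] (M i l * N l j)

  elementary : ∀ {d} → Fin d → Fin d → Carrier → Mat d
  elementary i j x r c = if does ((r Finₚ.≟ i) ×-dec (c Finₚ.≟ j)) then x else 1ᴹ r c

  -- The inverse of a unitriangular matrix, by expansion along the first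
  -- row; meaningless for other matrices.
  invᴹ : ∀ {d} → Mat d → Mat d
  invᴹ {suc d} M zero    zero    = 1#
  invᴹ {suc d} M zero    (suc j) =
    - (∑[ l < d ] (M zero (suc l) * invᴹ (λ r c → M (suc r) (suc c)) l j))
  invᴹ {suc d} M (suc i) zero    = 0#
  invᴹ {suc d} M (suc i) (suc j) = invᴹ (λ r c → M (suc r) (suc c)) i j

  record IsUnitriangular {d} (M : Mat d) : Set (a ⊔ ℓ) where
    field
      diagonal : ∀ i → M i i ≈ 1#
      lower    : ∀ {i j} → j Fin.< i → M i j ≈ 0#

  open IsUnitriangular

  record Unitriangular (d : ℕ) : Set (a ⊔ ℓ) where
    constructor _,ᵁ_
    field
      matrix          : Mat d
      isUnitriangular : IsUnitriangular matrix

  open Unitriangular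

  private
    sum-zero : ∀ {d} (f : Fin d → Carrier) → (∀ l → f l ≈ 0#) → sum f ≈ 0#
    sum-zero {d} f f≈0 = trans (sum-cong-≋ f≈0) (sum-replicate-zero d)

    sum-single : ∀ {d} (f : Fin d → Carrier) i →
                 (∀ l → l ≢ i → f l ≈ 0#) → sum f ≈ f i
    sum-single {suc d} f zero    f≈0 =
      trans (+-congˡ (sum-zero (f ∘ suc) λ l → f≈0 (suc l) λ ())) (+-identityʳ _)
    sum-single {suc d} f (suc i) f≈0 =
      trans (+-cong (f≈0 zero λ ())
                    (sum-single (f ∘ suc) i λ l l≢i → f≈0 (suc l) (l≢i ∘ Finₚ.suc-injective)))
            (+-identityˡ _)

    1ᴹ-diag : ∀ {d} (i : Fin d) → 1ᴹ i i ≈ 1#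
    1ᴹ-diag i with i Finₚ.≟ i
    ... | yes _  = refl
    ... | no i≢i = contradiction ≡.refl i≢i

    1ᴹ-off : ∀ {d} {i j : Fin d} → i ≢ j → 1ᴹ i j ≈ 0#
    1ᴹ-off {i = i} {j} i≢j with i Finₚ.≟ j
    ... | yes i≡j = contradiction i≡j i≢j
    ... | no _    = refl

    *ᴹ-cong : ∀ {d} {M M′ N N′ : Mat d} → M ≈ᴹ M′ → N ≈ᴹ N′ → M *ᴹ N ≈ᴹ M′ *ᴹ N′
    *ᴹ-cong M≈ N≈ i j = sum-cong-≋ λ l → *-cong (M≈ i l) (N≈ l j)

    *ᴹ-assoc : ∀ {d} (L M N : Mat d) → (L *ᴹ M) *ᴹ N ≈ᴹ L *ᴹ (M *ᴹ N)
    *ᴹ-assoc {d} L M N i j = begin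
      ∑[ l < d ] ((∑[ m < d ] (L i m * M m l)) * N l j)
        ≈⟨ sum-cong-≋ (λ l → *-distribʳ-sum (N l j) (λ m → L i m * M m l)) ⟩
      ∑[ l < d ] ∑[ m < d ] (L i m * M m l * N l j)
        ≈⟨ ∑-comm (λ l m → L i m * M m l * N l j) ⟩
      ∑[ m < d ] ∑[ l < d ] (L i m * M m l * N l j)
        ≈⟨ sum-cong-≋ (λ m → sum-cong-≋ λ l → *-assoc (L i m) (M m l) (N l j)) ⟩
      ∑[ m < d ] ∑[ l < d ] (L i m * (M m l * N l j))
        ≈⟨ sum-cong-≋ (λ m → *-distribˡ-sum (L i m) (λ l → M m l * N l j)) ⟨
      ∑[ m < d ] (L i m * ∑[ l < d ] (M m l * N l j)) ∎

    *ᴹ-identityˡ : ∀ {d} (M : Mat d) → 1ᴹ *ᴹ M ≈ᴹ M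
    *ᴹ-identityˡ M i j =
      trans (sum-single _ i λ l l≢i → trans (*-congʳ (1ᴹ-off (l≢i ∘ ≡.sym))) (zeroˡ _))
            (trans (*-congʳ (1ᴹ-diag i)) (*-identityˡ _))

    *ᴹ-identityʳ : ∀ {d} (M : Mat d) → M *ᴹ 1ᴹ ≈ᴹ M
    *ᴹ-identityʳ M i j =
      trans (sum-single _ j λ l l≢j → trans (*-congˡ (1ᴹ-off l≢j)) (zeroʳ _))
            (trans (*-congˡ (1ᴹ-diag j)) (*-identityʳ _))

    1ᴹ-unitriangular : ∀ {d} → IsUnitriangular (1ᴹ {d})
    1ᴹ-unitriangular .diagonal = 1ᴹ-diag
    1ᴹ-unitriangular .lower j<i = 1ᴹ-off (λ i≡j → Finₚ.<-irrefl (≡.sym i≡j) j<i)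

    *ᴹ-unitriangular : ∀ {d} {M N : Mat d} →
      IsUnitriangular M → IsUnitriangular N → IsUnitriangular (M *ᴹ N)
    *ᴹ-unitriangular {M = M} {N} u v .diagonal i =
      trans (sum-single _ i off)
            (trans (*-cong (u .diagonal i) (v .diagonal i)) (*-identityˡ 1#))
      where
      off : ∀ l → l ≢ i → M i l * N l i ≈ 0#
      off l l≢i with Finₚ.<-cmp l i
      ... | tri< l<i _ _ = trans (*-congʳ (u .lower l<i)) (zeroˡ _)
      ... | tri≈ _ l≡i _ = contradiction l≡i l≢i
      ... | tri> _ _ i<l = trans (*-congˡ (v .lower i<l)) (zeroʳ _)
    *ᴹ-unitriangular {M = M} {N} u v .lower {i} {j} j<i = sum-zero _ term
      where
      term : ∀ l → M i l * N l j ≈ 0#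
      term l with toℕ l ℕₚ.<? toℕ i
      ... | yes l<i = trans (*-congʳ (u .lower l<i)) (zeroˡ _)
      ... | no  l≮i = trans (*-congˡ (v .lower (ℕₚ.<-≤-trans j<i (ℕₚ.≮⇒≥ l≮i)))) (zeroʳ _)

    minor : ∀ {d} {M : Mat (suc d)} → IsUnitriangular M →
            IsUnitriangular (λ r c → M (suc r) (suc c))
    minor u .diagonal i  = u .diagonal (suc i)
    minor u .lower   j<i = u .lower (ℕ.s≤s j<i)

    invᴹ-unitriangular : ∀ {d} {M : Mat d} → IsUnitriangular M → IsUnitriangular (invᴹ M)
    invᴹ-unitriangular u .diagonal zero    = refl
    invᴹ-unitriangular u .diagonal (suc i) = invᴹ-unitriangular (minor u) .diagonal i
    invᴹ-unitriangular u .lower {suc i} {zero}  _           = refl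
    invᴹ-unitriangular u .lower {suc i} {suc j} (ℕ.s≤s j<i) =
      invᴹ-unitriangular (minor u) .lower j<i

    invᴹ-inverseʳ : ∀ {d} {M : Mat d} → IsUnitriangular M → M *ᴹ invᴹ M ≈ᴹ 1ᴹ
    invᴹ-inverseʳ {suc d} {M} u zero zero =
      trans (+-cong (trans (*-identityʳ _) (u .diagonal zero))
                    (sum-zero (λ l → M zero (suc l) * 0#) λ l → zeroʳ _))
            (+-identityʳ 1#)
    invᴹ-inverseʳ {suc d} {M} u zero (suc j) =
      trans (+-congʳ (trans (*-congʳ (u .diagonal zero)) (*-identityˡ _)))
            (-‿inverseˡ _)
    invᴹ-inverseʳ {suc d} {M} u (suc i) zero =
      trans (+-cong (trans (*-identityʳ _) (u .lower (ℕ.s≤s ℕ.z≤n)))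
                    (sum-zero (λ l → M (suc i) (suc l) * 0#) λ l → zeroʳ _))
            (+-identityʳ 0#)
    invᴹ-inverseʳ {suc d} {M} u (suc i) (suc j) =
      trans (+-congʳ (trans (*-congʳ (u .lower (ℕ.s≤s ℕ.z≤n))) (zeroˡ _)))
            (trans (+-identityˡ _) (invᴹ-inverseʳ (minor u) i j))

    invᴹ-inverseˡ : ∀ {d} {M : Mat d} → IsUnitriangular M → invᴹ M *ᴹ M ≈ᴹ 1ᴹ
    invᴹ-inverseˡ {d} {M} u i j = begin
      (M⁻ *ᴹ M) i j                 ≈⟨ *ᴹ-cong {M = M⁻} {N = M} (λ _ _ → refl) M≈M⁻⁻ i j ⟩
      (M⁻ *ᴹ invᴹ M⁻) i j           ≈⟨ invᴹ-inverseʳ (invᴹ-unitriangular u) i j ⟩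
      1ᴹ i j                        ∎
      where
      M⁻ M⁻⁻ : Mat d
      M⁻  = invᴹ M
      M⁻⁻ = invᴹ M⁻
      M≈M⁻⁻ : M ≈ᴹ M⁻⁻
      M≈M⁻⁻ r c = begin
        M r c                  ≈⟨ *ᴹ-identityʳ M r c ⟨
        (M *ᴹ 1ᴹ) r c          ≈⟨ *ᴹ-cong {M = M} {N = M⁻ *ᴹ M⁻⁻} (λ _ _ → refl)
                                    (invᴹ-inverseʳ (invᴹ-unitriangular u)) r c ⟨
        (M *ᴹ (M⁻ *ᴹ M⁻⁻)) r c ≈⟨ *ᴹ-assoc M M⁻ M⁻⁻ r c ⟨
        ((M *ᴹ M⁻) *ᴹ M⁻⁻) r c ≈⟨ *ᴹ-cong {N = M⁻⁻} (invᴹ-inverseʳ u) (λ _ _ → refl) r c ⟩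
        (1ᴹ *ᴹ M⁻⁻) r c        ≈⟨ *ᴹ-identityˡ M⁻⁻ r c ⟩
        M⁻⁻ r c                ∎

    invᴹ-cong : ∀ {d} {M N : Mat d} → M ≈ᴹ N → invᴹ M ≈ᴹ invᴹ N
    invᴹ-cong {suc d} M≈N zero    zero    = refl
    invᴹ-cong {suc d} M≈N zero    (suc j) = -‿cong (sum-cong-≋ λ l →
      *-cong (M≈N zero (suc l)) (invᴹ-cong (λ r c → M≈N (suc r) (suc c)) l j))
    invᴹ-cong {suc d} M≈N (suc i) zero    = refl
    invᴹ-cong {suc d} M≈N (suc i) (suc j) = invᴹ-cong (λ r c → M≈N (suc r) (suc c)) i j

  Unip : ℕ → Group (a ⊔ ℓ) ℓ
  Unip d = record
    { Carrier = Unitriangular d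
    ; _≈_     = _≈ᴹ_ on matrix
    ; _∙_     = λ g h → (matrix g *ᴹ matrix h) ,ᵁ
                  *ᴹ-unitriangular (isUnitriangular g) (isUnitriangular h)
    ; ε       = 1ᴹ ,ᵁ 1ᴹ-unitriangular
    ; _⁻¹     = λ g → invᴹ (matrix g) ,ᵁ invᴹ-unitriangular (isUnitriangular g)
    ; isGroup = record
      { isMonoid = record
        { isSemigroup = record
          { isMagma = record
            { isEquivalence = record
              { refl  = λ _ _ → refl
              ; sym   = λ M≈N i j → sym (M≈N i j)
              ; trans = λ L≈M M≈N i j → trans (L≈M i j) (M≈N i j)
              }
            ; ∙-cong = *ᴹ-cong
            }
          ; assoc = λ L M N → *ᴹ-assoc (matrix L) (matrix M) (matrix N)
          }
        ; identity = (*ᴹ-identityˡ ∘ matrix) , (*ᴹ-identityʳ ∘ matrix)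
        }
      ; inverse = (invᴹ-inverseˡ ∘ isUnitriangular) , (invᴹ-inverseʳ ∘ isUnitriangular)
      ; ⁻¹-cong = invᴹ-cong
      }
    }

  e : ∀ {d} (i j : Fin d) → i Fin.< j → Carrier → Unitriangular d
  e i j i<j x = elementary i j x ,ᵁ record { diagonal = diag ; lower = low }
    where
    diag : ∀ r → elementary i j x r r ≈ 1#
    diag r with r Finₚ.≟ i | r Finₚ.≟ j
    ... | yes ≡.refl | yes ≡.refl = contradiction i<j (Finₚ.<-irrefl ≡.refl)
    ... | yes _      | no _       = 1ᴹ-diag r
    ... | no _       | yes _      = 1ᴹ-diag r
    ... | no _       | no _       = 1ᴹ-diag r

    low : ∀ {r c} → c Fin.< r → elementary i j x r c ≈ 0#
    low {r} {c} c<r with r Finₚ.≟ i | c Finₚ.≟ j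
    ... | yes ≡.refl | yes ≡.refl = contradiction i<j (Finₚ.<-asym c<r)
    ... | yes _      | no _       = 1ᴹ-unitriangular .lower c<r
    ... | no _       | yes _      = 1ᴹ-unitriangular .lower c<r
    ... | no _       | no _       = 1ᴹ-unitriangular .lower c<r

  -- For j : Fin n (counted from 0), the generator e_{j,j+1}(x) in size n + 1.
  simple : ∀ {n} → Fin n → Carrier → Unitriangular (suc n)
  simple j = e (inject₁ j) (suc j) (ℕ.s≤s (ℕₚ.≤-reflexive (Finₚ.toℕ-inject₁ j)))

------------------------------------------------------------------------
-- Generated subgroups

module _ (G : Group a ℓ) where
  open Group G hiding (inverse)

  data Generated (X : Pred Carrier s) : Pred Carrier (a ⊔ ℓ ⊔ s) where
    generator : ∀ {g} → X g → Generated X g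
    unit      : Generated X ε
    product   : ∀ {g h} → Generated X g → Generated X h → Generated X (g ∙ h)
    inverse   : ∀ {g} → Generated X g → Generated X (g ⁻¹)
    respects  : ∀ {g h} → g ≈ h → Generated X g → Generated X h

------------------------------------------------------------------------
-- Words, presentations and Dehn functions

-- The generating set S is a symmetric subset of G, and the formal inverse
-- of the letter s in Free(S) is the letter s ⁻¹.  So words are lists of
-- elements of S, with no signs.  (With independent formal inverses, relators
-- of length 3 alone never present a nontrivial G: every letter could be sent
-- to 1 in ℤ/3.)
module Words (G : Group a ℓ) (S : Pred (Group.Carrier G) s)
             (S-inv : ∀ {g} → S g → S (Group._⁻¹ G g)) where
  open Group G

  Letter : Set (a ⊔ s)
  Letter = Σ Carrier S

  Word : Set (a ⊔ s)
  Word = List Letter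

  inv : Letter → Letter
  inv (g , g∈S) = g ⁻¹ , S-inv g∈S

  infix 9 _⁻ʷ
  _⁻ʷ : Word → Word
  w ⁻ʷ = reverse (map inv w)

  eval : Word → Carrier
  eval = foldr (λ x g → proj₁ x ∙ g) ε

  Trivial : Pred Word ℓ
  Trivial w = eval w ≈ ε

  Reduced : Pred Word (a ⊔ ℓ ⊔ s)
  Reduced = Linked (λ x y → ¬ (proj₁ x ≈ proj₁ (inv y)))

  -- Equality in Free(S).
  infix 4 _≋_
  data _≋_ : Rel Word (a ⊔ ℓ ⊔ s) where
    letters : ∀ {u v} → Pointwise (_≈_ on proj₁) u v → u ≋ v
    cancel  : ∀ u x v → u ++ x ∷ inv x ∷ v ≋ u ++ v
    sym≋    : ∀ {u v} → u ≋ v → v ≋ u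
    trans≋  : ∀ {u v w} → u ≋ v → v ≋ w → u ≋ w

  module Presentation (R : Pred Word r) where

    R∪R⁻¹ : Pred Word (a ⊔ s ⊔ r)
    R∪R⁻¹ w = R w ⊎ ∃ λ v → R v × w ≡ v ⁻ʷ

    conjugate : Word × Word → Word
    conjugate (u , v) = u ++ v ++ u ⁻ʷ

    ProductOfConjugates : ℕ → Pred Word (a ⊔ ℓ ⊔ s ⊔ r)
    ProductOfConjugates N w = ∃ λ (cs : List (Word × Word)) →
      length cs ≡ N × All (R∪R⁻¹ ∘ proj₂) cs × w ≋ concatMap conjugate cs

    -- G = ⟨ S ∣ R ⟩: S generates G, and the kernel of Free(S) → G is the
    -- normal closure of R.
    IsPresentation : Set (a ⊔ ℓ ⊔ s ⊔ r)
    IsPresentation = (∀ g → ∃ λ w → eval w ≈ g)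
                   × (∀ w → Trivial w ⇔ ∃ λ N → ProductOfConjugates N w)

    IsArea : Word → ℕ → Set (a ⊔ ℓ ⊔ s ⊔ r)
    IsArea w A = ProductOfConjugates A w
               × (∀ B → ProductOfConjugates B w → A ℕ.≤ B)

    AdmissibleWord : ℕ → Pred Word (a ⊔ ℓ ⊔ s)
    AdmissibleWord m w = Reduced w × Trivial w × length w ℕ.≤ m

    IsDehn : ℕ → ℕ → Set (a ⊔ ℓ ⊔ s ⊔ r)
    IsDehn m D = (∀ w → AdmissibleWord m w → ∃ λ A → IsArea w A × A ℕ.≤ D)
               × (∃ λ w → AdmissibleWord m w × IsArea w D)

    -- Dehn(m) ≤ N, with the minimum and the maximum unfolded, since neither
    -- need be attained constructively.
    Dehn[_]≤_ : ℕ → ℕ → Set (a ⊔ ℓ ⊔ s ⊔ r)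
    Dehn[ m ]≤ N = ∀ w → AdmissibleWord m w → ∃ λ A → A ℕ.≤ N × ProductOfConjugates A w

    Dehn[]≤-sound : ∀ {m D N} → IsDehn m D → Dehn[ m ]≤ N → D ℕ.≤ N
    Dehn[]≤-sound (_ , w , w-adm , _ , D-least) bound with bound w w-adm
    ... | A , A≤N , A-conj = ℕₚ.≤-trans (D-least A A-conj) A≤N

    Dehn[]≤-complete : ∀ {m D N} → IsDehn m D → D ℕ.≤ N → Dehn[ m ]≤ N
    Dehn[]≤-complete (areas , _) D≤N w w-adm with areas w w-adm
    ... | A , (A-conj , _) , A≤D = A , ℕₚ.≤-trans A≤D D≤N , A-conj

------------------------------------------------------------------------
-- The presentation of Unip_{n+1}(F) by its subgroups K_{i}

-- For n = 2 there are only two subgroups K_{i}, meeting trivially, and this is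
-- a presentation of their free product rather than of G.
module UnipPresentation (n : ℕ) {q : ℕ} (F : FiniteField q) where
  open Matrices (FiniteField.commutativeRing F)

  G : Group 0ℓ 0ℓ
  G = Unip (suc n)

  open Group G hiding (inverse)

  -- With j counted from 0 as well, "j ≠ i + 1" reads j ≢ i.
  K : Fin n → Pred Carrier 0ℓ
  K i = Generated G (λ g → ∃₂ λ j x → j ≢ i × g ≈ simple j x)

  -- The identity is not a letter: as an element of ⋃ K_{i} it is the empty
  -- word of Free(S).
  S : Pred Carrier 0ℓ
  S g = (∃ λ i → K i g) × ¬ (g ≈ ε)

  S-inv : ∀ {g} → S g → S (g ⁻¹)
  S-inv {g} ((i , g∈K) , g≉ε) = (i , inverse g∈K) , λ g⁻¹≈ε →
    g≉ε (⁻¹-injective {g} {ε} (trans {g ⁻¹} {ε} {ε ⁻¹} g⁻¹≈ε (sym {ε ⁻¹} {ε} ε⁻¹≈ε)))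
    where open GroupProperties G using (⁻¹-injective; ε⁻¹≈ε)

  open Words G S S-inv public

  R : Fin n → Pred Word 0ℓ
  R i w = length w ≡ 3 × All (K i ∘ proj₁) w × Trivial w

  open Presentation (λ w → ∃ λ i → R i w) public

{-
Uniform boundedness is turned into an identity in a group.  Consider all
instances (q, F, w) in which w is a trivial word whose letters lie in prescribed
subgroups K_{κ}.  Families of words indexed by the instances, modulo uniformly
bounded area, form a group Γ, and w has uniformly bounded area as soon as the
tautological family is trivial in Γ.  So it is enough to extend the maps from
the block subgroups to Γ to a homomorphism Ψ on the whole unitriangular group
over the product of the fields: then w = Ψ (eval w) = 1 in Γ.

Write a unitriangular matrix as col · unip · row · Z, with the last column, the
middle block, the first row and the corner.  All that is needed to define Ψ is
that row (r) and col (c) commute up to a central Z (r · c).  This follows once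
the entries of row and col with different indices commute.  Half of these
relations hold inside the subgroups K_{κ}, and conjugation by the middle block
gives the others if n ≥ 4.  For n = 3 the same conjugation only shows that
e₁₂(x) e₁₃(x t) commutes with e₃₄(z) e₂₄(− t z), and the missing relation
[ e₁₃, e₂₄ ] = 1 is deduced from this by dividing by 2.
-}
module Submission where

open import Defs
open import Level using (Level; _⊔_)
open import Algebra.Bundles using (CommutativeRing; Group)
import Algebra.Properties.Group as GroupProperties
import Algebra.Properties.Monoid.Mult as Mult
import Algebra.Properties.Ring as RingProperties
import Algebra.Properties.Semiring.Sum as Sum
open import Data.Bool.Base using (true; false; if_then_else_)
open import Data.Fin.Base as Fin using (Fin; zero; suc; inject₁; fromℕ; fromℕ<; toℕ)
open import Data.Fin.Induction using (<-weakInduction)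
open import Data.Fin.Permutation using (Permutation; permutation)
import Data.Fin.Properties as Finₚ
open import Data.Fin.Relation.Unary.Top using (view; ‵fromℕ; ‵inject₁)
open import Data.List.Base using (List; []; _∷_; _++_; length; map; concatMap; allFin)
open import Data.List.Extrema.Nat using (max; xs≤max)
open import Data.List.Membership.Propositional.Properties using (∈-map⁺; ∈-allFin)
import Data.List.Properties as Listₚ
open import Data.List.Relation.Binary.Pointwise as Pointwise using (Pointwise; []; _∷_)
open import Data.List.Relation.Unary.All as All using (All; []; _∷_)
open import Data.Nat using (ℕ; _≤_)
open import Data.Nat.Base as ℕ using (zero; suc)
open import Data.Nat.Divisibility using (_∣_; ∣m∣n⇒∣m+n; ∣-refl; _∣0)
import Data.Nat.Properties as ℕₚ
open import Data.Product using (Σ; ∃; ∃₂; _×_; _,_; proj₁; proj₂)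
open import Data.Sum using (_⊎_; inj₁; inj₂; [_,_]′)
open import Data.Unit.Base using (⊤; tt)
open import Function.Base using (_∘_; _on_; case_of_)
open import Function.Bundles using (_⇔_; mk⇔; module Inverse)
open import Function.Properties.Inverse using (↔⇒↣)
open import Relation.Binary.Definitions using (DecidableEquality; tri<; tri≈; tri>)
open import Relation.Binary.PropositionalEquality as ≡ using (_≡_; _≢_)
open import Relation.Nullary using (¬_; Dec; yes; no; does; contradiction)
open import Relation.Nullary.Decidable using (dec-true; dec-false; via-injection; _→-dec_)
open import Relation.Unary using (Pred)
open import Tactic.MonoidSolver using (solve)

-- No area is ever counted. Equality in Γ puts the bound before the instance, so a single derivation
-- of w = 1 in Γ is already a bound that serves all fields. The price is that this derivation cannot
-- look at the instance: its scalars live in a product of fields, a commutative ring with zero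
-- divisors and without a test for zero. Hence the passage from the block subgroups to Ψ is carried
-- out over an arbitrary commutative ring and into an arbitrary group, with one half as the only
-- inverse ever used. For the same reason each letter must lie in the same K_{κ} in all instances.
-- So there is one family for each list of indices κ, and a maximum over the finitely many lists of
-- length at most m gives the bound.
--
-- The corner entry lies in no K_{κ}, so Γ comes without a candidate for its image. The candidate is
-- built as a commutator of a row entry with a column entry; that it is central, additive and
-- dependent only on the product of the two entries must be deduced from the commutation of entries
-- with different indices.

private
  variable
    ρ ℓ γ ℓ′ σ ι : Level
    d : ℕ

-- Vectors with an appended last entry.

snoc : {X : Set ρ} → (Fin d → X) → X → Fin (suc d) → X
snoc {d = zero}  f x _       = x
snoc {d = suc _} f x zero    = f zero
snoc {d = suc _} f x (suc i) = snoc (f ∘ suc) x i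

snoc-inject₁ : {X : Set ρ} (f : Fin d → X) (x : X) (i : Fin d) → snoc f x (inject₁ i) ≡ f i
snoc-inject₁ f x zero    = ≡.refl
snoc-inject₁ f x (suc i) = snoc-inject₁ (f ∘ suc) x i

snoc-fromℕ : {X : Set ρ} (f : Fin d → X) (x : X) → snoc f x (fromℕ d) ≡ x
snoc-fromℕ {d = zero}  f x = ≡.refl
snoc-fromℕ {d = suc _} f x = snoc-fromℕ (f ∘ suc) x

inject₁<fromℕ : (i : Fin d) → inject₁ i Fin.< fromℕ d
inject₁<fromℕ {d} i rewrite Finₚ.toℕ-inject₁ i | Finₚ.toℕ-fromℕ d = Finₚ.toℕ<n i

inject₁-cancel-< : {i j : Fin d} → inject₁ i Fin.< inject₁ j → i Fin.< j
inject₁-cancel-< {i = i} {j} i<j rewrite Finₚ.toℕ-inject₁ i | Finₚ.toℕ-inject₁ j = i<j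

fromℕ≮inject₁ : (i : Fin d) → ¬ (fromℕ d Fin.< inject₁ i)
fromℕ≮inject₁ i = Finₚ.<-asym (inject₁<fromℕ i)

-- Vectors, unitriangular matrices and block conditions over a commutative ring.

module Linear (R : CommutativeRing ρ ℓ) where
  open CommutativeRing R hiding (zero)
  open RingProperties ring using (-0#≈0#)
  open Sum semiring
  open Matrices R
  open Unitriangular
  open IsUnitriangular
  open import Relation.Binary.Reasoning.Setoid setoid

  sum-≈0 : (f : Fin d → Carrier) → (∀ l → f l ≈ 0#) → sum f ≈ 0#
  sum-≈0 {d} f f≈0 = trans (sum-cong-≋ f≈0) (sum-replicate-zero d)

  sum-single : (f : Fin d → Carrier) (i : Fin d) → (∀ l → l ≢ i → f l ≈ 0#) → sum f ≈ f i
  sum-single f zero    f≈0 =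
    trans (+-congˡ (sum-≈0 (f ∘ suc) λ l → f≈0 (suc l) λ ())) (+-identityʳ _)
  sum-single f (suc i) f≈0 =
    trans (+-cong (f≈0 zero λ ())
                  (sum-single (f ∘ suc) i λ l l≢i → f≈0 (suc l) (l≢i ∘ Finₚ.suc-injective)))
          (+-identityˡ _)

  Vec : ℕ → Set ρ
  Vec d = Fin d → Carrier

  infix 4 _≈ᵛ_
  _≈ᵛ_ : Vec d → Vec d → Set ℓ
  v ≈ᵛ w = ∀ i → v i ≈ w i

  0ᵛ : Vec d
  0ᵛ _ = 0#

  infixl 6 _+ᵛ_
  _+ᵛ_ : Vec d → Vec d → Vec d
  (v +ᵛ w) i = v i + w i

  δ : Fin d → Carrier → Vec d
  δ k x i = if does (i Finₚ.≟ k) then x else 0#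

  infix 7 _·_
  _·_ : Vec d → Vec d → Carrier
  v · w = sum (λ l → v l * w l)

  infixl 7 _⊲_
  _⊲_ : Vec d → Mat d → Vec d
  (v ⊲ M) j = v · (λ l → M l j)

  infixr 7 _⊳_
  _⊳_ : Mat d → Vec d → Vec d
  (M ⊳ v) i = M i · v

  δ-diag : (k : Fin d) (x : Carrier) → δ k x k ≈ x
  δ-diag k x rewrite dec-true (k Finₚ.≟ k) ≡.refl = refl

  δ-off : {i k : Fin d} (x : Carrier) → i ≢ k → δ k x i ≈ 0#
  δ-off {i = i} {k} x i≢k rewrite dec-false (i Finₚ.≟ k) i≢k = refl

  δ-0 : (k : Fin d) → δ k 0# ≈ᵛ 0ᵛ
  δ-0 k i with i Finₚ.≟ k
  ... | yes _ = refl
  ... | no _  = refl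

  δ-+ : (k : Fin d) (x y : Carrier) → δ k (x + y) ≈ᵛ δ k x +ᵛ δ k y
  δ-+ k x y i with i Finₚ.≟ k
  ... | yes _ = refl
  ... | no _  = sym (+-identityˡ 0#)

  δ-cong : (k : Fin d) {x y : Carrier} → x ≈ y → δ k x ≈ᵛ δ k y
  δ-cong k x≈y i with i Finₚ.≟ k
  ... | yes _ = x≈y
  ... | no _  = refl

  1ᴹ≈δ : (i j : Fin d) → 1ᴹ i j ≈ δ i 1# j
  1ᴹ≈δ i j with i Finₚ.≟ j
  ... | yes ≡.refl = sym (δ-diag i 1#)
  ... | no i≢j     = sym (δ-off 1# (i≢j ∘ ≡.sym))

  1ᴹ-off : {i j : Fin d} → i ≢ j → 1ᴹ i j ≈ 0#
  1ᴹ-off = δ-off 1#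

  ·-cong : {v v′ w w′ : Vec d} → v ≈ᵛ v′ → w ≈ᵛ w′ → v · w ≈ v′ · w′
  ·-cong v≈ w≈ = sum-cong-≋ λ l → *-cong (v≈ l) (w≈ l)

  ·-zeroˡ : (w : Vec d) → 0ᵛ · w ≈ 0#
  ·-zeroˡ w = sum-≈0 _ λ l → zeroˡ (w l)

  ·-zeroʳ : (v : Vec d) → v · 0ᵛ ≈ 0#
  ·-zeroʳ v = sum-≈0 _ λ l → zeroʳ (v l)

  ·-distribʳ : (u v w : Vec d) → (u +ᵛ v) · w ≈ u · w + v · w
  ·-distribʳ u v w = trans (sum-cong-≋ λ l → distribʳ (w l) (u l) (v l))
                           (∑-distrib-+ (λ l → u l * w l) (λ l → v l * w l))

  ·-distribˡ : (u v w : Vec d) → u · (v +ᵛ w) ≈ u · v + u · w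
  ·-distribˡ u v w = trans (sum-cong-≋ λ l → distribˡ (u l) (v l) (w l))
                           (∑-distrib-+ (λ l → u l * v l) (λ l → u l * w l))

  δ-· : (k : Fin d) (x : Carrier) (w : Vec d) → δ k x · w ≈ x * w k
  δ-· k x w = trans (sum-single _ k λ l l≢k → trans (*-congʳ (δ-off x l≢k)) (zeroˡ _))
                    (*-congʳ (δ-diag k x))

  ·-δ : (v : Vec d) (k : Fin d) (x : Carrier) → v · δ k x ≈ v k * x
  ·-δ v k x = trans (sum-single _ k λ l l≢k → trans (*-congˡ (δ-off x l≢k)) (zeroʳ _))
                    (*-congˡ (δ-diag k x))

  ⊲-cong : {v v′ : Vec d} {M M′ : Mat d} → v ≈ᵛ v′ → M ≈ᴹ M′ → v ⊲ M ≈ᵛ v′ ⊲ M′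
  ⊲-cong v≈ M≈ j = ·-cong v≈ λ l → M≈ l j

  ⊳-cong : {M M′ : Mat d} {v v′ : Vec d} → M ≈ᴹ M′ → v ≈ᵛ v′ → M ⊳ v ≈ᵛ M′ ⊳ v′
  ⊳-cong M≈ v≈ i = ·-cong (M≈ i) v≈

  ⊲-identity : (v : Vec d) → v ⊲ 1ᴹ ≈ᵛ v
  ⊲-identity v j = trans (·-δ v j 1#) (*-identityʳ _)

  ⊳-identity : (v : Vec d) → 1ᴹ ⊳ v ≈ᵛ v
  ⊳-identity v i =
    trans (·-cong (1ᴹ≈δ i) λ _ → refl) (trans (δ-· i 1# v) (*-identityˡ _))

  -- `δ k (δ l t c) r` is the entry (r, c) of t times a matrix unit. In this additive form, the
  -- actions of an elementary matrix on rows and columns follow from bilinearity.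
  elementary≈ : (k l : Fin d) → k ≢ l → (t : Carrier) → ∀ r c →
                elementary k l t r c ≈ 1ᴹ r c + δ k (δ l t c) r
  elementary≈ k l k≢l t r c with r Finₚ.≟ k | c Finₚ.≟ l
  ... | yes ≡.refl | yes ≡.refl = trans (sym (+-identityˡ t)) (+-congʳ (sym (1ᴹ-off k≢l)))
  ... | yes _      | no _       = sym (+-identityʳ _)
  ... | no _       | yes _      = sym (+-identityʳ _)
  ... | no _       | no _       = sym (+-identityʳ _)

  ⊲-elementary : (v : Vec d) {k l : Fin d} → k ≢ l → (t : Carrier) →
                 v ⊲ elementary k l t ≈ᵛ v +ᵛ δ l (v k * t)
  ⊲-elementary v {k} {l} k≢l t j = begin
    v · (λ r → elementary k l t r j)         ≈⟨ ·-cong {v = v} (λ _ → refl) (λ r → elementary≈ k l k≢l t r j) ⟩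
    v · ((λ r → 1ᴹ r j) +ᵛ δ k (δ l t j))    ≈⟨ ·-distribˡ v _ _ ⟩
    (v ⊲ 1ᴹ) j + v · δ k (δ l t j)           ≈⟨ +-cong (⊲-identity v j) (·-δ v k _) ⟩
    v j + v k * δ l t j                      ≈⟨ +-congˡ (scale j) ⟩
    v j + δ l (v k * t) j                    ∎
    where
    scale : ∀ j → v k * δ l t j ≈ δ l (v k * t) j
    scale j with j Finₚ.≟ l
    ... | yes _ = refl
    ... | no _  = zeroʳ _

  elementary-⊳ : (v : Vec d) {k l : Fin d} → k ≢ l → (t : Carrier) →
                 elementary k l t ⊳ v ≈ᵛ v +ᵛ δ k (t * v l)
  elementary-⊳ v {k} {l} k≢l t i = begin
    elementary k l t i · v                          ≈⟨ ·-cong {w = v} (λ c → elementary≈ k l k≢l t i c) (λ _ → refl) ⟩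
    (1ᴹ i +ᵛ (λ c → δ k (δ l t c) i)) · v           ≈⟨ ·-distribʳ _ _ v ⟩
    (1ᴹ ⊳ v) i + (λ c → δ k (δ l t c) i) · v        ≈⟨ +-cong (⊳-identity v i) (scale i) ⟩
    v i + δ k (t * v l) i                           ∎
    where
    scale : ∀ i → (λ c → δ k (δ l t c) i) · v ≈ δ k (t * v l) i
    scale i with i Finₚ.≟ k
    ... | yes _ = δ-· l t v
    ... | no _  = ·-zeroˡ v

  -- A vector is the sum of its coordinate vectors. The last hypothesis speaks only of the
  -- coordinates of `v` itself, because in the generation result some coordinates are known to
  -- vanish and the others are reached by commutators.
  vec-ind : ∀ {p} (P : Vec d → Set p) → (∀ {v w} → v ≈ᵛ w → P v → P w) →
            P 0ᵛ → (∀ {v w} → P v → P w → P (v +ᵛ w)) →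
            ∀ v → (∀ k → P (δ k (v k))) → P v
  vec-ind {d = zero}  P resp P0 P+ v Pδ = resp (λ ()) P0
  vec-ind {d = suc d} P resp P0 P+ v Pδ = resp split (P+ (Pδ zero) tail-case)
    where
    0∷_ : Vec d → Vec (suc d)
    (0∷ w) zero    = 0#
    (0∷ w) (suc i) = w i

    0∷-+ : ∀ u w → (0∷ u) +ᵛ (0∷ w) ≈ᵛ 0∷ (u +ᵛ w)
    0∷-+ u w zero    = +-identityˡ 0#
    0∷-+ u w (suc i) = refl

    tail-case : P (0∷ (v ∘ suc))
    tail-case = vec-ind (P ∘ 0∷_)
      (λ v≈w → resp λ { zero → refl ; (suc i) → v≈w i })
      (resp (λ { zero → refl ; (suc i) → refl }) P0)
      (λ {u} {w} Pu Pw → resp (0∷-+ u w) (P+ Pu Pw))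
      (v ∘ suc)
      (λ k → resp (λ { zero → refl ; (suc i) → refl }) (Pδ (suc k)))

    split : δ zero (v zero) +ᵛ (0∷ (v ∘ suc)) ≈ᵛ v
    split zero    = +-identityʳ _
    split (suc i) = +-identityˡ _

  -- A matrix of size d + 2 is split into its corners, the interiors of its
  -- first row and last column, and its middle block.
  mid : Mat (suc (suc d)) → Mat d
  mid M i j = M (suc (inject₁ i)) (suc (inject₁ j))

  top : Mat (suc (suc d)) → Vec d
  top M j = M zero (suc (inject₁ j))

  right : Mat (suc (suc d)) → Vec d
  right M i = M (suc (inject₁ i)) (suc (fromℕ _))

  corner : Mat (suc (suc d)) → Carrier
  corner M = M zero (suc (fromℕ _))

  private
    *ᴹ-split : (M N : Mat (suc (suc d))) → ∀ i j → (M *ᴹ N) i j ≈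
               M i zero * N zero j
               + ((λ l → M i (suc (inject₁ l))) · (λ l → N (suc (inject₁ l)) j)
                  + M i (suc (fromℕ d)) * N (suc (fromℕ d)) j)
    *ᴹ-split M N i j = +-congˡ (sum-init-last (λ l → M i (suc l) * N (suc l) j))

    x*0 : {x y : Carrier} → y ≈ 0# → x * y ≈ 0#
    x*0 y≈0 = trans (*-congˡ y≈0) (zeroʳ _)

    0*x : {x y : Carrier} → x ≈ 0# → x * y ≈ 0#
    0*x x≈0 = trans (*-congʳ x≈0) (zeroˡ _)

    suc-inject₁<suc-fromℕ : (i : Fin d) → suc (inject₁ i) Fin.< suc (fromℕ d)
    suc-inject₁<suc-fromℕ i = ℕ.s≤s (inject₁<fromℕ i)

  module _ {M N : Mat (suc (suc d))} (uM : IsUnitriangular M) (uN : IsUnitriangular N) where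

    mid-* : mid (M *ᴹ N) ≈ᴹ mid M *ᴹ mid N
    mid-* i j = begin
      (M *ᴹ N) (suc (inject₁ i)) (suc (inject₁ j))  ≈⟨ *ᴹ-split M N _ _ ⟩
      _ + ((mid M *ᴹ mid N) i j + _)                ≈⟨ +-cong (0*x (uM .lower {suc (inject₁ i)} {zero} (ℕ.s≤s ℕ.z≤n)))
                                                          (+-congˡ (x*0 (uN .lower (suc-inject₁<suc-fromℕ j)))) ⟩
      0# + ((mid M *ᴹ mid N) i j + 0#)              ≈⟨ trans (+-identityˡ _) (+-identityʳ _) ⟩
      (mid M *ᴹ mid N) i j                          ∎

    top-* : top (M *ᴹ N) ≈ᵛ top N +ᵛ top M ⊲ mid N
    top-* j = begin
      (M *ᴹ N) zero (suc (inject₁ j))               ≈⟨ *ᴹ-split M N _ _ ⟩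
      _ + ((top M ⊲ mid N) j + _)                   ≈⟨ +-cong (trans (*-congʳ (uM .diagonal zero)) (*-identityˡ _))
                                                          (+-congˡ (x*0 (uN .lower (suc-inject₁<suc-fromℕ j)))) ⟩
      top N j + ((top M ⊲ mid N) j + 0#)            ≈⟨ +-congˡ (+-identityʳ _) ⟩
      top N j + (top M ⊲ mid N) j                   ∎

    right-* : right (M *ᴹ N) ≈ᵛ mid M ⊳ right N +ᵛ right M
    right-* i = begin
      (M *ᴹ N) (suc (inject₁ i)) (suc (fromℕ _))    ≈⟨ *ᴹ-split M N _ _ ⟩
      _ + ((mid M ⊳ right N) i + _)                 ≈⟨ +-cong (0*x (uM .lower {suc (inject₁ i)} {zero} (ℕ.s≤s ℕ.z≤n)))
                                                          (+-congˡ (trans (*-congˡ (uN .diagonal (suc (fromℕ _)))) (*-identityʳ _))) ⟩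
      0# + ((mid M ⊳ right N) i + right M i)        ≈⟨ +-identityˡ _ ⟩
      (mid M ⊳ right N) i + right M i               ∎

    corner-* : corner (M *ᴹ N) ≈ corner N + (top M · right N + corner M)
    corner-* = trans (*ᴹ-split M N _ _)
      (+-cong (trans (*-congʳ (uM .diagonal zero)) (*-identityˡ _))
              (+-congˡ (trans (*-congˡ (uN .diagonal (suc (fromℕ _)))) (*-identityʳ _))))

    components-injective : mid M ≈ᴹ mid N → top M ≈ᵛ top N → right M ≈ᵛ right N →
                           corner M ≈ corner N → M ≈ᴹ N
    components-injective m≈ t≈ r≈ c≈ zero zero = trans (uM .diagonal _) (sym (uN .diagonal _))
    components-injective m≈ t≈ r≈ c≈ zero (suc j) with view j
    ... | ‵fromℕ     = c≈
    ... | ‵inject₁ j = t≈ j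
    components-injective m≈ t≈ r≈ c≈ (suc i) zero =
      trans (uM .lower (ℕ.s≤s ℕ.z≤n)) (sym (uN .lower (ℕ.s≤s ℕ.z≤n)))
    components-injective m≈ t≈ r≈ c≈ (suc i) (suc j) with view i | view j
    ... | ‵inject₁ i | ‵inject₁ j = m≈ i j
    ... | ‵inject₁ i | ‵fromℕ     = r≈ i
    ... | ‵fromℕ     | ‵inject₁ j = trans (uM .lower (suc-inject₁<suc-fromℕ j))
                                          (sym (uN .lower (suc-inject₁<suc-fromℕ j)))
    ... | ‵fromℕ     | ‵fromℕ     = trans (uM .diagonal _) (sym (uN .diagonal _))

  midᵁ : Unitriangular (suc (suc d)) → Unitriangular d
  midᵁ g = mid (matrix g) ,ᵁ record
    { diagonal = λ i → isUnitriangular g .diagonal _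
    ; lower    = λ {i} {j} j<i → isUnitriangular g .lower
        (ℕ.s≤s (≡.subst₂ ℕ._<_ (≡.sym (Finₚ.toℕ-inject₁ j)) (≡.sym (Finₚ.toℕ-inject₁ i)) j<i))
    }

  -- The block matrix with rows (1, t, z), (0, m, r) and (0, 0, 1).
  assembleᴹ : Mat d → Vec d → Vec d → Carrier → Mat (suc (suc d))
  assembleᴹ m t r z zero    zero    = 1#
  assembleᴹ m t r z zero    (suc j) = snoc t z j
  assembleᴹ m t r z (suc i) zero    = 0#
  assembleᴹ m t r z (suc i) (suc j) = snoc (λ k → snoc (m k) (r k)) (snoc 0ᵛ 1#) i j

  module _ (m : Mat d) (t r : Vec d) (z : Carrier) where

    mid-assemble : mid (assembleᴹ m t r z) ≈ᴹ m
    mid-assemble i j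
      rewrite snoc-inject₁ (λ k → snoc (m k) (r k)) (snoc 0ᵛ 1#) i
            | snoc-inject₁ (m i) (r i) j = refl

    top-assemble : top (assembleᴹ m t r z) ≈ᵛ t
    top-assemble j rewrite snoc-inject₁ t z j = refl

    right-assemble : right (assembleᴹ m t r z) ≈ᵛ r
    right-assemble i
      rewrite snoc-inject₁ (λ k → snoc (m k) (r k)) (snoc 0ᵛ 1#) i
            | snoc-fromℕ (m i) (r i) = refl

    corner-assemble : corner (assembleᴹ m t r z) ≈ z
    corner-assemble rewrite snoc-fromℕ t z = refl

    assemble-unitriangular : IsUnitriangular m → IsUnitriangular (assembleᴹ m t r z)
    assemble-unitriangular um = record { diagonal = diag ; lower = λ {i} {j} → low i j }
      where
      rows : Fin (suc d) → Fin (suc d) → Carrier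
      rows = snoc (λ k → snoc (m k) (r k)) (snoc 0ᵛ 1#)

      last-row : (j : Fin (suc d)) → rows (fromℕ d) j ≡ snoc 0ᵛ 1# j
      last-row j = ≡.cong (λ f → f j) (snoc-fromℕ (λ k → snoc (m k) (r k)) (snoc 0ᵛ 1#))

      diag : ∀ i → assembleᴹ m t r z i i ≈ 1#
      diag zero = refl
      diag (suc i) with view i
      ... | ‵inject₁ i = trans (mid-assemble i i) (um .diagonal i)
      ... | ‵fromℕ     = reflexive (≡.trans (last-row (fromℕ d)) (snoc-fromℕ {d = d} 0ᵛ 1#))

      low : ∀ i j → j Fin.< i → assembleᴹ m t r z i j ≈ 0#
      low (suc i) zero    _           = refl
      low (suc i) (suc j) (ℕ.s≤s j<i) with view i | view j
      ... | ‵inject₁ i | ‵inject₁ j = trans (mid-assemble i j) (um .lower (inject₁-cancel-< j<i))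
      ... | ‵inject₁ i | ‵fromℕ     = contradiction j<i (fromℕ≮inject₁ i)
      ... | ‵fromℕ     | ‵inject₁ j = reflexive (≡.trans (last-row (inject₁ j)) (snoc-inject₁ 0ᵛ 1# j))
      ... | ‵fromℕ     | ‵fromℕ     = contradiction j<i (Finₚ.<-irrefl ≡.refl)

  assemble : Unitriangular d → Vec d → Vec d → Carrier → Unitriangular (suc (suc d))
  assemble g t r z =
    assembleᴹ (matrix g) t r z ,ᵁ assemble-unitriangular _ t r z (isUnitriangular g)

  -- The shape of the matrices in `K κ`: without the simple generator at κ, two diagonal blocks
  -- remain, the indices up to κ and those after it. As a condition on single entries it is
  -- decidable over a finite field and can be checked instance by instance over a product of rings.
  Block : ℕ → Mat d → Set ℓ
  Block κ M = ∀ i j → toℕ i ℕ.≤ κ → κ ℕ.< toℕ j → M i j ≈ 0#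

  Block-1 : (κ : ℕ) → Block κ (1ᴹ {d})
  Block-1 κ i j i≤κ κ<j = 1ᴹ-off (Finₚ.<⇒≢ (ℕₚ.≤-<-trans i≤κ κ<j))

  Block-cong : {κ : ℕ} {M N : Mat d} → M ≈ᴹ N → Block κ M → Block κ N
  Block-cong M≈N b i j i≤κ κ<j = trans (sym (M≈N i j)) (b i j i≤κ κ<j)

  Block-* : (κ : ℕ) {M N : Mat d} → Block κ M → Block κ N → Block κ (M *ᴹ N)
  Block-* κ bM bN i j i≤κ κ<j = sum-≈0 _ term
    where
    term : ∀ l → _ ≈ 0#
    term l with toℕ l ℕₚ.≤? κ
    ... | yes l≤κ = x*0 (bN l j l≤κ κ<j)
    ... | no  l≰κ = 0*x (bM i l i≤κ (ℕₚ.≰⇒> l≰κ))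

  -- The induction follows the recursion of `invᴹ`. Passing to the minor lowers κ by one; for κ = 0
  -- the first row of `M` already vanishes off the diagonal.
  Block-inv : (κ : ℕ) {M : Mat d} → Block κ M → Block κ (invᴹ M)
  Block-inv κ {M} b zero (suc j) _ κ<j = trans (-‿cong (sum-≈0 _ (term κ b κ<j))) -0#≈0#
    where
    term : ∀ κ → Block κ M → κ ℕ.< suc (toℕ j) → ∀ l →
           M zero (suc l) * invᴹ (λ r c → M (suc r) (suc c)) l j ≈ 0#
    term zero    b κ<j l = 0*x (b zero (suc l) ℕ.z≤n (ℕ.s≤s ℕ.z≤n))
    term (suc κ) b (ℕ.s≤s κ<j) l with toℕ l ℕₚ.≤? κ
    ... | yes l≤κ = x*0 (Block-inv κ (λ i j i≤κ κ<j → b (suc i) (suc j) (ℕ.s≤s i≤κ) (ℕ.s≤s κ<j)) l j l≤κ κ<j)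
    ... | no  l≰κ = 0*x (b zero (suc l) ℕ.z≤n (ℕ.s≤s (ℕₚ.≰⇒> l≰κ)))
  Block-inv κ       b (suc i) zero    _           ()
  Block-inv (suc κ) b (suc i) (suc j) (ℕ.s≤s i≤κ) (ℕ.s≤s κ<j) =
    Block-inv κ (λ i j i≤κ κ<j → b (suc i) (suc j) (ℕ.s≤s i≤κ) (ℕ.s≤s κ<j)) i j i≤κ κ<j

  -- Index i of the middle block is index i + 1 of the matrix, so i + 1 ≤ κ < j + 1 becomes i < κ ≤
  -- j. With κ ≤ d the last index d + 1 falls into the second block.
  Block-components : (κ : ℕ) → κ ℕ.≤ d → {M : Mat (suc (suc d))} → IsUnitriangular M →
    (∀ i j → toℕ i ℕ.< κ → κ ℕ.≤ toℕ j → mid M i j ≈ 0#) →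
    (∀ j → κ ℕ.≤ toℕ j → top M j ≈ 0#) →
    (∀ i → toℕ i ℕ.< κ → right M i ≈ 0#) →
    corner M ≈ 0# → Block κ M
  Block-components κ κ≤d uM m≈0 t≈0 r≈0 c≈0 zero (suc j) _ (ℕ.s≤s κ≤j) with view j
  ... | ‵fromℕ     = c≈0
  ... | ‵inject₁ j = t≈0 j (≡.subst (κ ℕ.≤_) (Finₚ.toℕ-inject₁ j) κ≤j)
  Block-components κ κ≤d uM m≈0 t≈0 r≈0 c≈0 (suc i) (suc j) i<κ (ℕ.s≤s κ≤j) with view i | view j
  ... | ‵inject₁ i | ‵inject₁ j = m≈0 i j (≡.subst (ℕ._< κ) (Finₚ.toℕ-inject₁ i) i<κ)
                                          (≡.subst (κ ℕ.≤_) (Finₚ.toℕ-inject₁ j) κ≤j)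
  ... | ‵inject₁ i | ‵fromℕ     = r≈0 i (≡.subst (ℕ._< κ) (Finₚ.toℕ-inject₁ i) i<κ)
  ... | ‵fromℕ     | _          =
    contradiction κ≤d (ℕₚ.<⇒≱ (≡.subst (ℕ._< κ) (Finₚ.toℕ-fromℕ _) i<κ))

  module _ {κ : ℕ} {M : Mat (suc (suc d))} (b : Block κ M) where

    Block-mid : ∀ i j → toℕ i ℕ.< κ → κ ℕ.≤ toℕ j → mid M i j ≈ 0#
    Block-mid i j i<κ κ≤j = b _ _ (≡.subst (ℕ._< κ) (≡.sym (Finₚ.toℕ-inject₁ i)) i<κ)
                                  (ℕ.s≤s (≡.subst (κ ℕ.≤_) (≡.sym (Finₚ.toℕ-inject₁ j)) κ≤j))

    Block-top : ∀ j → κ ℕ.≤ toℕ j → top M j ≈ 0#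
    Block-top j κ≤j = b _ _ ℕ.z≤n (ℕ.s≤s (≡.subst (κ ℕ.≤_) (≡.sym (Finₚ.toℕ-inject₁ j)) κ≤j))

    Block-right : κ ℕ.≤ d → ∀ i → toℕ i ℕ.< κ → right M i ≈ 0#
    Block-right κ≤d i i<κ = b _ _ (≡.subst (ℕ._< κ) (≡.sym (Finₚ.toℕ-inject₁ i)) i<κ)
                                  (ℕ.s≤s (≡.subst (κ ℕ.≤_) (≡.sym (Finₚ.toℕ-fromℕ _)) κ≤d))

    Block-corner : κ ℕ.≤ d → corner M ≈ 0#
    Block-corner κ≤d = b _ _ ℕ.z≤n (ℕ.s≤s (≡.subst (κ ℕ.≤_) (≡.sym (Finₚ.toℕ-fromℕ _)) κ≤d))

-- Commuting elements of a group.

module Commuting (Γ : Group γ ℓ′) where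
  open Group Γ
  open GroupProperties Γ
  open import Relation.Binary.Reasoning.Setoid setoid

  infix 4 _⟷_
  _⟷_ : Carrier → Carrier → Set ℓ′
  g ⟷ h = g ∙ h ≈ h ∙ g

  private
    variable
      g g′ h h′ k : Carrier

  ⟷-sym : g ⟷ h → h ⟷ g
  ⟷-sym = sym

  ⟷-cong : g ≈ g′ → h ≈ h′ → g ⟷ h → g′ ⟷ h′
  ⟷-cong g≈ h≈ gh = trans (∙-cong (sym g≈) (sym h≈)) (trans gh (∙-cong h≈ g≈))

  ⟷-ε : g ⟷ ε
  ⟷-ε = trans (identityʳ _) (sym (identityˡ _))

  ⟷-∙ : g ⟷ h → g ⟷ k → g ⟷ h ∙ k
  ⟷-∙ {g} {h} {k} gh gk = begin
    g ∙ (h ∙ k) ≈⟨ assoc g h k ⟨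
    g ∙ h ∙ k   ≈⟨ ∙-congʳ gh ⟩
    h ∙ g ∙ k   ≈⟨ assoc h g k ⟩
    h ∙ (g ∙ k) ≈⟨ ∙-congˡ gk ⟩
    h ∙ (k ∙ g) ≈⟨ assoc h k g ⟨
    h ∙ k ∙ g   ∎

  ⟷-⁻¹ : g ⟷ h → g ⟷ h ⁻¹
  ⟷-⁻¹ {g} {h} gh = ∙-cancelˡ h _ _ (begin
    h ∙ (g ∙ h ⁻¹)   ≈⟨ assoc h g (h ⁻¹) ⟨
    h ∙ g ∙ h ⁻¹     ≈⟨ ∙-congʳ gh ⟨
    g ∙ h ∙ h ⁻¹     ≈⟨ assoc g h (h ⁻¹) ⟩
    g ∙ (h ∙ h ⁻¹)   ≈⟨ ∙-congˡ (inverseʳ h) ⟩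
    g ∙ ε            ≈⟨ ⟷-ε ⟩
    ε ∙ g            ≈⟨ ∙-congʳ (inverseʳ h) ⟨
    h ∙ h ⁻¹ ∙ g     ≈⟨ assoc h (h ⁻¹) g ⟩
    h ∙ (h ⁻¹ ∙ g)   ∎)

  ⟷-cancel : g ⟷ h ∙ k → g ⟷ h → g ⟷ k
  ⟷-cancel {g} {h} {k} ghk gh = ⟷-cong refl
    (trans (sym (assoc _ _ _)) (trans (∙-congʳ (inverseˡ h)) (identityˡ k)))
    (⟷-∙ (⟷-⁻¹ gh) ghk)

  swap : ∀ k → g ⟷ h → g ∙ (h ∙ k) ≈ h ∙ (g ∙ k)
  swap k gh = trans (sym (assoc _ _ _)) (trans (∙-congʳ gh) (assoc _ _ _))


  commutator-unique : ∀ {g h k} → g ∙ h ≈ h ∙ (g ∙ k) → g ⁻¹ ∙ (h ⁻¹ ∙ (g ∙ h)) ≈ k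
  commutator-unique {g} {h} {k} gh≈hgk = begin
    g ⁻¹ ∙ (h ⁻¹ ∙ (g ∙ h))       ≈⟨ ∙-congˡ (∙-congˡ gh≈hgk) ⟩
    g ⁻¹ ∙ (h ⁻¹ ∙ (h ∙ (g ∙ k))) ≈⟨ ∙-congˡ (\\-leftDividesʳ h (g ∙ k)) ⟩
    g ⁻¹ ∙ (g ∙ k)                ≈⟨ \\-leftDividesʳ g k ⟩
    k                             ∎

-- Size 4 with 2 invertible: [ e₁₃, e₂₄ ] = 1.

module Additive (R : CommutativeRing ρ ℓ) (Γ : Group γ ℓ′) where
  open CommutativeRing R
    using (_+_; _*_; +-cong; -‿cong; -_; 0#; 1#; -‿inverseˡ; +-identityˡ; +-comm; *-comm; *-congʳ; *-identityˡ; *-identityʳ; distribʳ)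
    renaming (Carrier to A; _≈_ to _≈ᴬ_; refl to reflᴬ; sym to symᴬ; trans to transᴬ)
  open RingProperties (CommutativeRing.ring R) using (-‿distribˡ-*; -‿distribʳ-*; -‿involutive)
  open Group Γ
  open GroupProperties Γ
  open Commuting Γ
  open import Relation.Binary.Reasoning.Setoid setoid

  record IsAdditive (f : A → Carrier) : Set (ρ ⊔ ℓ ⊔ ℓ′) where
    field
      cong : ∀ {x y} → x ≈ᴬ y → f x ≈ f y
      homo : ∀ x y → f (x + y) ≈ f x ∙ f y

    homo-0 : f 0# ≈ ε
    homo-0 = identityˡ-unique _ _ (trans (sym (homo 0# 0#)) (cong (+-identityˡ 0#)))

    neg : ∀ x → f (- x) ≈ f x ⁻¹
    neg x = inverseˡ-unique _ _ (trans (sym (homo (- x) x)) (trans (cong (-‿inverseˡ x)) homo-0))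

    neg-inverseˡ : ∀ x → f (- x) ∙ f x ≈ ε
    neg-inverseˡ x = trans (∙-congʳ (neg x)) (inverseˡ (f x))

    neg-inverseʳ : ∀ x → f x ∙ f (- x) ≈ ε
    neg-inverseʳ x = trans (∙-congˡ (neg x)) (inverseʳ (f x))

    commutative : ∀ x y → f x ⟷ f y
    commutative x y = trans (sym (homo x y)) (trans (cong (+-comm x y)) (homo y x))

  open IsAdditive

  -- The monoid solver knows nothing of inverses; it brings a product into this shape, where a pair
  -- can be cancelled or inserted.
  cancel-middle : ∀ {g h} k l → g ∙ h ≈ ε → k ∙ (g ∙ (h ∙ l)) ≈ k ∙ l
  cancel-middle {g} {h} k l gh≈ε = begin
    k ∙ (g ∙ (h ∙ l)) ≈⟨ solve monoid ⟩
    k ∙ ((g ∙ h) ∙ l) ≈⟨ ∙-congˡ (∙-congʳ gh≈ε) ⟩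
    k ∙ (ε ∙ l)       ≈⟨ ∙-congˡ (identityˡ l) ⟩
    k ∙ l             ∎

  -- In size 4, p, q, s, v are e₁₂, e₁₃, e₃₄, e₂₄, and the last hypothesis
  -- is [ e₁₂(x), e₃₄(z) ] = 1 conjugated by e₂₃(t).
  record Quadruple (p q s v : A → Carrier) : Set (ρ ⊔ ℓ ⊔ γ ⊔ ℓ′) where
    field
      p+  : IsAdditive p
      q+  : IsAdditive q
      s+  : IsAdditive s
      v+  : IsAdditive v
      p⟷q : ∀ x y → p x ⟷ q y
      s⟷v : ∀ x y → s x ⟷ v y
      p⟷s : ∀ x y → p x ⟷ s y
      pq⟷sv : ∀ x t z → p x ∙ q (x * t) ⟷ s z ∙ v (- (t * z))

  open Quadruple

  -- Reflection in the antidiagonal, e₁₂ ↔ e₃₄ and e₁₃ ↔ e₂₄. It changes the sign of t.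
  swap-quadruple : ∀ {p q s v} → Quadruple p q s v → Quadruple s v p q
  swap-quadruple Q .p+ = Q .s+
  swap-quadruple Q .q+ = Q .v+
  swap-quadruple Q .s+ = Q .p+
  swap-quadruple Q .v+ = Q .q+
  swap-quadruple Q .p⟷q = Q .s⟷v
  swap-quadruple Q .s⟷v = Q .p⟷q
  swap-quadruple Q .p⟷s x y = ⟷-sym (Q .p⟷s y x)
  swap-quadruple Q .pq⟷sv x t z = ⟷-cong
    (∙-congˡ (Q .v+ .cong (transᴬ (-‿distribˡ-* (- t) x) (transᴬ (*-congʳ (-‿involutive t)) (*-comm t x)))))
    (∙-congˡ (Q .q+ .cong (transᴬ (symᴬ (-‿distribʳ-* z t)) (-‿cong (*-comm z t)))))
    (⟷-sym (Q .pq⟷sv z (- t) x))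

  module _ {p q s v : A → Carrier} (Q : Quadruple p q s v) where

    -- By `pq⟷sv` at - t, the product of `P` and `W⁻` commutes with S ∙ V. Moving the inverse of `W`
    -- to the other side, on the left and on the right, leaves a relation between positive words.
    exchange : ∀ x t z → p x ∙ (s z ∙ (v (t * z) ∙ q (x * t))) ≈ q (x * t) ∙ (s z ∙ (v (t * z) ∙ p x))
    exchange x t z = begin
      P ∙ (S ∙ (V ∙ W))             ≈⟨ identityˡ _ ⟨
      ε ∙ (P ∙ (S ∙ (V ∙ W)))       ≈⟨ cancel-middle {W} {W⁻} ε _ W∙W⁻ ⟨
      ε ∙ (W ∙ (W⁻ ∙ (P ∙ (S ∙ (V ∙ W))))) ≈⟨ solve monoid ⟩
      W ∙ ((W⁻ ∙ P) ∙ (S ∙ V) ∙ W)  ≈⟨ ∙-congˡ (∙-congʳ W⁻P⟷SV) ⟩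
      W ∙ ((S ∙ V) ∙ (W⁻ ∙ P) ∙ W)  ≈⟨ ∙-congˡ (∙-congʳ (∙-congˡ (Q .p⟷q x _))) ⟨
      W ∙ ((S ∙ V) ∙ (P ∙ W⁻) ∙ W)  ≈⟨ solve monoid ⟩
      (W ∙ S ∙ V ∙ P) ∙ (W⁻ ∙ (W ∙ ε)) ≈⟨ cancel-middle {W⁻} {W} _ ε W⁻∙W ⟩
      (W ∙ S ∙ V ∙ P) ∙ ε           ≈⟨ solve monoid ⟩
      W ∙ (S ∙ (V ∙ P))             ∎
      where
      P S V W W⁻ : Carrier
      P  = p x
      S  = s z
      V  = v (t * z)
      W  = q (x * t)
      W⁻ = q (x * - t)

      W⁻≈ : W⁻ ≈ q (- (x * t))
      W⁻≈ = Q .q+ .cong (symᴬ (-‿distribʳ-* x t))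

      W∙W⁻ : W ∙ W⁻ ≈ ε
      W∙W⁻ = trans (∙-congˡ W⁻≈) (neg-inverseʳ (Q .q+) _)

      W⁻∙W : W⁻ ∙ W ≈ ε
      W⁻∙W = trans (∙-congʳ W⁻≈) (neg-inverseˡ (Q .q+) _)

      W⁻P⟷SV : W⁻ ∙ P ⟷ S ∙ V
      W⁻P⟷SV = ⟷-cong (Q .p⟷q x _)
        (∙-congˡ (Q .v+ .cong (transᴬ (-‿distribˡ-* (- t) z) (*-congʳ (-‿involutive t)))))
        (Q .pq⟷sv x (- t) z)

    -- In the unitriangular group this is e₁₄(x w), and for the swapped quadruple e₁₄(- (x w)). The
    -- lemmas below recover in Γ as much of this as is needed: commutation with p and q, and
    -- additivity in x.
    β : A → A → Carrier
    β x w = v w ⁻¹ ∙ (p x ∙ v w) ∙ p x ⁻¹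

    -- By the exchange relation, s (z) conjugates q (x t) to the element
    -- p v r v ⁻¹ with r = q (x t) p ⁻¹, p = p (x) and v = v (t z).  As q is
    -- additive, so is this element in x.
    v⁻¹pv⟷qp⁻¹ : ∀ x y t z → q (x * t) ∙ p x ⁻¹ ⟷ v (t * z) ⁻¹ ∙ (p y ∙ v (t * z))
    v⁻¹pv⟷qp⁻¹ x y t z =
      ∙-cancelʳ (r y) _ _ (∙-cancelˡ V _ _ (∙-cancelˡ (p x) _ _ (∙-cancelˡ S _ _ (begin
        S ∙ (p x ∙ (V ∙ ((r x ∙ c) ∙ r y)))             ≈⟨ solve monoid ⟩
        (S ∙ (p x ∙ (V ∙ r x))) ∙ c ∙ r y               ≈⟨ ∙-congʳ (∙-congʳ (conjugate x)) ⟨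
        (W x ∙ (S ∙ V)) ∙ (V ⁻¹ ∙ (p y ∙ V)) ∙ r y      ≈⟨ solve monoid ⟩
        (W x ∙ S) ∙ (V ∙ (V ⁻¹ ∙ (p y ∙ V ∙ r y)))      ≈⟨ cancel-middle _ _ (inverseʳ V) ⟩
        (W x ∙ S) ∙ (p y ∙ V ∙ r y)                     ≈⟨ solve monoid ⟩
        W x ∙ (S ∙ (p y ∙ (V ∙ r y)))                   ≈⟨ ∙-congˡ (conjugate y) ⟨
        W x ∙ (W y ∙ (S ∙ V))                           ≈⟨ assoc _ _ _ ⟨
        W x ∙ W y ∙ (S ∙ V)                             ≈⟨ ∙-congʳ (W-homo x y) ⟨
        W (x + y) ∙ (S ∙ V)                             ≈⟨ conjugate (x + y) ⟩
        S ∙ (p (x + y) ∙ (V ∙ r (x + y)))               ≈⟨ ∙-congˡ (∙-cong (Q .p+ .homo x y) (∙-congˡ (r-homo x y))) ⟩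
        S ∙ ((p x ∙ p y) ∙ (V ∙ (r x ∙ r y)))           ≈⟨ solve monoid ⟩
        (S ∙ p x) ∙ ((p y ∙ V) ∙ (r x ∙ r y))           ≈⟨ cancel-middle _ _ (inverseʳ V) ⟨
        (S ∙ p x) ∙ (V ∙ (V ⁻¹ ∙ ((p y ∙ V) ∙ (r x ∙ r y)))) ≈⟨ solve monoid ⟩
        S ∙ (p x ∙ (V ∙ ((c ∙ r x) ∙ r y)))             ∎))))
      where
      S V c : Carrier
      S = s z
      V = v (t * z)
      c = V ⁻¹ ∙ (p y ∙ V)

      W r : A → Carrier
      W x = q (x * t)
      r x = W x ∙ p x ⁻¹

      W-homo : ∀ x y → W (x + y) ≈ W x ∙ W y
      W-homo x y = trans (Q .q+ .cong (distribʳ t x y)) (Q .q+ .homo _ _)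

      r-homo : ∀ x y → r (x + y) ≈ r x ∙ r y
      r-homo x y = begin
        W (x + y) ∙ p (x + y) ⁻¹            ≈⟨ ∙-cong (W-homo x y) (⁻¹-cong (Q .p+ .homo x y)) ⟩
        (W x ∙ W y) ∙ (p x ∙ p y) ⁻¹        ≈⟨ ∙-congˡ (⁻¹-anti-homo-∙ (p x) (p y)) ⟩
        (W x ∙ W y) ∙ (p y ⁻¹ ∙ p x ⁻¹)     ≈⟨ solve monoid ⟩
        W x ∙ (r y ∙ p x ⁻¹)                ≈⟨ ∙-congˡ p⁻¹⟷r ⟨
        W x ∙ (p x ⁻¹ ∙ r y)                ≈⟨ assoc _ _ _ ⟨
        r x ∙ r y                           ∎
        where
        p⁻¹⟷r : p x ⁻¹ ⟷ r y
        p⁻¹⟷r = ⟷-sym (⟷-⁻¹ (⟷-sym (⟷-∙ (Q .p⟷q x _) (⟷-⁻¹ (commutative (Q .p+) x y)))))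

      conjugate : ∀ x → W x ∙ (S ∙ V) ≈ S ∙ (p x ∙ (V ∙ r x))
      conjugate x = ∙-cancelʳ (p x) _ _ (begin
        W x ∙ (S ∙ V) ∙ p x                     ≈⟨ solve monoid ⟩
        W x ∙ (S ∙ (V ∙ p x))                   ≈⟨ exchange x t z ⟨
        p x ∙ (S ∙ (V ∙ W x))                   ≈⟨ swap _ (Q .p⟷s x z) ⟩
        S ∙ (p x ∙ (V ∙ W x))                   ≈⟨ identityʳ _ ⟨
        S ∙ (p x ∙ (V ∙ W x)) ∙ ε               ≈⟨ ∙-congˡ (inverseˡ (p x)) ⟨
        S ∙ (p x ∙ (V ∙ W x)) ∙ (p x ⁻¹ ∙ p x)  ≈⟨ solve monoid ⟩
        S ∙ (p x ∙ (V ∙ (W x ∙ p x ⁻¹))) ∙ p x  ∎)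

    module _ (½ : A) (½+½≈1 : ½ + ½ ≈ᴬ 1#) where

      halve : ∀ x → x ≈ᴬ ½ * x + ½ * x
      halve x = symᴬ (transᴬ (symᴬ (distribʳ x ½ ½)) (transᴬ (*-congʳ ½+½≈1) (*-identityˡ x)))

      β-cong : ∀ {x x′ w w′} → x ≈ᴬ x′ → w ≈ᴬ w′ → β x w ≈ β x′ w′
      β-cong x≈ w≈ = ∙-cong (∙-cong (⁻¹-cong (Q .v+ .cong w≈)) (∙-cong (Q .p+ .cong x≈) (Q .v+ .cong w≈)))
                            (⁻¹-cong (Q .p+ .cong x≈))

      β⟷qp⁻¹ : ∀ x y t z → β y (t * z) ⟷ q (x * t) ∙ p x ⁻¹
      β⟷qp⁻¹ x y t z = ⟷-sym (⟷-∙ (v⁻¹pv⟷qp⁻¹ x y t z) (⟷-⁻¹ (⟷-sym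
        (⟷-∙ (Q .p⟷q y _) (⟷-⁻¹ (commutative (Q .p+) y x))))))

      β⟷qp⁻¹₊ : ∀ x y w → β y w ⟷ q x ∙ p x ⁻¹
      β⟷qp⁻¹₊ x y w = ⟷-cong (β-cong reflᴬ (*-identityˡ w)) (∙-congʳ (Q .q+ .cong (*-identityʳ x)))
        (β⟷qp⁻¹ x y 1# w)

      -- Taking t = - 1 and z = - w keeps t z = w but reverses the sign of x t. Together with t = 1
      -- this separates q from p.
      β⟷qp⁻¹₋ : ∀ x y w → β y w ⟷ q (- x) ∙ p x ⁻¹
      β⟷qp⁻¹₋ x y w = ⟷-cong
        (β-cong reflᴬ (transᴬ (symᴬ (-‿distribˡ-* 1# (- w)))
                        (transᴬ (-‿cong (*-identityˡ _)) (-‿involutive w))))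
        (∙-congʳ (Q .q+ .cong (transᴬ (symᴬ (-‿distribʳ-* x 1#)) (-‿cong (*-identityʳ x)))))
        (β⟷qp⁻¹ x y (- 1#) (- w))

      -- The elements q(h) p(h)⁻¹ and q(- h) p(h)⁻¹ both commute with β, and their quotient is q(h +
      -- h). Only doubled arguments are reached in this way, so h is half of x.
      β⟷q : ∀ x y w → β y w ⟷ q x
      β⟷q x y w = ⟷-cong refl (trans (sym (Q .q+ .homo h h)) (Q .q+ .cong (symᴬ (halve x))))
        (⟷-cancel (⟷-cong refl split (β⟷qp⁻¹₊ h y w)) (β⟷qp⁻¹₋ h y w))
        where
        h : A
        h = ½ * x

        split : q h ∙ p h ⁻¹ ≈ (q (- h) ∙ p h ⁻¹) ∙ (q h ∙ q h)
        split = begin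
          q h ∙ p h ⁻¹                       ≈⟨ ⟷-⁻¹ (⟷-sym (Q .p⟷q h h)) ⟩
          p h ⁻¹ ∙ q h                       ≈⟨ identityˡ _ ⟨
          ε ∙ (p h ⁻¹ ∙ q h)                 ≈⟨ cancel-middle ε _ (neg-inverseˡ (Q .q+) h) ⟨
          ε ∙ (q (- h) ∙ (q h ∙ (p h ⁻¹ ∙ q h)))  ≈⟨ ∙-congˡ (∙-congˡ (swap _ (⟷-⁻¹ (⟷-sym (Q .p⟷q h h))))) ⟩
          ε ∙ (q (- h) ∙ (p h ⁻¹ ∙ (q h ∙ q h)))  ≈⟨ solve monoid ⟩
          (q (- h) ∙ p h ⁻¹) ∙ (q h ∙ q h)   ∎

      β⟷p : ∀ x y w → β y w ⟷ p x
      β⟷p x y w = ⟷-cong refl (⁻¹-involutive (p x)) (⟷-⁻¹ (⟷-cancel (β⟷qp⁻¹₊ x y w) (β⟷q x y w)))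

      -- Expanding p(x + y) puts `β y w` between v⁻¹ p(x) v and p(x)⁻¹; since β commutes with p, it
      -- can be moved to the end.
      β-additive : ∀ w → IsAdditive (λ x → β x w)
      β-additive w .cong x≈y = β-cong x≈y reflᴬ
      β-additive w .homo x y = begin
        V ⁻¹ ∙ (p (x + y) ∙ V) ∙ p (x + y) ⁻¹
          ≈⟨ ∙-cong (∙-congˡ (∙-congʳ (Q .p+ .homo x y)))
                    (trans (⁻¹-cong (Q .p+ .homo x y)) (⁻¹-anti-homo-∙ (p x) (p y))) ⟩
        V ⁻¹ ∙ ((p x ∙ p y) ∙ V) ∙ (p y ⁻¹ ∙ p x ⁻¹)
          ≈⟨ solve monoid ⟩
        (V ⁻¹ ∙ p x) ∙ (p y ∙ V ∙ p y ⁻¹ ∙ p x ⁻¹)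
          ≈⟨ cancel-middle _ _ (inverseʳ V) ⟨
        (V ⁻¹ ∙ p x) ∙ (V ∙ (V ⁻¹ ∙ (p y ∙ V ∙ p y ⁻¹ ∙ p x ⁻¹)))
          ≈⟨ solve monoid ⟩
        V ⁻¹ ∙ (p x ∙ V) ∙ (β y w ∙ p x ⁻¹)
          ≈⟨ ∙-congˡ (⟷-⁻¹ (β⟷p x y w)) ⟩
        V ⁻¹ ∙ (p x ∙ V) ∙ (p x ⁻¹ ∙ β y w)
          ≈⟨ assoc _ _ _ ⟨
        β x w ∙ β y w ∎
        where
        V : Carrier
        V = v w

  module _ {p q s v : A → Carrier} (Q : Quadruple p q s v) (½ : A) (½+½≈1 : ½ + ½ ≈ᴬ 1#) where
    private
      Q* : Quadruple s v p q
      Q* = swap-quadruple Q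

      B B* : A → A → Carrier
      B  = β Q
      B* = β Q*

      b⟷p : ∀ x y w → B y w ⟷ p x
      b⟷p = β⟷p Q ½ ½+½≈1
      b⟷q : ∀ x y w → B y w ⟷ q x
      b⟷q = β⟷q Q ½ ½+½≈1
      b*⟷s : ∀ x y w → B* y w ⟷ s x
      b*⟷s = β⟷p Q* ½ ½+½≈1
      b*⟷v : ∀ x y w → B* y w ⟷ v x
      b*⟷v = β⟷q Q* ½ ½+½≈1

    -- In `exchange`, P S V W = W S V P, the factor P is carried to the right end of the left side,
    -- past S for free and past V at the cost of b. On the right side W is carried past S at the
    -- cost of b*⁻¹. Then S and P cancel.
    vqβ : ∀ x t z → v (t * z) ∙ (q (x * t) ∙ B x (t * z)) ≈ q (x * t) ∙ (v (t * z) ∙ B* z (x * t) ⁻¹)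
    vqβ x t z = ∙-cancelʳ P _ _ (∙-cancelˡ S _ _ (begin
      S ∙ (V ∙ (W ∙ b) ∙ P)              ≈⟨ solve monoid ⟩
      S ∙ V ∙ (W ∙ (b ∙ P))              ≈⟨ ∙-congˡ (⟷-∙ (⟷-sym (b⟷q _ x _)) (⟷-sym (Q .p⟷q x _))) ⟩
      S ∙ V ∙ ((b ∙ P) ∙ W)              ≈⟨ solve monoid ⟩
      S ∙ ((V ∙ (b ∙ P)) ∙ W)            ≈⟨ ∙-congˡ (∙-congʳ (sym (straighten P V))) ⟩
      S ∙ ((P ∙ V) ∙ W)                  ≈⟨ solve monoid ⟩
      S ∙ (P ∙ (V ∙ W))                  ≈⟨ swap _ (Q .p⟷s x z) ⟨
      P ∙ (S ∙ (V ∙ W))                  ≈⟨ exchange Q x t z ⟩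
      W ∙ (S ∙ (V ∙ P))                  ≈⟨ solve monoid ⟩
      W ∙ S ∙ (V ∙ P)                    ≈⟨ ∙-congʳ WS ⟩
      S ∙ W ∙ b* ⁻¹ ∙ (V ∙ P)            ≈⟨ solve monoid ⟩
      S ∙ (W ∙ ((b* ⁻¹ ∙ V) ∙ P))        ≈⟨ ∙-congˡ (∙-congˡ (∙-congʳ (⟷-⁻¹ (⟷-sym (b*⟷v _ z _))))) ⟨
      S ∙ (W ∙ ((V ∙ b* ⁻¹) ∙ P))        ≈⟨ solve monoid ⟩
      S ∙ (W ∙ (V ∙ b* ⁻¹) ∙ P)          ∎))
      where
      P S V W b b* : Carrier
      P  = p x
      S  = s z
      V  = v (t * z)
      W  = q (x * t)
      b  = B x (t * z)
      b* = B* z (x * t)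

      straighten : ∀ g h → g ∙ h ≈ h ∙ ((h ⁻¹ ∙ (g ∙ h) ∙ g ⁻¹) ∙ g)
      straighten g h = begin
        g ∙ h                                      ≈⟨ solve monoid ⟩
        ε ∙ ((g ∙ h) ∙ ε)                          ≈⟨ cancel-middle ε _ (inverseʳ h) ⟨
        ε ∙ (h ∙ (h ⁻¹ ∙ ((g ∙ h) ∙ ε)))           ≈⟨ ∙-congˡ (∙-congˡ (∙-congˡ (∙-congˡ (inverseˡ g)))) ⟨
        ε ∙ (h ∙ (h ⁻¹ ∙ ((g ∙ h) ∙ (g ⁻¹ ∙ g))))  ≈⟨ solve monoid ⟩
        h ∙ ((h ⁻¹ ∙ (g ∙ h) ∙ g ⁻¹) ∙ g)          ∎

      WS : W ∙ S ≈ S ∙ W ∙ b* ⁻¹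
      WS = ∙-cancelʳ b* _ _ (begin
        W ∙ S ∙ b*             ≈⟨ assoc _ _ _ ⟩
        W ∙ (S ∙ b*)           ≈⟨ ∙-congˡ (b*⟷s _ z _) ⟨
        W ∙ (b* ∙ S)           ≈⟨ straighten S W ⟨
        S ∙ W                  ≈⟨ identityʳ _ ⟨
        S ∙ W ∙ ε              ≈⟨ ∙-congˡ (inverseˡ b*) ⟨
        S ∙ W ∙ (b* ⁻¹ ∙ b*)   ≈⟨ assoc _ _ _ ⟨
        S ∙ W ∙ b* ⁻¹ ∙ b*     ∎)

    [v,q] : ∀ x t z → v (t * z) ∙ (q (x * t) ∙ (B x (t * z) ∙ B* z (x * t))) ≈ q (x * t) ∙ v (t * z)
    [v,q] x t z = begin
      V ∙ (W ∙ (b ∙ b*))         ≈⟨ solve monoid ⟩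
      V ∙ (W ∙ b) ∙ b*           ≈⟨ ∙-congʳ (vqβ x t z) ⟩
      W ∙ (V ∙ b* ⁻¹) ∙ b*       ≈⟨ solve monoid ⟩
      W ∙ V ∙ (b* ⁻¹ ∙ b*)       ≈⟨ ∙-congˡ (inverseˡ b*) ⟩
      W ∙ V ∙ ε                  ≈⟨ identityʳ _ ⟩
      W ∙ V                      ∎
      where
      V W b b* : Carrier
      V  = v (t * z)
      W  = q (x * t)
      b  = B x (t * z)
      b* = B* z (x * t)

    -- Changing the signs of x, t and z inverts β and β* but not v and q.
    β²β*² : ∀ x t z → B (x + x) (t * z) ∙ B* (z + z) (x * t) ≈ ε
    β²β*² x t z = begin
      B (x + x) (t * z) ∙ B* (z + z) (x * t)  ≈⟨ ∙-cong (B+ .homo x x) (B*+ .homo z z) ⟩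
      (b ∙ b) ∙ (b* ∙ b*)                     ≈⟨ solve monoid ⟩
      b ∙ (b ∙ b*) ∙ b*                       ≈⟨ ∙-congʳ (∙-congˡ inverted) ⟩
      b ∙ (b ⁻¹ ∙ b* ⁻¹) ∙ b*                 ≈⟨ solve monoid ⟩
      b ∙ (b ⁻¹ ∙ (b* ⁻¹ ∙ b*))               ≈⟨ ∙-congˡ (∙-congˡ (inverseˡ b*)) ⟩
      b ∙ (b ⁻¹ ∙ ε)                          ≈⟨ ∙-congˡ (identityʳ _) ⟩
      b ∙ b ⁻¹                                ≈⟨ inverseʳ b ⟩
      ε                                       ∎
      where
      B+ : IsAdditive (λ x → B x (t * z))
      B+ = β-additive Q ½ ½+½≈1 (t * z)

      B*+ : IsAdditive (λ z → B* z (x * t))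
      B*+ = β-additive Q* ½ ½+½≈1 (x * t)

      b b* : Carrier
      b  = B x (t * z)
      b* = B* z (x * t)

      neg-neg : ∀ y y′ → (- y) * (- y′) ≈ᴬ y * y′
      neg-neg y y′ = transᴬ (symᴬ (-‿distribˡ-* y (- y′)))
                            (transᴬ (-‿cong (symᴬ (-‿distribʳ-* y y′))) (-‿involutive _))

      inverted : b ∙ b* ≈ b ⁻¹ ∙ b* ⁻¹
      inverted = ∙-cancelˡ (q (x * t)) _ _ (∙-cancelˡ (v (t * z)) _ _ (begin
        v (t * z) ∙ (q (x * t) ∙ (b ∙ b*))
          ≈⟨ [v,q] x t z ⟩
        q (x * t) ∙ v (t * z)
          ≈⟨ ∙-cong (Q .q+ .cong (neg-neg x t)) (Q .v+ .cong (neg-neg t z)) ⟨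
        q (- x * - t) ∙ v (- t * - z)
          ≈⟨ [v,q] (- x) (- t) (- z) ⟨
        v (- t * - z) ∙ (q (- x * - t) ∙ (B (- x) (- t * - z) ∙ B* (- z) (- x * - t)))
          ≈⟨ ∙-cong (Q .v+ .cong (neg-neg t z)) (∙-cong (Q .q+ .cong (neg-neg x t))
               (∙-cong (β-cong Q ½ ½+½≈1 reflᴬ (neg-neg t z)) (β-cong Q* ½ ½+½≈1 reflᴬ (neg-neg x t)))) ⟩
        v (t * z) ∙ (q (x * t) ∙ (B (- x) (t * z) ∙ B* (- z) (x * t)))
          ≈⟨ ∙-congˡ (∙-congˡ (∙-cong (neg B+ x) (neg B*+ z))) ⟩
        v (t * z) ∙ (q (x * t) ∙ (b ⁻¹ ∙ b* ⁻¹)) ∎))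

    -- At t = 1 the error term in `[v,q]` is `B x z` ∙ `B* z x`. It is trivial by `β²β*²` at x/2, 2,
    -- z/2: the first arguments double to x and z, and the factor t = 2 undoes the halving in the
    -- second ones.
    q⟷v : ∀ x z → q x ⟷ v z
    q⟷v x z = begin
      q x ∙ v z               ≈⟨ ∙-cong (Q .q+ .cong (*-identityʳ x)) (Q .v+ .cong (*-identityˡ z)) ⟨
      q (x * 1#) ∙ v (1# * z) ≈⟨ [v,q] x 1# z ⟨
      v (1# * z) ∙ (q (x * 1#) ∙ (B x (1# * z) ∙ B* z (x * 1#)))
        ≈⟨ ∙-congˡ (∙-congˡ (∙-cong (β-cong Q ½ ½+½≈1 (halve Q ½ ½+½≈1 x) (scale z))
                                    (β-cong Q* ½ ½+½≈1 (halve Q ½ ½+½≈1 z) (scale′ x)))) ⟩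
      v (1# * z) ∙ (q (x * 1#) ∙ (B (½ * x + ½ * x) ((1# + 1#) * (½ * z)) ∙ B* (½ * z + ½ * z) (½ * x * (1# + 1#))))
        ≈⟨ ∙-congˡ (∙-congˡ (β²β*² (½ * x) (1# + 1#) (½ * z))) ⟩
      v (1# * z) ∙ (q (x * 1#) ∙ ε) ≈⟨ ∙-congˡ (identityʳ _) ⟩
      v (1# * z) ∙ q (x * 1#) ≈⟨ ∙-cong (Q .v+ .cong (*-identityˡ z)) (Q .q+ .cong (*-identityʳ x)) ⟩
      v z ∙ q x               ∎
      where
      scale : ∀ z → 1# * z ≈ᴬ (1# + 1#) * (½ * z)
      scale z = transᴬ (*-identityˡ z) (transᴬ (halve Q ½ ½+½≈1 z) (symᴬ
        (transᴬ (distribʳ (½ * z) 1# 1#) (+-cong (*-identityˡ _) (*-identityˡ _)))))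

      scale′ : ∀ x → x * 1# ≈ᴬ ½ * x * (1# + 1#)
      scale′ x = transᴬ (*-comm x 1#) (transᴬ (scale x) (*-comm _ _))

-- Row and column entries, the central corner and normal forms.

module Core (R : CommutativeRing ρ ℓ) (Γ : Group γ ℓ′) where
  open CommutativeRing R
    using (_+_; _*_; -_; 0#; 1#; +-cong; +-congˡ; -‿cong; -‿inverseˡ; +-identityˡ; +-identityʳ; +-assoc; +-comm;
           *-congʳ; *-congˡ; *-identityˡ; *-identityʳ; zeroˡ; zeroʳ)
    renaming (Carrier to A; _≈_ to _≈ᴬ_; refl to reflᴬ; sym to symᴬ; trans to transᴬ)
  open RingProperties (CommutativeRing.ring R) using (-‿involutive)
  open Matrices R
  open Unitriangular
  open IsUnitriangular
  open Linear R
  open Group Γ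
  open GroupProperties Γ
  open Commuting Γ
  open Additive R Γ
  open IsAdditive
  open import Relation.Binary.Reasoning.Setoid setoid

  -- These are relations that hold inside single block subgroups: rows and the middle block in `K`
  -- at κ = d, columns and the middle block at κ = 0. In `disjoint` the block is κ = l, where row
  -- entry k and column entry l lie in different diagonal blocks.
  record Action (d : ℕ) : Set (ρ ⊔ ℓ ⊔ γ ⊔ ℓ′) where
    field
      row col   : Vec d → Carrier
      unip      : Unitriangular d → Carrier
      row-cong  : ∀ {r r′} → r ≈ᵛ r′ → row r ≈ row r′
      row-homo  : ∀ r r′ → row (r +ᵛ r′) ≈ row r ∙ row r′
      col-cong  : ∀ {c c′} → c ≈ᵛ c′ → col c ≈ col c′
      col-homo  : ∀ c c′ → col (c +ᵛ c′) ≈ col c ∙ col c′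
      unip-homo : ∀ g h → unip (Group._∙_ (Unip d) g h) ≈ unip g ∙ unip h
      row-unip  : ∀ r g → row r ∙ unip g ≈ unip g ∙ row (r ⊲ matrix g)
      unip-col  : ∀ g c → unip g ∙ col c ≈ col (matrix g ⊳ c) ∙ unip g
      disjoint  : ∀ {k l : Fin d} → k Fin.< l → ∀ x y → row (δ k x) ⟷ col (δ l y)

    R-additive : ∀ k → IsAdditive (λ x → row (δ k x))
    R-additive k .cong x≈y = row-cong (δ-cong k x≈y)
    R-additive k .homo x y = trans (row-cong (δ-+ k x y)) (row-homo _ _)

    C-additive : ∀ k → IsAdditive (λ x → col (δ k x))
    C-additive k .cong x≈y = col-cong (δ-cong k x≈y)
    C-additive k .homo x y = trans (col-cong (δ-+ k x y)) (col-homo _ _)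

    row-commute : ∀ r r′ → row r ⟷ row r′
    row-commute r r′ = trans (sym (row-homo r r′)) (trans (row-cong λ i → +-comm (r i) (r′ i)) (row-homo r′ r))

    col-commute : ∀ c c′ → col c ⟷ col c′
    col-commute c c′ = trans (sym (col-homo c c′)) (trans (col-cong λ i → +-comm (c i) (c′ i)) (col-homo c′ c))

    row-0 : row 0ᵛ ≈ ε
    row-0 = identityˡ-unique _ _ (trans (sym (row-homo 0ᵛ 0ᵛ)) (row-cong λ _ → +-identityˡ 0#))

    col-0 : col 0ᵛ ≈ ε
    col-0 = identityˡ-unique _ _ (trans (sym (col-homo 0ᵛ 0ᵛ)) (col-cong λ _ → +-identityˡ 0#))

    row-col-unip : ∀ r g c → row r ∙ col (matrix g ⊳ c) ∙ unip g ≈ unip g ∙ (row (r ⊲ matrix g) ∙ col c)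
    row-col-unip r g c = begin
      row r ∙ col (matrix g ⊳ c) ∙ unip g    ≈⟨ assoc _ _ _ ⟩
      row r ∙ (col (matrix g ⊳ c) ∙ unip g)  ≈⟨ ∙-congˡ (unip-col g c) ⟨
      row r ∙ (unip g ∙ col c)               ≈⟨ assoc _ _ _ ⟨
      row r ∙ unip g ∙ col c                 ≈⟨ ∙-congʳ (row-unip r g) ⟩
      unip g ∙ row (r ⊲ matrix g) ∙ col c    ≈⟨ assoc _ _ _ ⟩
      unip g ∙ (row (r ⊲ matrix g) ∙ col c)  ∎

    col-row-unip : ∀ r g c → col (matrix g ⊳ c) ∙ row r ∙ unip g ≈ unip g ∙ (col c ∙ row (r ⊲ matrix g))
    col-row-unip r g c = begin
      col (matrix g ⊳ c) ∙ row r ∙ unip g    ≈⟨ assoc _ _ _ ⟩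
      col (matrix g ⊳ c) ∙ (row r ∙ unip g)  ≈⟨ ∙-congˡ (row-unip r g) ⟩
      col (matrix g ⊳ c) ∙ (unip g ∙ row (r ⊲ matrix g))  ≈⟨ assoc _ _ _ ⟨
      col (matrix g ⊳ c) ∙ unip g ∙ row (r ⊲ matrix g)  ≈⟨ ∙-congʳ (unip-col g c) ⟨
      unip g ∙ col c ∙ row (r ⊲ matrix g)    ≈⟨ assoc _ _ _ ⟩
      unip g ∙ (col c ∙ row (r ⊲ matrix g))  ∎

    ⟷-conjugate : ∀ r g c → row r ⟷ col (matrix g ⊳ c) → row (r ⊲ matrix g) ⟷ col c
    ⟷-conjugate r g c rc = ∙-cancelˡ (unip g) _ _
      (trans (sym (row-col-unip r g c)) (trans (∙-congʳ rc) (col-row-unip r g c)))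

    ⟷-conjugate⁻¹ : ∀ r g c → row (r ⊲ matrix g) ⟷ col c → row r ⟷ col (matrix g ⊳ c)
    ⟷-conjugate⁻¹ r g c rc = ∙-cancelʳ (unip g) _ _
      (trans (row-col-unip r g c) (trans (∙-congˡ rc) (sym (col-row-unip r g c))))

    -- Conjugation by e_{j,l}(1) fixes row entry k and turns column entry l into the sum of entries
    -- l and j. So column entry j is a quotient of two elements that commute with the row entry.
    spread-col : ∀ {j k l : Fin d} → j Fin.< l → k ≢ j →
                 (∀ x y → row (δ k x) ⟷ col (δ l y)) → ∀ x y → row (δ k x) ⟷ col (δ j y)
    spread-col {j} {k} {l} j<l k≢j comm x y = ⟷-cancel (⟷-cong refl
        (trans (col-cong λ i → transᴬ (elementary-⊳ (δ l y) j≢l 1# i)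
                 (+-congˡ (δ-cong j (transᴬ (*-identityˡ _) (δ-diag l y)) i)))
               (col-homo _ _))
        (⟷-conjugate⁻¹ (δ k x) (e j l j<l 1#) (δ l y)
          (⟷-cong (row-cong λ i → symᴬ (fixed i)) refl (comm x y))))
      (comm x y)
      where
      j≢l : j ≢ l
      j≢l = Finₚ.<⇒≢ j<l

      fixed : δ k x ⊲ elementary j l 1# ≈ᵛ δ k x
      fixed i = transᴬ (⊲-elementary (δ k x) j≢l 1# i) (transᴬ (+-congˡ
        (transᴬ (δ-cong l (transᴬ (*-congʳ (δ-off x (k≢j ∘ ≡.sym))) (zeroˡ 1#)) i) (δ-0 l i)))
        (+-identityʳ _))

    -- Dually, conjugation by e_{k,l}(1) fixes column entry j and adds entry l to row entry k.
    spread-row : ∀ {j k l : Fin d} → k Fin.< l → j ≢ l →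
                 (∀ x y → row (δ k x) ⟷ col (δ j y)) → ∀ x y → row (δ l x) ⟷ col (δ j y)
    spread-row {j} {k} {l} k<l j≢l comm x y = ⟷-sym (⟷-cancel (⟷-sym (⟷-cong
        (trans (row-cong λ i → transᴬ (⊲-elementary (δ k x) k≢l 1# i)
                 (+-congˡ (δ-cong l (transᴬ (*-identityʳ _) (δ-diag k x)) i)))
               (row-homo _ _))
        refl
        (⟷-conjugate (δ k x) (e k l k<l 1#) (δ j y)
          (⟷-cong refl (col-cong λ i → symᴬ (fixed i)) (comm x y)))))
      (⟷-sym (comm x y)))
      where
      k≢l : k ≢ l
      k≢l = Finₚ.<⇒≢ k<l

      fixed : elementary k l 1# ⊳ δ j y ≈ᵛ δ j y
      fixed i = transᴬ (elementary-⊳ (δ j y) k≢l 1# i) (transᴬ (+-congˡ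
        (transᴬ (δ-cong k (transᴬ (*-congˡ (δ-off y (j≢l ∘ ≡.sym))) (zeroʳ 1#)) i) (δ-0 k i)))
        (+-identityʳ _))

    -- The relation `disjoint` for k < l, conjugated by e_{k,l}(t).
    rowrow⟷colcol : ∀ {k l : Fin d} → k Fin.< l → ∀ x t z →
      row (δ k x) ∙ row (δ l (x * t)) ⟷ col (δ l z) ∙ col (δ k (- (t * z)))
    rowrow⟷colcol {k} {l} k<l x t z = ⟷-cong
      (trans (row-cong λ i → transᴬ (⊲-elementary (δ k x) k≢l t i)
               (+-congˡ (δ-cong l (*-congʳ (δ-diag k x)) i)))
             (row-homo _ _))
      (col-homo _ _)
      (⟷-conjugate (δ k x) (e k l k<l t) c (⟷-cong refl (col-cong λ i → symᴬ (moved i)) (disjoint k<l x z)))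
      where
      k≢l : k ≢ l
      k≢l = Finₚ.<⇒≢ k<l

      -- The preimage of `δ l z` under e_{k,l}(t); hence the minus sign.
      c : Vec d
      c = δ l z +ᵛ δ k (- (t * z))

      cₗ : c l ≈ᴬ z
      cₗ = transᴬ (+-cong (δ-diag l z) (δ-off _ (k≢l ∘ ≡.sym))) (+-identityʳ z)

      moved : elementary k l t ⊳ c ≈ᵛ δ l z
      moved i = transᴬ (elementary-⊳ c k≢l t i) (transᴬ (+-assoc _ _ _) (transᴬ (+-congˡ
        (transᴬ (symᴬ (δ-+ k _ _ i)) (transᴬ (δ-cong k
          (transᴬ (+-congˡ (*-congˡ cₗ)) (-‿inverseˡ _)) i) (δ-0 k i)))) (+-identityʳ _)))

  OffDiagonal : Action d → Set _
  OffDiagonal {d} 𝒜 = ∀ {k l : Fin d} → k ≢ l → ∀ x y → row (δ k x) ⟷ col (δ l y)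
    where open Action 𝒜

  -- For l < k < ω start from column ω, where `disjoint` applies, and move the column to l. Row ω is
  -- reached from row 0 in the columns strictly between 0 and ω, and then column 0 from column 1.
  -- The index 1 ≠ ω is what two indices do not provide.
  off-diagonal₃ : (𝒜 : Action (suc (suc (suc d)))) → OffDiagonal 𝒜
  off-diagonal₃ {d} 𝒜 {k} {l} k≢l = case Finₚ.<-cmp k l of λ where
      (tri< k<l _ _) → disjoint k<l
      (tri≈ _ k≡l _) → contradiction k≡l k≢l
      (tri> _ _ l<k) → case k Finₚ.≟ ω of λ where
        (no k≢ω)     → let k<ω = Finₚ.≤∧≢⇒< (Finₚ.≤fromℕ k) k≢ω in
                       spread-col (Finₚ.<-trans l<k k<ω) k≢l (disjoint k<ω)
        (yes ≡.refl) → last l k≢l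
    where
    open Action 𝒜

    ω : Fin (suc (suc (suc d)))
    ω = fromℕ (suc (suc d))

    last-suc : ∀ l → suc l ≢ ω → ∀ x y → row (δ ω x) ⟷ col (δ (suc l) y)
    last-suc l l≢ω = spread-row {k = zero} (ℕ.s≤s ℕ.z≤n) l≢ω (disjoint (ℕ.s≤s ℕ.z≤n))

    last : ∀ l → ω ≢ l → ∀ x y → row (δ ω x) ⟷ col (δ l y)
    last zero    _   = spread-col {l = suc zero} (ℕ.s≤s ℕ.z≤n) (λ ()) (last-suc zero λ ())
    last (suc l) ω≢l = last-suc l (ω≢l ∘ ≡.sym)

  off-diagonal₂ : (½ : A) → ½ + ½ ≈ᴬ 1# → (𝒜 : Action 2) → OffDiagonal 𝒜
  off-diagonal₂ ½ ½+½≈1 𝒜 {zero}     {zero}     k≢l = contradiction ≡.refl k≢l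
  off-diagonal₂ ½ ½+½≈1 𝒜 {zero}     {suc zero} k≢l = Action.disjoint 𝒜 (ℕ.s≤s ℕ.z≤n)
  off-diagonal₂ ½ ½+½≈1 𝒜 {suc zero} {suc zero} k≢l = contradiction ≡.refl k≢l
  off-diagonal₂ ½ ½+½≈1 𝒜 {suc zero} {zero}     k≢l = q⟷v quadruple ½ ½+½≈1
    where
    open Action 𝒜

    quadruple : Quadruple (λ x → row (δ zero x)) (λ x → row (δ (suc zero) x))
                          (λ x → col (δ (suc zero) x)) (λ x → col (δ zero x))
    quadruple = record
      { p+ = R-additive zero
      ; q+ = R-additive (suc zero)
      ; s+ = C-additive (suc zero)
      ; v+ = C-additive zero
      ; p⟷q = λ _ _ → row-commute _ _
      ; s⟷v = λ _ _ → col-commute _ _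
      ; p⟷s = disjoint (ℕ.s≤s ℕ.z≤n)
      ; pq⟷sv = rowrow⟷colcol (ℕ.s≤s ℕ.z≤n)
      }

  module Corner (𝒜 : Action (suc (suc d))) (off-diagonal : OffDiagonal 𝒜) where
    open Action 𝒜

    private
      R′ C′ : Fin (suc (suc d)) → A → Carrier
      R′ k x = row (δ k x)
      C′ k x = col (δ k x)

    -- The element of Γ that stands for the corner entry x w: the commutator of row entry 0 and
    -- column entry 0.
    P : A → A → Carrier
    P x w = R′ zero x ∙ C′ zero w ∙ (C′ zero w ∙ R′ zero x) ⁻¹

    P-commutator : ∀ x w → R′ zero x ∙ C′ zero w ≈ P x w ∙ (C′ zero w ∙ R′ zero x)
    P-commutator x w = begin
      R′ zero x ∙ C′ zero w       ≈⟨ identityʳ _ ⟨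
      R′ zero x ∙ C′ zero w ∙ ε   ≈⟨ ∙-congˡ (inverseˡ _) ⟨
      R′ zero x ∙ C′ zero w ∙ ((C′ zero w ∙ R′ zero x) ⁻¹ ∙ (C′ zero w ∙ R′ zero x)) ≈⟨ assoc _ _ _ ⟨
      P x w ∙ (C′ zero w ∙ R′ zero x) ∎

    P-cong : ∀ {x x′ w w′} → x ≈ᴬ x′ → w ≈ᴬ w′ → P x w ≈ P x′ w′
    P-cong x≈ w≈ = ∙-cong (∙-cong r≈ c≈) (⁻¹-cong (∙-cong c≈ r≈))
      where
      r≈ = R-additive zero .cong x≈
      c≈ = C-additive zero .cong w≈

    -- All pairs with different indices in `rowrow⟷colcol` for 0 < l + 1 commute, so that relation
    -- compares the commutator at index l + 1 with the one at index 0.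
    P-transfer : ∀ l x t z → R′ (suc l) (x * t) ∙ C′ (suc l) z ∙ P x (- (t * z)) ≈
                             C′ (suc l) z ∙ R′ (suc l) (x * t)
    P-transfer l x t z = ∙-cancelʳ (v ∙ p) _ _ (begin
      q ∙ s ∙ P x (- (t * z)) ∙ (v ∙ p)     ≈⟨ assoc _ _ _ ⟩
      q ∙ s ∙ (P x (- (t * z)) ∙ (v ∙ p))   ≈⟨ ∙-congˡ (P-commutator x _) ⟨
      q ∙ s ∙ (p ∙ v)                       ≈⟨ solve monoid ⟩
      q ∙ ((s ∙ p) ∙ v)                     ≈⟨ ∙-congˡ (∙-congʳ (off-diagonal (λ ()) _ _)) ⟨
      q ∙ ((p ∙ s) ∙ v)                     ≈⟨ solve monoid ⟩
      (q ∙ p) ∙ (s ∙ v)                     ≈⟨ ∙-congʳ (row-commute _ _) ⟩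
      (p ∙ q) ∙ (s ∙ v)                     ≈⟨ rowrow⟷colcol (ℕ.s≤s ℕ.z≤n) x t z ⟩
      (s ∙ v) ∙ (p ∙ q)                     ≈⟨ ∙-congˡ (row-commute _ _) ⟩
      (s ∙ v) ∙ (q ∙ p)                     ≈⟨ solve monoid ⟩
      s ∙ ((v ∙ q) ∙ p)                     ≈⟨ ∙-congˡ (∙-congʳ (off-diagonal (λ ()) _ _)) ⟨
      s ∙ ((q ∙ v) ∙ p)                     ≈⟨ solve monoid ⟩
      s ∙ q ∙ (v ∙ p)                       ∎)
      where
      p q s v : Carrier
      p = R′ zero x
      q = R′ (suc l) (x * t)
      s = C′ (suc l) z
      v = C′ zero (- (t * z))

    -- By `P-transfer` at t = 1, P is a commutator at every index, so commuting with the entries at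
    -- a single index suffices. Every row or column entry differs in index from 0 or from 1, which
    -- makes P commute with all of them.
    P-centralised : ∀ {g} k → (∀ x → g ⟷ R′ k x) → (∀ x → g ⟷ C′ k x) → ∀ x w → g ⟷ P x w
    P-centralised zero    gR gC x w =
      ⟷-∙ (⟷-∙ (gR x) (gC w)) (⟷-⁻¹ (⟷-∙ (gC w) (gR x)))
    P-centralised (suc l) gR gC x w = ⟷-cong refl (P-cong reflᴬ w≈)
      (⟷-cancel (⟷-cong refl (sym (P-transfer l x 1# (- w))) (⟷-∙ (gC _) (gR _)))
                (⟷-∙ (gR _) (gC _)))
      where
      w≈ : - (1# * - w) ≈ᴬ w
      w≈ = transᴬ (-‿cong (*-identityˡ _)) (-‿involutive w)

    P⟷R : ∀ x w k y → P x w ⟷ R′ k y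
    P⟷R x w zero    y = ⟷-sym (P-centralised (suc zero)
      (λ _ → row-commute _ _) (λ _ → off-diagonal (λ ()) _ _) x w)
    P⟷R x w (suc k) y = ⟷-sym (P-centralised zero
      (λ _ → row-commute _ _) (λ _ → off-diagonal (λ ()) _ _) x w)

    P⟷C : ∀ x w k y → P x w ⟷ C′ k y
    P⟷C x w zero    y = ⟷-sym (P-centralised (suc zero)
      (λ _ → ⟷-sym (off-diagonal (λ ()) _ _)) (λ _ → col-commute _ _) x w)
    P⟷C x w (suc k) y = ⟷-sym (P-centralised zero
      (λ _ → ⟷-sym (off-diagonal (λ ()) _ _)) (λ _ → col-commute _ _) x w)

    P-additive : ∀ x → IsAdditive (P x)
    P-additive x .cong = P-cong reflᴬ
    P-additive x .homo w w′ = ∙-cancelʳ (C′ zero (w + w′) ∙ p) _ _ (begin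
      P x (w + w′) ∙ (C′ zero (w + w′) ∙ p)   ≈⟨ P-commutator x _ ⟨
      p ∙ C′ zero (w + w′)                    ≈⟨ ∙-congˡ (C-additive zero .homo w w′) ⟩
      p ∙ (v ∙ v′)                            ≈⟨ assoc _ _ _ ⟨
      p ∙ v ∙ v′                              ≈⟨ ∙-congʳ (P-commutator x w) ⟩
      P x w ∙ (v ∙ p) ∙ v′                    ≈⟨ solve monoid ⟩
      P x w ∙ (v ∙ (p ∙ v′))                  ≈⟨ ∙-congˡ (∙-congˡ (P-commutator x w′)) ⟩
      P x w ∙ (v ∙ (P x w′ ∙ (v′ ∙ p)))       ≈⟨ ∙-congˡ (swap _ (⟷-sym (P⟷C x w′ zero w))) ⟩
      P x w ∙ (P x w′ ∙ (v ∙ (v′ ∙ p)))       ≈⟨ solve monoid ⟩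
      P x w ∙ P x w′ ∙ ((v ∙ v′) ∙ p)         ≈⟨ ∙-congˡ (∙-congʳ (C-additive zero .homo w w′)) ⟨
      P x w ∙ P x w′ ∙ (C′ zero (w + w′) ∙ p) ∎)
      where
      p v v′ : Carrier
      p  = R′ zero x
      v  = C′ zero w
      v′ = C′ zero w′

    suc-commutator : ∀ l x t z → R′ (suc l) (x * t) ∙ C′ (suc l) z ≈
                                 C′ (suc l) z ∙ R′ (suc l) (x * t) ∙ P x (t * z)
    suc-commutator l x t z = begin
      q ∙ s                                            ≈⟨ identityʳ _ ⟨
      q ∙ s ∙ ε                                        ≈⟨ ∙-congˡ (neg-inverseˡ (P-additive x) _) ⟨
      q ∙ s ∙ (P x (- (t * z)) ∙ P x (t * z))          ≈⟨ assoc _ _ _ ⟨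
      q ∙ s ∙ P x (- (t * z)) ∙ P x (t * z)            ≈⟨ ∙-congʳ (P-transfer l x t z) ⟩
      s ∙ q ∙ P x (t * z)                              ∎
      where
      q s : Carrier
      q = R′ (suc l) (x * t)
      s = C′ (suc l) z

    Z : A → Carrier
    Z = P 1#

    suc-commutator-Z : ∀ l x z → R′ (suc l) x ∙ C′ (suc l) z ≈ C′ (suc l) z ∙ R′ (suc l) x ∙ Z (x * z)
    suc-commutator-Z l x z = begin
      R′ (suc l) x ∙ C′ (suc l) z                           ≈⟨ ∙-congʳ 1x ⟨
      R′ (suc l) (1# * x) ∙ C′ (suc l) z                    ≈⟨ suc-commutator l 1# x z ⟩
      C′ (suc l) z ∙ R′ (suc l) (1# * x) ∙ Z (x * z)        ≈⟨ ∙-congʳ (∙-congˡ 1x) ⟩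
      C′ (suc l) z ∙ R′ (suc l) x ∙ Z (x * z)               ∎
      where
      1x : R′ (suc l) (1# * x) ≈ R′ (suc l) x
      1x = R-additive (suc l) .cong (*-identityˡ x)

    -- The commutator of row entry x and column entry z at index 1 is computed twice, with x written
    -- as x * 1 and as 1 * x.
    P≈Z : ∀ x z → P x z ≈ Z (x * z)
    P≈Z x z = ∙-cancelˡ (s ∙ q) _ _ (begin
      s ∙ q ∙ P x z                    ≈⟨ ∙-cong (∙-congˡ x1) (P-cong reflᴬ (*-identityˡ z)) ⟨
      s ∙ R′ (suc zero) (x * 1#) ∙ P x (1# * z) ≈⟨ suc-commutator zero x 1# z ⟨
      R′ (suc zero) (x * 1#) ∙ s       ≈⟨ ∙-congʳ x1 ⟩
      q ∙ s                            ≈⟨ suc-commutator-Z zero x z ⟩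
      s ∙ q ∙ Z (x * z)                ∎)
      where
      q s : Carrier
      q = R′ (suc zero) x
      s = C′ (suc zero) z

      x1 : R′ (suc zero) (x * 1#) ≈ q
      x1 = R-additive (suc zero) .cong (*-identityʳ x)

    Z+ : IsAdditive Z
    Z+ = P-additive 1#

    row-col-δ : ∀ k x z → R′ k x ∙ C′ k z ≈ C′ k z ∙ R′ k x ∙ Z (x * z)
    row-col-δ (suc l) x z = suc-commutator-Z l x z
    row-col-δ zero    x z = begin
      R′ zero x ∙ C′ zero z                 ≈⟨ P-commutator x z ⟩
      P x z ∙ (C′ zero z ∙ R′ zero x)       ≈⟨ ⟷-∙ (P⟷C x z zero z) (P⟷R x z zero x) ⟩
      C′ zero z ∙ R′ zero x ∙ P x z         ≈⟨ ∙-congˡ (P≈Z x z) ⟩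
      C′ zero z ∙ R′ zero x ∙ Z (x * z)     ∎

    Z⟷row : ∀ y r → Z y ⟷ row r
    Z⟷row y r = vec-ind (λ r → Z y ⟷ row r) (λ v≈w → ⟷-cong refl (row-cong v≈w))
      (⟷-cong refl (sym row-0) ⟷-ε) (λ gv gw → ⟷-cong refl (sym (row-homo _ _)) (⟷-∙ gv gw))
      r (λ k → P⟷R 1# y k (r k))

    Z⟷col : ∀ y c → Z y ⟷ col c
    Z⟷col y c = vec-ind (λ c → Z y ⟷ col c) (λ v≈w → ⟷-cong refl (col-cong v≈w))
      (⟷-cong refl (sym col-0) ⟷-ε) (λ gv gw → ⟷-cong refl (sym (col-homo _ _)) (⟷-∙ gv gw))
      c (λ k → P⟷C 1# y k (c k))

    private
      Swap : Vec (suc (suc d)) → Vec (suc (suc d)) → Set ℓ′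
      Swap r c = row r ∙ col c ≈ col c ∙ row r ∙ Z (r · c)

      swap-cong : ∀ {r r′ c c′} → r ≈ᵛ r′ → c ≈ᵛ c′ → Swap r c → Swap r′ c′
      swap-cong {r} {r′} {c} {c′} r≈ c≈ rc = begin
        row r′ ∙ col c′                 ≈⟨ ∙-cong (row-cong r≈) (col-cong c≈) ⟨
        row r ∙ col c                   ≈⟨ rc ⟩
        col c ∙ row r ∙ Z (r · c)       ≈⟨ ∙-cong (∙-cong (col-cong c≈) (row-cong r≈)) (Z+ .cong (·-cong r≈ c≈)) ⟩
        col c′ ∙ row r′ ∙ Z (r′ · c′)   ∎

      swap-0ˡ : ∀ c → Swap 0ᵛ c
      swap-0ˡ c = begin
        row 0ᵛ ∙ col c                  ≈⟨ ∙-congʳ row-0 ⟩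
        ε ∙ col c                       ≈⟨ solve monoid ⟩
        col c ∙ ε ∙ ε                   ≈⟨ ∙-cong (∙-congˡ row-0) (trans (Z+ .cong (·-zeroˡ c)) (homo-0 Z+)) ⟨
        col c ∙ row 0ᵛ ∙ Z (0ᵛ · c)     ∎

      swap-0ʳ : ∀ r → Swap r 0ᵛ
      swap-0ʳ r = begin
        row r ∙ col 0ᵛ                  ≈⟨ ∙-congˡ col-0 ⟩
        row r ∙ ε                       ≈⟨ solve monoid ⟩
        ε ∙ row r ∙ ε                   ≈⟨ ∙-cong (∙-congʳ col-0) (trans (Z+ .cong (·-zeroʳ r)) (homo-0 Z+)) ⟨
        col 0ᵛ ∙ row r ∙ Z (r · 0ᵛ)     ∎

      swap-+ˡ : ∀ c {r r′} → Swap r c → Swap r′ c → Swap (r +ᵛ r′) c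
      swap-+ˡ c {r} {r′} rc r′c = begin
        row (r +ᵛ r′) ∙ col c                          ≈⟨ ∙-congʳ (row-homo r r′) ⟩
        (row r ∙ row r′) ∙ col c                       ≈⟨ assoc _ _ _ ⟩
        row r ∙ (row r′ ∙ col c)                       ≈⟨ ∙-congˡ r′c ⟩
        row r ∙ (col c ∙ row r′ ∙ Z (r′ · c))          ≈⟨ solve monoid ⟩
        (row r ∙ col c) ∙ (row r′ ∙ Z (r′ · c))        ≈⟨ ∙-congʳ rc ⟩
        (col c ∙ row r ∙ Z (r · c)) ∙ (row r′ ∙ Z (r′ · c)) ≈⟨ solve monoid ⟩
        (col c ∙ row r) ∙ (Z (r · c) ∙ (row r′ ∙ Z (r′ · c))) ≈⟨ ∙-congˡ (swap _ (Z⟷row _ _)) ⟩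
        (col c ∙ row r) ∙ (row r′ ∙ (Z (r · c) ∙ Z (r′ · c))) ≈⟨ solve monoid ⟩
        col c ∙ (row r ∙ row r′) ∙ (Z (r · c) ∙ Z (r′ · c))
          ≈⟨ ∙-cong (∙-congˡ (row-homo r r′)) (trans (Z+ .cong (·-distribʳ r r′ c)) (Z+ .homo _ _)) ⟨
        col c ∙ row (r +ᵛ r′) ∙ Z ((r +ᵛ r′) · c)      ∎

      swap-+ʳ : ∀ r {c c′} → Swap r c → Swap r c′ → Swap r (c +ᵛ c′)
      swap-+ʳ r {c} {c′} rc rc′ = begin
        row r ∙ col (c +ᵛ c′)                          ≈⟨ ∙-congˡ (col-homo c c′) ⟩
        row r ∙ (col c ∙ col c′)                       ≈⟨ assoc _ _ _ ⟨
        row r ∙ col c ∙ col c′                         ≈⟨ ∙-congʳ rc ⟩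
        col c ∙ row r ∙ Z (r · c) ∙ col c′             ≈⟨ solve monoid ⟩
        col c ∙ (row r ∙ (Z (r · c) ∙ col c′))         ≈⟨ ∙-congˡ (∙-congˡ (Z⟷col _ _)) ⟩
        col c ∙ (row r ∙ (col c′ ∙ Z (r · c)))         ≈⟨ solve monoid ⟩
        col c ∙ (row r ∙ col c′) ∙ Z (r · c)           ≈⟨ ∙-congʳ (∙-congˡ rc′) ⟩
        col c ∙ (col c′ ∙ row r ∙ Z (r · c′)) ∙ Z (r · c) ≈⟨ solve monoid ⟩
        col c ∙ col c′ ∙ row r ∙ (Z (r · c′) ∙ Z (r · c)) ≈⟨ ∙-congˡ (commutative Z+ _ _) ⟩
        col c ∙ col c′ ∙ row r ∙ (Z (r · c) ∙ Z (r · c′))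
          ≈⟨ ∙-cong (∙-congʳ (col-homo c c′)) (trans (Z+ .cong (·-distribˡ r c c′)) (Z+ .homo _ _)) ⟨
        col (c +ᵛ c′) ∙ row r ∙ Z (r · (c +ᵛ c′))      ∎

      swap-δ : ∀ k l x y → Swap (δ k x) (δ l y)
      swap-δ k l x y with k Finₚ.≟ l
      ... | yes ≡.refl = trans (row-col-δ k x y) (∙-congˡ (Z+ .cong (symᴬ (transᴬ (δ-· k x (δ k y)) (*-congˡ (δ-diag k y))))))
      ... | no  k≢l    = begin
        R′ k x ∙ C′ l y                        ≈⟨ off-diagonal k≢l x y ⟩
        C′ l y ∙ R′ k x                        ≈⟨ identityʳ _ ⟨
        C′ l y ∙ R′ k x ∙ ε                    ≈⟨ ∙-congˡ (homo-0 Z+) ⟨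
        C′ l y ∙ R′ k x ∙ Z 0#                 ≈⟨ ∙-congˡ (Z+ .cong (transᴬ (δ-· k x (δ l y))
                                                    (transᴬ (*-congˡ (δ-off y k≢l)) (zeroʳ x)))) ⟨
        C′ l y ∙ R′ k x ∙ Z (δ k x · δ l y)    ∎

    -- As Z commutes with rows and columns, the relation passes to sums in either argument. On
    -- coordinate vectors it is `row-col-δ` or `off-diagonal`.
    row-col : ∀ r c → row r ∙ col c ≈ col c ∙ row r ∙ Z (r · c)
    row-col r c = vec-ind (λ r → Swap r c) (λ r≈ → swap-cong r≈ λ _ → reflᴬ) (swap-0ˡ c) (swap-+ˡ c) r λ k →
      vec-ind (Swap (δ k (r k))) (λ c≈ → swap-cong (λ _ → reflᴬ) c≈) (swap-0ʳ _) (swap-+ʳ _) c λ l →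
        swap-δ k l (r k) (c l)

    -- Z y is the error in exchanging `row r` with `col (M ⊳ c)`. Conjugation by `unip g` turns
    -- these into `row (r ⊲ M)` and `col c`, whose error is the same, since r · (M c) = (r M) · c =
    -- y by M₀₀ = 1.
    Z⟷unip : ∀ y g → Z y ⟷ unip g
    Z⟷unip y g = ∙-cancelˡ (col (M ⊳ c) ∙ row r) _ _ (begin
      col (M ⊳ c) ∙ row r ∙ (Z y ∙ unip g)                 ≈⟨ ∙-congˡ (∙-congʳ (Z+ .cong y≈ˡ)) ⟨
      col (M ⊳ c) ∙ row r ∙ (Z (r · (M ⊳ c)) ∙ unip g)     ≈⟨ assoc _ _ _ ⟨
      col (M ⊳ c) ∙ row r ∙ Z (r · (M ⊳ c)) ∙ unip g       ≈⟨ ∙-congʳ (row-col r _) ⟨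
      row r ∙ col (M ⊳ c) ∙ unip g                         ≈⟨ row-col-unip r g c ⟩
      unip g ∙ (row (r ⊲ M) ∙ col c)                       ≈⟨ ∙-congˡ (row-col _ c) ⟩
      unip g ∙ (col c ∙ row (r ⊲ M) ∙ Z ((r ⊲ M) · c))     ≈⟨ assoc _ _ _ ⟨
      unip g ∙ (col c ∙ row (r ⊲ M)) ∙ Z ((r ⊲ M) · c)     ≈⟨ ∙-cong (col-row-unip r g c) (sym (Z+ .cong y≈ʳ)) ⟨
      col (M ⊳ c) ∙ row r ∙ unip g ∙ Z y                   ≈⟨ assoc _ _ _ ⟩
      col (M ⊳ c) ∙ row r ∙ (unip g ∙ Z y)                 ∎)
      where
      M : Mat (suc (suc d))
      M = matrix g

      r c : Vec (suc (suc d))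
      r = δ zero 1#
      c = δ zero y

      M₀₀ : M zero zero * y ≈ᴬ y
      M₀₀ = transᴬ (*-congʳ (isUnitriangular g .diagonal zero)) (*-identityˡ y)

      y≈ˡ : r · (M ⊳ c) ≈ᴬ y
      y≈ˡ = transᴬ (δ-· zero 1# (M ⊳ c)) (transᴬ (*-identityˡ _) (transᴬ (·-δ (M zero) zero y) M₀₀))

      y≈ʳ : (r ⊲ M) · c ≈ᴬ y
      y≈ʳ = transᴬ (·-δ (r ⊲ M) zero y) (transᴬ (*-congʳ (transᴬ (δ-· zero 1# (λ l → M l zero)) (*-identityˡ _))) M₀₀)

    normal : Vec (suc (suc d)) → Unitriangular (suc (suc d)) → Vec (suc (suc d)) → A → Carrier
    normal c g r z = col c ∙ (unip g ∙ (row r ∙ Z z))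

    -- The arguments on the right are the components of a matrix product, as in `right-*`, `mid-*`,
    -- `top-*` and `corner-*`; so this is the multiplicativity of Ψ.
    normal-homo : ∀ c g r z c′ g′ r′ z′ → normal c g r z ∙ normal c′ g′ r′ z′ ≈
      normal (matrix g ⊳ c′ +ᵛ c) (Group._∙_ (Unip _) g g′) (r′ +ᵛ r ⊲ matrix g′) (z′ + (r · c′ + z))
    normal-homo c g r z c′ g′ r′ z′ = begin
      (col c ∙ (u ∙ (row r ∙ Z z))) ∙ (col c′ ∙ (u′ ∙ (row r′ ∙ Z z′)))
        ≈⟨ solve monoid ⟩
      (col c ∙ u) ∙ (row r ∙ (Z z ∙ ((col c′ ∙ u′ ∙ row r′) ∙ Z z′)))
        ≈⟨ ∙-congˡ (∙-congˡ (swap _ (⟷-∙ (⟷-∙ (Z⟷col z c′) (Z⟷unip z g′)) (Z⟷row z r′)))) ⟩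
      (col c ∙ u) ∙ (row r ∙ ((col c′ ∙ u′ ∙ row r′) ∙ (Z z ∙ Z z′)))
        ≈⟨ solve monoid ⟩
      (col c ∙ u) ∙ ((row r ∙ col c′) ∙ ((u′ ∙ row r′) ∙ (Z z ∙ Z z′)))
        ≈⟨ ∙-congˡ (∙-congʳ (row-col r c′)) ⟩
      (col c ∙ u) ∙ ((col c′ ∙ row r ∙ Z (r · c′)) ∙ ((u′ ∙ row r′) ∙ (Z z ∙ Z z′)))
        ≈⟨ solve monoid ⟩
      (col c ∙ u) ∙ ((col c′ ∙ row r) ∙ (Z (r · c′) ∙ ((u′ ∙ row r′) ∙ (Z z ∙ Z z′))))
        ≈⟨ ∙-congˡ (∙-congˡ (swap _ (⟷-∙ (Z⟷unip _ g′) (Z⟷row _ r′)))) ⟩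
      (col c ∙ u) ∙ ((col c′ ∙ row r) ∙ ((u′ ∙ row r′) ∙ (Z (r · c′) ∙ (Z z ∙ Z z′))))
        ≈⟨ solve monoid ⟩
      col c ∙ ((u ∙ col c′) ∙ ((row r ∙ u′) ∙ (row r′ ∙ (Z (r · c′) ∙ (Z z ∙ Z z′)))))
        ≈⟨ ∙-congˡ (∙-cong (unip-col g c′) (∙-cong (row-unip r g′) (∙-congˡ Z-sum))) ⟩
      col c ∙ ((col (matrix g ⊳ c′) ∙ u) ∙ ((u′ ∙ row (r ⊲ matrix g′)) ∙ (row r′ ∙ Z (z′ + (r · c′ + z)))))
        ≈⟨ solve monoid ⟩
      (col c ∙ col (matrix g ⊳ c′)) ∙ ((u ∙ u′) ∙ ((row (r ⊲ matrix g′) ∙ row r′) ∙ Z (z′ + (r · c′ + z))))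
        ≈⟨ ∙-cong (trans (col-commute _ _) (sym (col-homo _ _)))
             (∙-cong (sym (unip-homo g g′)) (∙-congʳ (trans (row-commute _ _) (sym (row-homo _ _))))) ⟩
      normal (matrix g ⊳ c′ +ᵛ c) (Group._∙_ (Unip _) g g′) (r′ +ᵛ r ⊲ matrix g′) (z′ + (r · c′ + z)) ∎
      where
      u u′ : Carrier
      u  = unip g
      u′ = unip g′

      Z-sum : Z (r · c′) ∙ (Z z ∙ Z z′) ≈ Z (z′ + (r · c′ + z))
      Z-sum = begin
        Z (r · c′) ∙ (Z z ∙ Z z′)  ≈⟨ assoc _ _ _ ⟨
        Z (r · c′) ∙ Z z ∙ Z z′    ≈⟨ ∙-congʳ (Z+ .homo _ _) ⟨
        Z (r · c′ + z) ∙ Z z′      ≈⟨ Z+ .homo _ _ ⟨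
        Z (r · c′ + z + z′)        ≈⟨ Z+ .cong (+-comm _ _) ⟩
        Z (z′ + (r · c′ + z))      ∎

-- Extending the maps on the block subgroups to a homomorphism Ψ.

module Extension (R : CommutativeRing ρ ℓ) (Γ : Group γ ℓ′) (d : ℕ)
  (φ : Matrices.Unitriangular R (suc (suc d)) → Group.Carrier Γ)
  (φ-cong : {g h : Matrices.Unitriangular R (suc (suc d))} →
            Group._≈_ (Matrices.Unip R (suc (suc d))) g h → Group._≈_ Γ (φ g) (φ h))
  (φ-homo : (κ : ℕ) → κ ℕ.≤ d → (g h : Matrices.Unitriangular R (suc (suc d))) →
            Linear.Block R κ (Matrices.Unitriangular.matrix g) →
            Linear.Block R κ (Matrices.Unitriangular.matrix h) →
            Group._≈_ Γ (φ (Group._∙_ (Matrices.Unip R (suc (suc d))) g h)) (Group._∙_ Γ (φ g) (φ h)))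
  where

  private
    module R = CommutativeRing R
  open R using (0#; 1#; _+_) renaming (Carrier to A; _≈_ to _≈ᴬ_)
  open Matrices R
  open Unitriangular
  open IsUnitriangular
  open Linear R
  open Group Γ
  open Core R Γ

  private
    1ᵁ : Unitriangular d
    1ᵁ = Group.ε (Unip d)

    _*ᵁ_ : ∀ {m} → Unitriangular m → Unitriangular m → Unitriangular m
    _*ᵁ_ = Group._∙_ (Unip _)

    0≈0+0 : ∀ {x y} → x ≈ᴬ 0# → y ≈ᴬ 0# → x + y ≈ᴬ 0#
    0≈0+0 x≈0 y≈0 = R.trans (R.+-cong x≈0 y≈0) (R.+-identityˡ 0#)

    x+0 : ∀ {x x′ y} → x ≈ᴬ x′ → y ≈ᴬ 0# → x + y ≈ᴬ x′
    x+0 x≈x′ y≈0 = R.trans (R.+-cong x≈x′ y≈0) (R.+-identityʳ _)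

    0+x : ∀ {x x′ y} → y ≈ᴬ 0# → x ≈ᴬ x′ → y + x ≈ᴬ x′
    0+x y≈0 x≈x′ = R.trans (R.+-cong y≈0 x≈x′) (R.+-identityˡ _)

  Block-assemble : ∀ κ → κ ℕ.≤ d → ∀ g t r {z} →
    (∀ i j → toℕ i ℕ.< κ → κ ℕ.≤ toℕ j → matrix g i j ≈ᴬ 0#) →
    (∀ j → κ ℕ.≤ toℕ j → t j ≈ᴬ 0#) →
    (∀ i → toℕ i ℕ.< κ → r i ≈ᴬ 0#) →
    z ≈ᴬ 0# → Block κ (matrix (assemble g t r z))
  Block-assemble κ κ≤d g t r {z} g≈0 t≈0 r≈0 z≈0 = Block-components κ κ≤d
    (isUnitriangular (assemble g t r z))
    (λ i j i<κ κ≤j → R.trans (mid-assemble (matrix g) t r z i j) (g≈0 i j i<κ κ≤j))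
    (λ j κ≤j → R.trans (top-assemble (matrix g) t r z j) (t≈0 j κ≤j))
    (λ i i<κ → R.trans (right-assemble (matrix g) t r z i) (r≈0 i i<κ))
    (R.trans (corner-assemble (matrix g) t r z) z≈0)

  assemble-η : ∀ M (g : Unitriangular d) t r z → mid (matrix M) ≈ᴹ matrix g → top (matrix M) ≈ᵛ t →
               right (matrix M) ≈ᵛ r → corner (matrix M) ≈ᴬ z →
               matrix M ≈ᴹ matrix (assemble g t r z)
  assemble-η M g t r z m≈ t≈ r≈ z≈ = components-injective
    (isUnitriangular M) (isUnitriangular (assemble g t r z))
    (λ i j → R.trans (m≈ i j) (R.sym (mid-assemble (matrix g) t r z i j)))
    (λ j → R.trans (t≈ j) (R.sym (top-assemble (matrix g) t r z j)))
    (λ i → R.trans (r≈ i) (R.sym (right-assemble (matrix g) t r z i)))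
    (R.trans z≈ (R.sym (corner-assemble (matrix g) t r z)))

  φ-product : ∀ κ → κ ℕ.≤ d → ∀ g t r z g′ t′ r′ z′ M →
    Block κ (matrix (assemble g t r z)) → Block κ (matrix (assemble g′ t′ r′ z′)) →
    mid (matrix M) ≈ᴹ matrix g *ᴹ matrix g′ → top (matrix M) ≈ᵛ t′ +ᵛ t ⊲ matrix g′ →
    right (matrix M) ≈ᵛ matrix g ⊳ r′ +ᵛ r → corner (matrix M) ≈ᴬ z′ + (t · r′ + z) →
    φ (assemble g t r z) ∙ φ (assemble g′ t′ r′ z′) ≈ φ M
  φ-product κ κ≤d g t r z g′ t′ r′ z′ M bX bY m≈ t≈ r≈ z≈ =
    trans (sym (φ-homo κ κ≤d X Y bX bY)) (φ-cong {X *ᵁ Y} {M} (components-injective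
      (isUnitriangular (X *ᵁ Y)) (isUnitriangular M)
      (λ i j → R.trans (mid-* uX uY i j) (R.trans (*-congᵐ i j) (R.sym (m≈ i j))))
      (λ j → R.trans (top-* uX uY j) (R.trans
        (R.+-cong (top-assemble (matrix g′) t′ r′ z′ j) (⊲-cong {M′ = matrix g′} (top-assemble (matrix g) t r z) (mid-assemble (matrix g′) t′ r′ z′) j))
        (R.sym (t≈ j))))
      (λ i → R.trans (right-* uX uY i) (R.trans
        (R.+-cong (⊳-cong {M′ = matrix g} (mid-assemble (matrix g) t r z) (right-assemble (matrix g′) t′ r′ z′) i)
                  (right-assemble (matrix g) t r z i))
        (R.sym (r≈ i))))
      (R.trans (corner-* uX uY) (R.trans
        (R.+-cong (corner-assemble (matrix g′) t′ r′ z′) (R.+-cong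
          (·-cong (top-assemble (matrix g) t r z) (right-assemble (matrix g′) t′ r′ z′))
          (corner-assemble (matrix g) t r z)))
        (R.sym z≈)))))
    where
    X Y : Unitriangular (suc (suc d))
    X = assemble g t r z
    Y = assemble g′ t′ r′ z′

    uX = isUnitriangular X
    uY = isUnitriangular Y

    *-congᵐ : mid (matrix X) *ᴹ mid (matrix Y) ≈ᴹ matrix g *ᴹ matrix g′
    *-congᵐ i j = ·-cong (mid-assemble (matrix g) t r z i) (λ l → mid-assemble (matrix g′) t′ r′ z′ l j)

  φ-assemble : ∀ κ → κ ℕ.≤ d → ∀ g t r z g′ t′ r′ z′ g″ t″ r″ z″ →
    Block κ (matrix (assemble g t r z)) → Block κ (matrix (assemble g′ t′ r′ z′)) →
    matrix g″ ≈ᴹ matrix g *ᴹ matrix g′ → t″ ≈ᵛ t′ +ᵛ t ⊲ matrix g′ →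
    r″ ≈ᵛ matrix g ⊳ r′ +ᵛ r → z″ ≈ᴬ z′ + (t · r′ + z) →
    φ (assemble g t r z) ∙ φ (assemble g′ t′ r′ z′) ≈ φ (assemble g″ t″ r″ z″)
  φ-assemble κ κ≤d g t r z g′ t′ r′ z′ g″ t″ r″ z″ bX bY m≈ t≈ r≈ z≈ =
    φ-product κ κ≤d g t r z g′ t′ r′ z′ (assemble g″ t″ r″ z″) bX bY
      (λ i j → R.trans (mid-assemble (matrix g″) t″ r″ z″ i j) (m≈ i j))
      (λ j → R.trans (top-assemble (matrix g″) t″ r″ z″ j) (t≈ j))
      (λ i → R.trans (right-assemble (matrix g″) t″ r″ z″ i) (r≈ i))
      (R.trans (corner-assemble (matrix g″) t″ r″ z″) z≈)

  row col : Vec d → Carrier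
  row t = φ (assemble 1ᵁ t 0ᵛ 0#)
  col r = φ (assemble 1ᵁ 0ᵛ r 0#)

  unip : Unitriangular d → Carrier
  unip g = φ (assemble g 0ᵛ 0ᵛ 0#)

  Block-lower : ∀ g r → Block 0 (matrix (assemble g 0ᵛ r 0#))
  Block-lower g r = Block-assemble 0 ℕ.z≤n g 0ᵛ r (λ _ _ ()) (λ _ _ → R.refl) (λ _ ()) R.refl

  Block-upper : ∀ g t → Block d (matrix (assemble g t 0ᵛ 0#))
  Block-upper g t = Block-assemble d ℕₚ.≤-refl g t 0ᵛ
    (λ _ j _ d≤j → contradiction (Finₚ.toℕ<n j) (ℕₚ.≤⇒≯ d≤j))
    (λ j d≤j → contradiction (Finₚ.toℕ<n j) (ℕₚ.≤⇒≯ d≤j))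
    (λ _ _ → R.refl) R.refl

  private
    1*1 : matrix 1ᵁ ≈ᴹ matrix 1ᵁ *ᴹ matrix 1ᵁ
    1*1 i j = R.sym (Group.identityˡ (Unip d) 1ᵁ i j)

    g*1 : ∀ g → matrix g ≈ᴹ matrix g *ᴹ matrix 1ᵁ
    g*1 g i j = R.sym (Group.identityʳ (Unip d) g i j)

    1*g : ∀ g → matrix g ≈ᴹ matrix 1ᵁ *ᴹ matrix g
    1*g g i j = R.sym (Group.identityˡ (Unip d) g i j)

    ⊳0+0 : ∀ (M : Mat d) → 0ᵛ ≈ᵛ M ⊳ 0ᵛ +ᵛ 0ᵛ
    ⊳0+0 M i = R.sym (0≈0+0 (·-zeroʳ (M i)) R.refl)

    0+0⊲ : ∀ (M : Mat d) → 0ᵛ ≈ᵛ 0ᵛ +ᵛ 0ᵛ ⊲ M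
    0+0⊲ M j = R.sym (0≈0+0 R.refl (·-zeroˡ (λ l → M l j)))

    corner-0 : ∀ {v w : Vec d} → v · w ≈ᴬ 0# → 0# ≈ᴬ 0# + (v · w + 0#)
    corner-0 vw≈0 = R.sym (0≈0+0 R.refl (0≈0+0 vw≈0 R.refl))

    corner-00 : 0# ≈ᴬ 0# + (_·_ {d} 0ᵛ 0ᵛ + 0#)
    corner-00 = corner-0 (·-zeroˡ {d} 0ᵛ)

  action : Action d
  action = record
    { row      = row
    ; col      = col
    ; unip     = unip
    ; row-cong = λ {r} {r′} r≈ → φ-cong {assemble 1ᵁ r 0ᵛ 0#} {assemble 1ᵁ r′ 0ᵛ 0#} (assemble-η
        (assemble 1ᵁ r 0ᵛ 0#) 1ᵁ r′ 0ᵛ 0#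
        (mid-assemble 1ᴹ r 0ᵛ 0#) (λ j → R.trans (top-assemble 1ᴹ r 0ᵛ 0# j) (r≈ j))
        (right-assemble 1ᴹ r 0ᵛ 0#) (corner-assemble 1ᴹ r 0ᵛ 0#))
    ; row-homo = λ r r′ → sym (φ-assemble d ℕₚ.≤-refl
        1ᵁ r 0ᵛ 0# 1ᵁ r′ 0ᵛ 0# 1ᵁ (r +ᵛ r′) 0ᵛ 0# (Block-upper 1ᵁ r) (Block-upper 1ᵁ r′)
        1*1 (λ j → R.trans (R.+-comm _ _) (R.+-congˡ (R.sym (⊲-identity r j)))) (⊳0+0 1ᴹ)
        (corner-0 (·-zeroʳ r)))
    ; col-cong = λ {r} {r′} r≈ → φ-cong {assemble 1ᵁ 0ᵛ r 0#} {assemble 1ᵁ 0ᵛ r′ 0#} (assemble-η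
        (assemble 1ᵁ 0ᵛ r 0#) 1ᵁ 0ᵛ r′ 0#
        (mid-assemble 1ᴹ 0ᵛ r 0#) (top-assemble 1ᴹ 0ᵛ r 0#)
        (λ j → R.trans (right-assemble 1ᴹ 0ᵛ r 0# j) (r≈ j)) (corner-assemble 1ᴹ 0ᵛ r 0#))
    ; col-homo = λ r r′ → sym (φ-assemble 0 ℕ.z≤n
        1ᵁ 0ᵛ r 0# 1ᵁ 0ᵛ r′ 0# 1ᵁ 0ᵛ (r +ᵛ r′) 0# (Block-lower 1ᵁ r) (Block-lower 1ᵁ r′)
        1*1 (0+0⊲ 1ᴹ) (λ j → R.trans (R.+-comm _ _) (R.+-congʳ (R.sym (⊳-identity r′ j))))
        (corner-0 (·-zeroˡ r′)))
    ; unip-homo = λ g h → sym (φ-assemble 0 ℕ.z≤n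
        g 0ᵛ 0ᵛ 0# h 0ᵛ 0ᵛ 0# (g *ᵁ h) 0ᵛ 0ᵛ 0# (Block-lower g 0ᵛ) (Block-lower h 0ᵛ)
        (λ _ _ → R.refl) (0+0⊲ (matrix h)) (⊳0+0 (matrix g)) corner-00)
    ; row-unip = λ r g → trans
        (φ-assemble d ℕₚ.≤-refl 1ᵁ r 0ᵛ 0# g 0ᵛ 0ᵛ 0# g (r ⊲ matrix g) 0ᵛ 0#
          (Block-upper 1ᵁ r) (Block-upper g 0ᵛ) (1*g g) (λ j → R.sym (0+x R.refl R.refl)) (⊳0+0 1ᴹ)
          (corner-0 (·-zeroʳ r)))
        (sym (φ-assemble d ℕₚ.≤-refl g 0ᵛ 0ᵛ 0# 1ᵁ (r ⊲ matrix g) 0ᵛ 0# g (r ⊲ matrix g) 0ᵛ 0#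
          (Block-upper g 0ᵛ) (Block-upper 1ᵁ _) (g*1 g)
          (λ j → R.sym (x+0 R.refl (·-zeroˡ (λ l → 1ᴹ l j)))) (⊳0+0 (matrix g))
          corner-00))
    ; unip-col = λ g c → trans
        (φ-assemble 0 ℕ.z≤n g 0ᵛ 0ᵛ 0# 1ᵁ 0ᵛ c 0# g 0ᵛ (matrix g ⊳ c) 0#
          (Block-lower g 0ᵛ) (Block-lower 1ᵁ c) (g*1 g) (0+0⊲ 1ᴹ) (λ i → R.sym (x+0 R.refl R.refl))
          (corner-0 (·-zeroˡ c)))
        (sym (φ-assemble 0 ℕ.z≤n 1ᵁ 0ᵛ (matrix g ⊳ c) 0# g 0ᵛ 0ᵛ 0# g 0ᵛ (matrix g ⊳ c) 0#
          (Block-lower 1ᵁ _) (Block-lower g 0ᵛ) (1*g g) (0+0⊲ (matrix g))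
          (λ i → R.sym (0+x (·-zeroʳ (1ᴹ i)) R.refl)) corner-00))
    ; disjoint = λ {k} {l} k<l x y → trans
        (φ-assemble (toℕ l) (Finₚ.toℕ≤n l) 1ᵁ (δ k x) 0ᵛ 0# 1ᵁ 0ᵛ (δ l y) 0# 1ᵁ (δ k x) (δ l y) 0#
          (Block-row k<l x) (Block-col l y) 1*1
          (λ j → R.sym (0+x R.refl (⊲-identity (δ k x) j)))
          (λ i → R.sym (x+0 (⊳-identity (δ l y) i) R.refl))
          (corner-0 (R.trans (δ-· k x (δ l y)) (R.trans (R.*-congˡ (δ-off y (Finₚ.<⇒≢ k<l))) (R.zeroʳ x)))))
        (sym (φ-assemble (toℕ l) (Finₚ.toℕ≤n l) 1ᵁ 0ᵛ (δ l y) 0# 1ᵁ (δ k x) 0ᵛ 0# 1ᵁ (δ k x) (δ l y) 0#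
          (Block-col l y) (Block-row k<l x) 1*1
          (λ j → R.sym (x+0 R.refl (·-zeroˡ (λ i → 1ᴹ i j))))
          (λ i → R.sym (0+x (·-zeroʳ (1ᴹ i)) R.refl))
          corner-00))
    }
    where
    1-block : ∀ κ (i j : Fin d) → toℕ i ℕ.< κ → κ ℕ.≤ toℕ j → 1ᴹ i j ≈ᴬ 0#
    1-block κ i j i<κ κ≤j = 1ᴹ-off (Finₚ.<⇒≢ (ℕₚ.<-≤-trans i<κ κ≤j))

    Block-row : ∀ {k l : Fin d} → k Fin.< l → ∀ x → Block (toℕ l) (matrix (assemble 1ᵁ (δ k x) 0ᵛ 0#))
    Block-row {k} {l} k<l x = Block-assemble (toℕ l) (Finₚ.toℕ≤n l) 1ᵁ (δ k x) 0ᵛ (1-block (toℕ l))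
      (λ j l≤j → δ-off x (Finₚ.<⇒≢ (ℕₚ.<-≤-trans k<l l≤j) ∘ ≡.sym)) (λ _ _ → R.refl) R.refl

    Block-col : ∀ (l : Fin d) y → Block (toℕ l) (matrix (assemble 1ᵁ 0ᵛ (δ l y) 0#))
    Block-col l y = Block-assemble (toℕ l) (Finₚ.toℕ≤n l) 1ᵁ 0ᵛ (δ l y) (1-block (toℕ l))
      (λ _ _ → R.refl) (λ i i<l → δ-off y (Finₚ.<⇒≢ i<l)) R.refl

  unip-cong : ∀ {g h} → matrix g ≈ᴹ matrix h → unip g ≈ unip h
  unip-cong {g} {h} g≈ = φ-cong {assemble g 0ᵛ 0ᵛ 0#} {assemble h 0ᵛ 0ᵛ 0#} (assemble-η
    (assemble g 0ᵛ 0ᵛ 0#) h 0ᵛ 0ᵛ 0#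
    (λ i j → R.trans (mid-assemble (matrix g) 0ᵛ 0ᵛ 0# i j) (g≈ i j))
    (top-assemble (matrix g) 0ᵛ 0ᵛ 0#) (right-assemble (matrix g) 0ᵛ 0ᵛ 0#)
    (corner-assemble (matrix g) 0ᵛ 0ᵛ 0#))

  -- Two block subgroups are involved: `unip` ∙ `row` is formed at κ = d, and its product with `col`
  -- at the given κ, where both factors lie because they inherit the zeros of `M`.
  φ-factors : ∀ κ → κ ℕ.≤ d → ∀ M → Block κ (matrix M) →
              φ M ≈ col (right (matrix M)) ∙ (unip (midᵁ M) ∙ row (top (matrix M)))
  φ-factors κ κ≤d M b = sym (trans
    (∙-congˡ (φ-assemble d ℕₚ.≤-refl m 0ᵛ 0ᵛ 0# 1ᵁ t 0ᵛ 0# m t 0ᵛ 0# (Block-upper m 0ᵛ) (Block-upper 1ᵁ t)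
      (g*1 m) (λ j → R.sym (x+0 R.refl (·-zeroˡ (λ l → 1ᴹ l j)))) (⊳0+0 (matrix m))
      corner-00))
    (φ-product κ κ≤d 1ᵁ 0ᵛ r 0# m t 0ᵛ 0# M
      (Block-assemble κ κ≤d 1ᵁ 0ᵛ r (λ i j i<κ κ≤j → 1ᴹ-off (Finₚ.<⇒≢ (ℕₚ.<-≤-trans i<κ κ≤j)))
        (λ _ _ → R.refl) (Block-right b κ≤d) R.refl)
      (Block-assemble κ κ≤d m t 0ᵛ (Block-mid b) (Block-top b) (λ _ _ → R.refl) R.refl)
      (1*g m) (λ j → R.sym (x+0 R.refl (·-zeroˡ (λ l → matrix m l j))))
      (λ i → R.sym (0+x (·-zeroʳ (1ᴹ i)) R.refl))
      (R.trans (Block-corner b κ≤d) corner-00)))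
    where
    m : Unitriangular d
    m = midᵁ M

    t r : Vec d
    t = top (matrix M)
    r = right (matrix M)

module ExtensionHomomorphism (R : CommutativeRing ρ ℓ) (Γ : Group γ ℓ′) (d : ℕ)
  (φ : Matrices.Unitriangular R (suc (suc (suc (suc d)))) → Group.Carrier Γ)
  (φ-cong : {g h : Matrices.Unitriangular R (suc (suc (suc (suc d))))} →
            Group._≈_ (Matrices.Unip R (suc (suc (suc (suc d))))) g h → Group._≈_ Γ (φ g) (φ h))
  (φ-homo : (κ : ℕ) → κ ℕ.≤ suc (suc d) → (g h : Matrices.Unitriangular R (suc (suc (suc (suc d))))) →
            Linear.Block R κ (Matrices.Unitriangular.matrix g) →
            Linear.Block R κ (Matrices.Unitriangular.matrix h) →
            Group._≈_ Γ (φ (Group._∙_ (Matrices.Unip R (suc (suc (suc (suc d))))) g h)) (Group._∙_ Γ (φ g) (φ h)))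
  (off-diagonal : (𝒜 : Core.Action R Γ (suc (suc d))) → Core.OffDiagonal R Γ 𝒜)
  where

  private
    module R = CommutativeRing R
  open Matrices R
  open Unitriangular
  open Linear R
  open Group Γ
  open Extension R Γ (suc (suc d)) φ φ-cong φ-homo
  open Core R Γ
  open Action action using (row-cong; col-cong)
  open Corner action (off-diagonal action)
  open Additive R Γ
  open IsAdditive
  open import Relation.Binary.Reasoning.Setoid setoid

  private
    G : Group _ _
    G = Unip (suc (suc (suc (suc d))))

  Ψ : Unitriangular (suc (suc (suc (suc d)))) → Carrier
  Ψ M = normal (right (matrix M)) (midᵁ M) (top (matrix M)) (corner (matrix M))

  normal-cong : ∀ {c c′ g g′ r r′ z z′} → c ≈ᵛ c′ → matrix g ≈ᴹ matrix g′ → r ≈ᵛ r′ → z R.≈ z′ →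
                normal c g r z ≈ normal c′ g′ r′ z′
  normal-cong {g = g} {g′} c≈ g≈ r≈ z≈ = ∙-cong (col-cong c≈) (∙-cong (unip-cong {g} {g′} g≈)
    (∙-cong (row-cong r≈) (Z+ .cong z≈)))

  Ψ-cong : ∀ {g h} → matrix g ≈ᴹ matrix h → Ψ g ≈ Ψ h
  Ψ-cong {g} {h} g≈h = normal-cong {g = midᵁ g} {midᵁ h}
    (λ _ → g≈h _ _) (λ _ _ → g≈h _ _) (λ _ → g≈h _ _) (g≈h _ _)

  Ψ-homo : ∀ g h → Ψ (Group._∙_ G g h) ≈ Ψ g ∙ Ψ h
  Ψ-homo g h = trans
    (normal-cong {g = midᵁ (Group._∙_ G g h)} {Group._∙_ (Unip _) (midᵁ g) (midᵁ h)}
      (right-* ug uh) (mid-* ug uh) (top-* ug uh) (corner-* ug uh))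
    (sym (normal-homo _ (midᵁ g) _ _ _ (midᵁ h) _ _))
    where
    ug = Unitriangular.isUnitriangular g
    uh = Unitriangular.isUnitriangular h

  Ψ-ε : Ψ (Group.ε G) ≈ ε
  Ψ-ε = identityˡ-unique _ _
    (trans (sym (Ψ-homo 1ᴳ 1ᴳ)) (Ψ-cong {Group._∙_ G 1ᴳ 1ᴳ} {1ᴳ} (Group.identityˡ G 1ᴳ)))
    where
    open GroupProperties Γ using (identityˡ-unique)
    1ᴳ = Group.ε G

  Ψ≈φ : ∀ κ → κ ℕ.≤ suc (suc d) → ∀ M → Block κ (matrix M) → Ψ M ≈ φ M
  Ψ≈φ κ κ≤d M b = begin
    col c ∙ (unip m ∙ (row r ∙ Z (corner (matrix M))))
      ≈⟨ ∙-congˡ (∙-congˡ (∙-congˡ (trans (Z+ .cong (Block-corner b κ≤d)) (homo-0 Z+)))) ⟩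
    col c ∙ (unip m ∙ (row r ∙ ε))  ≈⟨ ∙-congˡ (∙-congˡ (identityʳ _)) ⟩
    col c ∙ (unip m ∙ row r)        ≈⟨ φ-factors κ κ≤d M b ⟨
    φ M                             ∎
    where
    m = midᵁ M
    c = right (matrix M)
    r = top (matrix M)

-- Generation of the block subgroups by simple elements.

module Generation (R : CommutativeRing ρ ℓ) where
  open CommutativeRing R hiding (zero)
  open Matrices R
  open Unitriangular
  open IsUnitriangular
  open Linear R
  open import Relation.Binary.Reasoning.Setoid setoid

  Simple : ∀ {p} → Pred (Fin d) p → Pred (Unitriangular (suc d)) _
  Simple J g = ∃₂ λ j x → J j × matrix g ≈ᴹ matrix (simple j x)

  ⟨_⟩ : ∀ {p} → Pred (Fin d) p → Pred (Unitriangular (suc d)) _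
  ⟨_⟩ {d = d} J = Generated (Unip (suc d)) (Simple J)

  borderedᴹ : Vec d → Mat d → Mat (suc d)
  borderedᴹ r M zero    zero    = 1#
  borderedᴹ r M zero    (suc j) = r j
  borderedᴹ r M (suc i) zero    = 0#
  borderedᴹ r M (suc i) (suc j) = M i j

  bordered : Vec d → Unitriangular d → Unitriangular (suc d)
  bordered r g = borderedᴹ r (matrix g) ,ᵁ record
    { diagonal = λ { zero → refl ; (suc i) → isUnitriangular g .diagonal i }
    ; lower    = λ { {suc i} {zero} _ → refl ; {suc i} {suc j} (ℕ.s≤s j<i) → isUnitriangular g .lower j<i }
    }

  bordered-cong : {r r′ : Vec d} {M M′ : Mat d} → r ≈ᵛ r′ → M ≈ᴹ M′ → borderedᴹ r M ≈ᴹ borderedᴹ r′ M′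
  bordered-cong r≈ M≈ zero    zero    = refl
  bordered-cong r≈ M≈ zero    (suc j) = r≈ j
  bordered-cong r≈ M≈ (suc i) zero    = refl
  bordered-cong r≈ M≈ (suc i) (suc j) = M≈ i j

  bordered-* : (r r′ : Vec d) (M M′ : Mat d) →
               borderedᴹ r M *ᴹ borderedᴹ r′ M′ ≈ᴹ borderedᴹ (r′ +ᵛ r ⊲ M′) (M *ᴹ M′)
  bordered-* r r′ M M′ zero    zero    =
    trans (+-cong (*-identityˡ 1#) (·-zeroʳ r)) (+-identityʳ 1#)
  bordered-* r r′ M M′ zero    (suc j) = +-congʳ (*-identityˡ (r′ j))
  bordered-* r r′ M M′ (suc i) zero    = trans (+-cong (zeroˡ 1#) (·-zeroʳ (M i))) (+-identityʳ 0#)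
  bordered-* r r′ M M′ (suc i) (suc j) = trans (+-congʳ (zeroˡ (r′ j))) (+-identityˡ _)

  bordered-η : (g : Unitriangular (suc d)) →
               matrix g ≈ᴹ borderedᴹ (λ j → matrix g zero (suc j)) (λ i j → matrix g (suc i) (suc j))
  bordered-η g zero    zero    = isUnitriangular g .diagonal zero
  bordered-η g zero    (suc j) = refl
  bordered-η g (suc i) zero    = isUnitriangular g .lower (ℕ.s≤s ℕ.z≤n)
  bordered-η g (suc i) (suc j) = refl

  bordered-simple : (j : Fin d) (x : Carrier) →
                    borderedᴹ 0ᵛ (matrix (simple j x)) ≈ᴹ matrix (simple (suc j) x)
  bordered-simple j x zero    zero    = refl
  bordered-simple j x zero    (suc c) = refl
  bordered-simple j x (suc r) zero    with r Finₚ.≟ inject₁ j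
  ... | yes _ = refl
  ... | no _  = refl
  bordered-simple j x (suc r) (suc c) = refl

  bordered-δ-zero : (x : Carrier) → borderedᴹ {suc d} (δ zero x) 1ᴹ ≈ᴹ matrix (simple zero x)
  bordered-δ-zero x zero    zero          = refl
  bordered-δ-zero x zero    (suc zero)    = refl
  bordered-δ-zero x zero    (suc (suc c)) = refl
  bordered-δ-zero x (suc r) zero          = refl
  bordered-δ-zero x (suc r) (suc c)       = refl

  module _ {p} {J : Pred (Fin (suc d)) p} where

    private
      module G = Group (Unip (suc (suc d)))

    bordered-⟨⟩ : ∀ {g} → ⟨ J ∘ suc ⟩ g → ⟨ J ⟩ (bordered 0ᵛ g)
    bordered-⟨⟩ (generator (j , x , Jj , g≈)) =
      generator (suc j , x , Jj , λ r c → trans (bordered-cong (λ _ → refl) g≈ r c) (bordered-simple j x r c))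
    bordered-⟨⟩ unit = respects {g = G.ε} {bordered 0ᵛ (Group.ε (Unip (suc d)))} (λ where
      zero    zero    → refl
      zero    (suc j) → refl
      (suc i) zero    → refl
      (suc i) (suc j) → refl) unit
    bordered-⟨⟩ (product {g} {h} Jg Jh) =
      respects {g = bordered 0ᵛ g G.∙ bordered 0ᵛ h} {bordered 0ᵛ (Group._∙_ (Unip (suc d)) g h)}
        (λ r c → trans (bordered-* 0ᵛ 0ᵛ (matrix g) (matrix h) r c)
          (bordered-cong (λ j → trans (+-identityˡ _) (·-zeroˡ (λ l → matrix h l j))) (λ _ _ → refl) r c))
        (product (bordered-⟨⟩ Jg) (bordered-⟨⟩ Jh))
    bordered-⟨⟩ (inverse {g} Jg) =
      respects {g = bordered 0ᵛ g G.⁻¹} {bordered 0ᵛ (Group._⁻¹ (Unip (suc d)) g)}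
        (λ where
          zero    zero    → refl
          zero    (suc j) → trans (-‿cong (·-zeroˡ (λ l → invᴹ (matrix g) l j))) -0#≈0#
          (suc i) zero    → refl
          (suc i) (suc j) → refl)
        (inverse (bordered-⟨⟩ Jg))
      where open import Algebra.Properties.Ring ring using (-0#≈0#)
    bordered-⟨⟩ (respects {g} {h} g≈h Jg) =
      respects {g = bordered 0ᵛ g} {bordered 0ᵛ h} (bordered-cong (λ _ → refl) g≈h) (bordered-⟨⟩ Jg)

  private
    rowᵁ : Vec d → Unitriangular (suc d)
    rowᵁ r = bordered r (Group.ε (Unip _))

    rowᵁ-homo : (r r′ : Vec d) → matrix (rowᵁ (r +ᵛ r′)) ≈ᴹ matrix (rowᵁ r) *ᴹ matrix (rowᵁ r′)
    rowᵁ-homo r r′ i j = sym (trans (bordered-* r r′ 1ᴹ 1ᴹ i j) (bordered-cong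
      (λ j → trans (+-congˡ (⊲-identity r j)) (+-comm _ _)) (Group.identityˡ (Unip _) (Group.ε (Unip _))) i j))

  module _ {p} {J : Pred (Fin (suc d)) p} where
    private
      module G = Group (Unip (suc (suc d)))
      open Commuting (Unip (suc (suc d))) using (commutator-unique)

    -- e_{0,j+2}(x) is the commutator of e_{0,j+1}(x) and e_{j+1,j+2}(1).
    rowᵁ-δ : ∀ k → (∀ i → i Fin.≤ k → J i) → ∀ x → ⟨ J ⟩ (rowᵁ (δ k x))
    rowᵁ-δ = <-weakInduction _
      (λ J≤ x → generator (zero , x , J≤ zero ℕ.z≤n , bordered-δ-zero x))
      step
      where
      step : ∀ (k : Fin d) → ((∀ i → i Fin.≤ inject₁ k → J i) → ∀ x → ⟨ J ⟩ (rowᵁ (δ (inject₁ k) x))) →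
             (∀ i → i Fin.≤ suc k → J i) → ∀ x → ⟨ J ⟩ (rowᵁ (δ (suc k) x))
      step k IH J≤ x = respects {g = (a G.⁻¹) G.∙ ((D G.⁻¹) G.∙ (a G.∙ D))} {b} a⁻¹D⁻¹aD≈b
        (product (inverse Ja) (product (inverse JD) (product Ja JD)))
        where
        s : Unitriangular (suc d)
        s = simple k 1#

        a b D : Unitriangular (suc (suc d))
        a = rowᵁ (δ (inject₁ k) x)
        b = rowᵁ (δ (suc k) x)
        D = bordered 0ᵛ s

        k<k+1 : inject₁ k Fin.< suc k
        k<k+1 = ℕ.s≤s (ℕₚ.≤-reflexive (Finₚ.toℕ-inject₁ k))

        Ja : ⟨ J ⟩ a
        Ja = IH (λ i i≤k → J≤ i (ℕₚ.<⇒≤ (ℕₚ.≤-<-trans i≤k k<k+1))) x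

        JD : ⟨ J ⟩ D
        JD = generator (suc k , 1# , J≤ (suc k) ℕₚ.≤-refl , bordered-simple k 1#)

        aD≈Dab : a G.∙ D G.≈ D G.∙ (a G.∙ b)
        aD≈Dab i j = begin
          (matrix a *ᴹ matrix D) i j
            ≈⟨ bordered-* (δ (inject₁ k) x) 0ᵛ 1ᴹ (matrix s) i j ⟩
          borderedᴹ (0ᵛ +ᵛ δ (inject₁ k) x ⊲ matrix s) (1ᴹ *ᴹ matrix s) i j
            ≈⟨ bordered-cong
                 (λ j → trans (+-identityˡ _) (trans (⊲-elementary _ (Finₚ.<⇒≢ k<k+1) 1# j)
                   (+-congˡ (δ-cong (suc k) (trans (*-identityʳ _) (δ-diag (inject₁ k) x)) j))))
                 (Group.identityˡ (Unip _) s) i j ⟩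
          borderedᴹ (δ (inject₁ k) x +ᵛ δ (suc k) x) (matrix s) i j
            ≈⟨ bordered-cong
                 (λ j → trans (+-congˡ (·-zeroˡ (λ l → 1ᴹ l j))) (+-identityʳ _))
                 (Group.identityʳ (Unip _) s) i j ⟨
          borderedᴹ (δ (inject₁ k) x +ᵛ δ (suc k) x +ᵛ 0ᵛ ⊲ 1ᴹ) (matrix s *ᴹ 1ᴹ) i j
            ≈⟨ bordered-* 0ᵛ (δ (inject₁ k) x +ᵛ δ (suc k) x) (matrix s) 1ᴹ i j ⟨
          (matrix D *ᴹ matrix (rowᵁ (δ (inject₁ k) x +ᵛ δ (suc k) x))) i j
            ≈⟨ ·-cong {v = matrix D i} (λ _ → refl) (λ l → rowᵁ-homo (δ (inject₁ k) x) (δ (suc k) x) l j) ⟩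
          (matrix D *ᴹ (matrix a *ᴹ matrix b)) i j ∎

        a⁻¹D⁻¹aD≈b : (a G.⁻¹) G.∙ ((D G.⁻¹) G.∙ (a G.∙ D)) G.≈ b
        a⁻¹D⁻¹aD≈b = commutator-unique {a} {D} {b} aD≈Dab

  -- e_{i,j} is an iterated commutator of the simple generators i, ..., j - 1, so a nonzero entry
  -- needs all of these in `J`. The disjunction is part of the data, as a general ring has no test
  -- for zero.
  Compatible : ∀ {p} → Pred (Fin d) p → Mat (suc d) → Set _
  Compatible J M = ∀ i j → i Fin.< j → M i j ≈ 0# ⊎ (∀ κ → toℕ i ℕ.≤ toℕ κ → κ Fin.< j → J κ)

  compatible⇒generated : ∀ {p} (J : Pred (Fin d) p) (g : Unitriangular (suc d)) →
                         Compatible J (matrix g) → ⟨ J ⟩ g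
  compatible⇒generated {d = zero} J g c =
    respects {g = Group.ε (Unip 1)} {g} (λ { zero zero → sym (isUnitriangular g .diagonal zero) }) unit
  compatible⇒generated {d = suc d} J g c = respects {g = bordered 0ᵛ m G.∙ rowᵁ r} {g}
    (λ i j → begin
      (borderedᴹ 0ᵛ (matrix m) *ᴹ borderedᴹ r 1ᴹ) i j ≈⟨ bordered-* 0ᵛ r (matrix m) 1ᴹ i j ⟩
      borderedᴹ (r +ᵛ 0ᵛ ⊲ 1ᴹ) (matrix m *ᴹ 1ᴹ) i j   ≈⟨ bordered-cong
        (λ j → trans (+-congˡ (·-zeroˡ (λ l → 1ᴹ l j))) (+-identityʳ _)) (Group.identityʳ (Unip _) m) i j ⟩
      borderedᴹ r (matrix m) i j                      ≈⟨ bordered-η g i j ⟨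
      matrix g i j                                    ∎)
    (product (bordered-⟨⟩ (compatible⇒generated (J ∘ suc) m minor)) Jr)
    where
    module G = Group (Unip (suc (suc d)))

    r : Vec (suc d)
    r j = matrix g zero (suc j)

    m : Unitriangular (suc d)
    m = (λ i j → matrix g (suc i) (suc j)) ,ᵁ record
      { diagonal = λ i → isUnitriangular g .diagonal (suc i)
      ; lower    = λ j<i → isUnitriangular g .lower (ℕ.s≤s j<i)
      }

    minor : Compatible (J ∘ suc) (matrix m)
    minor i j i<j with c (suc i) (suc j) (ℕ.s≤s i<j)
    ... | inj₁ m≈0 = inj₁ m≈0
    ... | inj₂ J≤  = inj₂ (λ κ i≤κ κ<j → J≤ (suc κ) (ℕ.s≤s i≤κ) (ℕ.s≤s κ<j))

    rowᵁ-cong : {v w : Vec (suc d)} → v ≈ᵛ w → ⟨ J ⟩ (rowᵁ v) → ⟨ J ⟩ (rowᵁ w)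
    rowᵁ-cong {v} {w} v≈w = respects {g = rowᵁ v} {rowᵁ w} (bordered-cong v≈w (λ _ _ → refl))

    J0 : ⟨ J ⟩ (rowᵁ 0ᵛ)
    J0 = bordered-⟨⟩ unit

    Jr : ⟨ J ⟩ (rowᵁ r)
    Jr = vec-ind (⟨ J ⟩ ∘ rowᵁ) rowᵁ-cong J0
      (λ {v} {w} Jv Jw → respects {g = rowᵁ v G.∙ rowᵁ w} {rowᵁ (v +ᵛ w)}
        (λ i j → sym (rowᵁ-homo v w i j)) (product Jv Jw))
      r λ k → case c zero (suc k) (ℕ.s≤s ℕ.z≤n) of λ where
        (inj₁ rₖ≈0) → rowᵁ-cong (λ i → trans (sym (δ-0 k i)) (δ-cong k (sym rₖ≈0) i)) J0
        (inj₂ J≤)   → rowᵁ-δ k (λ i i≤k → J≤ i ℕ.z≤n (ℕ.s≤s i≤k)) (r k)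

  Block⇒generated : (κ : Fin d) (g : Unitriangular (suc d)) → Block (toℕ κ) (matrix g) → ⟨ _≢ κ ⟩ g
  Block⇒generated κ g b = compatible⇒generated (_≢ κ) g compatible
    where
    compatible : Compatible (_≢ κ) (matrix g)
    compatible i j i<j with toℕ i ℕₚ.≤? toℕ κ | toℕ κ ℕₚ.<? toℕ j
    ... | yes i≤κ | yes κ<j = inj₁ (b i j i≤κ κ<j)
    ... | no  i≰κ | _       = inj₂ λ { κ′ i≤κ′ _ ≡.refl → i≰κ i≤κ′ }
    ... | yes _   | no  κ≮j = inj₂ λ { κ′ _ κ′<j ≡.refl → κ≮j κ′<j }

  generated⇒Block : (κ : Fin d) {g : Unitriangular (suc d)} → ⟨ _≢ κ ⟩ g → Block (toℕ κ) (matrix g)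
  generated⇒Block κ (generator (j , x , j≢κ , g≈)) =
    Block-cong (λ r c → sym (g≈ r c)) simple-block
    where
    simple-block : Block (toℕ κ) (matrix (simple j x))
    simple-block r c r≤κ κ<c with r Finₚ.≟ inject₁ j | c Finₚ.≟ suc j
    ... | yes ≡.refl | yes ≡.refl = contradiction
      (Finₚ.toℕ-injective (ℕₚ.≤-antisym (≡.subst (ℕ._≤ toℕ κ) (Finₚ.toℕ-inject₁ j) r≤κ) (ℕ.s≤s⁻¹ κ<c))) j≢κ
    ... | yes _      | no _       = Block-1 (toℕ κ) r c r≤κ κ<c
    ... | no _       | yes _      = Block-1 (toℕ κ) r c r≤κ κ<c
    ... | no _       | no _       = Block-1 (toℕ κ) r c r≤κ κ<c
  generated⇒Block κ unit = Block-1 (toℕ κ)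
  generated⇒Block κ (product g h) = Block-* (toℕ κ) (generated⇒Block κ g) (generated⇒Block κ h)
  generated⇒Block κ (inverse g) = Block-inv (toℕ κ) (generated⇒Block κ g)
  generated⇒Block κ (respects g≈h g) = Block-cong g≈h (generated⇒Block κ g)

-- Words up to bounded area.

module WordArea (G : Group γ ℓ) (S : Pred (Group.Carrier G) σ)
                (S-inv : ∀ {g} → S g → S (Group._⁻¹ G g))
                (R : Pred (Words.Word G S S-inv) ρ) where
  open Group G
  open GroupProperties G
  open Words G S S-inv
  open Presentation R

  ≋-refl : ∀ {u} → u ≋ u
  ≋-refl = letters (Pointwise.refl refl)

  ≋-reflexive : ∀ {u v} → u ≡ v → u ≋ v
  ≋-reflexive ≡.refl = ≋-refl

  ≋-++ˡ : ∀ w {u v} → u ≋ v → w ++ u ≋ w ++ v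
  ≋-++ˡ w (letters u≈v)   = letters (Pointwise.++⁺ (Pointwise.refl refl) u≈v)
  ≋-++ˡ w (cancel u x v)  = trans≋ (≋-reflexive (≡.sym (Listₚ.++-assoc w u _)))
    (trans≋ (cancel (w ++ u) x v) (≋-reflexive (Listₚ.++-assoc w u v)))
  ≋-++ˡ w (sym≋ u≋v)      = sym≋ (≋-++ˡ w u≋v)
  ≋-++ˡ w (trans≋ t≋u u≋v) = trans≋ (≋-++ˡ w t≋u) (≋-++ˡ w u≋v)

  ≋-++ʳ : ∀ w {u v} → u ≋ v → u ++ w ≋ v ++ w
  ≋-++ʳ w (letters u≈v)   = letters (Pointwise.++⁺ u≈v (Pointwise.refl refl))
  ≋-++ʳ w (cancel u x v)  = trans≋ (≋-reflexive (Listₚ.++-assoc u _ w))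
    (trans≋ (cancel u x (v ++ w)) (≋-reflexive (≡.sym (Listₚ.++-assoc u v w))))
  ≋-++ʳ w (sym≋ u≋v)      = sym≋ (≋-++ʳ w u≋v)
  ≋-++ʳ w (trans≋ t≋u u≋v) = trans≋ (≋-++ʳ w t≋u) (≋-++ʳ w u≋v)

  ⁻ʷ-∷ : ∀ x u → (x ∷ u) ⁻ʷ ≡ u ⁻ʷ ++ inv x ∷ []
  ⁻ʷ-∷ x u = Listₚ.unfold-reverse (inv x) (map inv u)

  ⁻ʷ-inverseʳ : ∀ u → u ++ u ⁻ʷ ≋ []
  ⁻ʷ-inverseʳ []      = ≋-refl
  ⁻ʷ-inverseʳ (x ∷ u) = trans≋
    (≋-reflexive (≡.trans (≡.cong ((x ∷ u) ++_) (⁻ʷ-∷ x u)) (≡.cong (x ∷_) (≡.sym (Listₚ.++-assoc u (u ⁻ʷ) _)))))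
    (trans≋ (≋-++ˡ (x ∷ []) (≋-++ʳ (inv x ∷ []) (⁻ʷ-inverseʳ u))) (cancel [] x []))

  ⁻ʷ-inverseˡ : ∀ u → u ⁻ʷ ++ u ≋ []
  ⁻ʷ-inverseˡ []      = ≋-refl
  ⁻ʷ-inverseˡ (x ∷ u) = trans≋
    (≋-reflexive (≡.trans (≡.cong (_++ x ∷ u) (⁻ʷ-∷ x u)) (Listₚ.++-assoc (u ⁻ʷ) _ _)))
    (trans≋ (≋-++ˡ (u ⁻ʷ) (letters (refl ∷ sym (⁻¹-involutive (proj₁ x)) ∷ Pointwise.refl refl)))
    (trans≋ (cancel (u ⁻ʷ) (inv x) u) (⁻ʷ-inverseˡ u)))

  eval-++ : ∀ u v → eval (u ++ v) ≈ eval u ∙ eval v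
  eval-++ []      v = sym (identityˡ _)
  eval-++ (x ∷ u) v = trans (∙-congˡ (eval-++ u v)) (sym (assoc _ _ _))

  eval-≋ : ∀ {u v} → u ≋ v → eval u ≈ eval v
  eval-≋ (letters u≈v)    = pointwise u≈v
    where
    pointwise : ∀ {u v} → Pointwise (_≈_ on proj₁) u v → eval u ≈ eval v
    pointwise []        = refl
    pointwise (x≈ ∷ u≈) = ∙-cong x≈ (pointwise u≈)
  eval-≋ (cancel u x v)   = trans (eval-++ u _) (trans (∙-congˡ
    (trans (sym (assoc _ _ _)) (trans (∙-congʳ (inverseʳ (proj₁ x))) (identityˡ _)))) (sym (eval-++ u v)))
  eval-≋ (sym≋ u≋v)       = sym (eval-≋ u≋v)
  eval-≋ (trans≋ t≋u u≋v) = trans (eval-≋ t≋u) (eval-≋ u≋v)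

  eval-⁻ʷ : ∀ u → eval (u ⁻ʷ) ≈ eval u ⁻¹
  eval-⁻ʷ u = inverseˡ-unique _ _ (trans (sym (eval-++ (u ⁻ʷ) u)) (eval-≋ (⁻ʷ-inverseˡ u)))

  conjugate-trivial : ∀ u {r} → Trivial r → Trivial (conjugate (u , r))
  conjugate-trivial u {r} r≈ε = trans (eval-++ u _) (trans (∙-congˡ (trans (eval-++ r _)
    (trans (∙-cong r≈ε (eval-⁻ʷ u)) (identityˡ _)))) (inverseʳ _))

  product-trivial : (∀ {r} → R r → Trivial r) → ∀ {N w} → ProductOfConjugates N w → Trivial w
  product-trivial R-trivial (cs , _ , Rs , w≋) = trans (eval-≋ w≋) (go cs Rs)
    where
    relator-trivial : ∀ {r} → R∪R⁻¹ r → Trivial r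
    relator-trivial (inj₁ Rr)                 = R-trivial Rr
    relator-trivial (inj₂ (r , Rr , ≡.refl)) =
      trans (eval-⁻ʷ r) (trans (⁻¹-cong (R-trivial Rr)) ε⁻¹≈ε)

    go : ∀ cs → All (R∪R⁻¹ ∘ proj₂) cs → eval (concatMap conjugate cs) ≈ ε
    go []             []       = refl
    go ((u , r) ∷ cs) (Rr ∷ Rs) = trans (eval-++ (conjugate (u , r)) _)
      (trans (∙-cong (conjugate-trivial u (relator-trivial Rr)) (go cs Rs)) (identityˡ ε))

  infix 4 _~[_]_
  -- At most N relators are inserted or deleted between the two words. Unlike products of
  -- conjugates, such derivations compose and extend to contexts without rearrangement.
  data _~[_]_ : Word → ℕ → Word → Set (γ ⊔ ℓ ⊔ σ ⊔ ρ) where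
    free    : ∀ {u v} → u ≋ v → u ~[ 0 ] v
    relator : ∀ u {r} v → R r → u ++ r ++ v ~[ 1 ] u ++ v
    ~-sym   : ∀ {M u v} → u ~[ M ] v → v ~[ M ] u
    ~-trans : ∀ {M N u v w} → u ~[ M ] v → v ~[ N ] w → u ~[ M ℕ.+ N ] w
    weaken  : ∀ {M N u v} → M ℕ.≤ N → u ~[ M ] v → u ~[ N ] v

  free-trans : ∀ {N u v w} → u ≋ v → v ~[ N ] w → u ~[ N ] w
  free-trans u≋v = ~-trans (free u≋v)

  trans-free : ∀ {N u v w} → u ~[ N ] v → v ≋ w → u ~[ N ] w
  trans-free u~v v≋w = weaken (ℕₚ.≤-reflexive (ℕₚ.+-identityʳ _)) (~-trans u~v (free v≋w))

  ~-++ˡ : ∀ {N} w {u v} → u ~[ N ] v → w ++ u ~[ N ] w ++ v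
  ~-++ˡ w (free u≋v)        = free (≋-++ˡ w u≋v)
  ~-++ˡ w (relator u v Rr)  = free-trans (≋-reflexive (≡.sym (Listₚ.++-assoc w u _)))
    (trans-free (relator (w ++ u) v Rr) (≋-reflexive (Listₚ.++-assoc w u v)))
  ~-++ˡ w (~-sym u~v)       = ~-sym (~-++ˡ w u~v)
  ~-++ˡ w (~-trans t~u u~v) = ~-trans (~-++ˡ w t~u) (~-++ˡ w u~v)
  ~-++ˡ w (weaken M≤N u~v)  = weaken M≤N (~-++ˡ w u~v)

  ~-++ʳ : ∀ {N} w {u v} → u ~[ N ] v → u ++ w ~[ N ] v ++ w
  ~-++ʳ w (free u≋v)            = free (≋-++ʳ w u≋v)
  ~-++ʳ w (relator u {r} v Rr)  = free-trans
    (≋-reflexive (≡.trans (Listₚ.++-assoc u _ w) (≡.cong (u ++_) (Listₚ.++-assoc r v w))))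
    (trans-free (relator u (v ++ w) Rr) (≋-reflexive (≡.sym (Listₚ.++-assoc u v w))))
  ~-++ʳ w (~-sym u~v)           = ~-sym (~-++ʳ w u~v)
  ~-++ʳ w (~-trans t~u u~v)     = ~-trans (~-++ʳ w t~u) (~-++ʳ w u~v)
  ~-++ʳ w (weaken M≤N u~v)      = weaken M≤N (~-++ʳ w u~v)

  ~-++ : ∀ {M N u u′ v v′} → u ~[ M ] u′ → v ~[ N ] v′ → u ++ v ~[ M ℕ.+ N ] u′ ++ v′
  ~-++ {u′ = u′} {v} u~u′ v~v′ = ~-trans (~-++ʳ v u~u′) (~-++ˡ u′ v~v′)

  -- Replacing u by v in the middle of u⁻¹ u v⁻¹ leads from v⁻¹ to u⁻¹, so no relator has to be
  -- inverted.
  ~-⁻ʷ : ∀ {N u v} → u ~[ N ] v → u ⁻ʷ ~[ N ] v ⁻ʷ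
  ~-⁻ʷ {u = u} {v} u~v = ~-sym (free-trans (sym≋ (≋-++ʳ (v ⁻ʷ) (⁻ʷ-inverseˡ u)))
    (free-trans (≋-reflexive (Listₚ.++-assoc (u ⁻ʷ) u (v ⁻ʷ)))
    (trans-free (~-++ˡ (u ⁻ʷ) (~-++ʳ (v ⁻ʷ) u~v))
    (trans≋ (≋-++ˡ (u ⁻ʷ) (⁻ʷ-inverseʳ v)) (≋-reflexive (Listₚ.++-identityʳ (u ⁻ʷ)))))))

  private
    Area≤ : ℕ → Pred Word _
    Area≤ N w = ∃ λ A → A ℕ.≤ N × ProductOfConjugates A w

    conjugate-insert : ∀ u r v → conjugate (u , r) ++ (u ++ v) ≋ u ++ r ++ v
    conjugate-insert u r v = trans≋ (≋-reflexive
        (≡.trans (Listₚ.++-assoc u _ _) (≡.cong (u ++_) (Listₚ.++-assoc r (u ⁻ʷ) (u ++ v)))))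
      (≋-++ˡ u (≋-++ˡ r (trans≋ (≋-reflexive (≡.sym (Listₚ.++-assoc (u ⁻ʷ) u v))) (≋-++ʳ v (⁻ʷ-inverseˡ u)))))

    Area≤-∷ : ∀ {M u v} c → R∪R⁻¹ (proj₂ c) → v ≋ conjugate c ++ u → Area≤ M u → Area≤ (suc M) v
    Area≤-∷ c Rc v≋ (A , A≤M , cs , ≡.refl , Rs , u≋) =
      suc A , ℕ.s≤s A≤M , c ∷ cs , ≡.refl , Rc ∷ Rs , trans≋ v≋ (≋-++ˡ (conjugate c) u≋)

    Area≤-≋ : ∀ {M u v} → v ≋ u → Area≤ M u → Area≤ M v
    Area≤-≋ v≋u (A , A≤M , cs , len , Rs , u≋) = A , A≤M , cs , len , Rs , trans≋ v≋u u≋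

    Area≤-weaken : ∀ {M N w} → M ℕ.≤ N → Area≤ M w → Area≤ N w
    Area≤-weaken M≤N (A , A≤M , p) = A , ℕₚ.≤-trans A≤M M≤N , p

    -- Both directions are proved at once because `~-sym` exchanges them. An arbitrary area M of the
    -- other word is allowed because the intermediate word of `~-trans` need not be empty.
    transport : ∀ {N u v} → u ~[ N ] v →
                (∀ M → Area≤ M v → Area≤ (N ℕ.+ M) u) × (∀ M → Area≤ M u → Area≤ (N ℕ.+ M) v)
    transport (free u≋v) = (λ M → Area≤-≋ u≋v) , (λ M → Area≤-≋ (sym≋ u≋v))
    transport (relator u {r} v Rr) =
      (λ M → Area≤-∷ (u , r) (inj₁ Rr) (sym≋ (conjugate-insert u r v))) ,
      (λ M → Area≤-∷ (u , r ⁻ʷ) (inj₂ (r , Rr , ≡.refl)) (sym≋ (trans≋ (conjugate-insert u (r ⁻ʷ) (r ++ v))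
        (≋-++ˡ u (trans≋ (≋-reflexive (≡.sym (Listₚ.++-assoc (r ⁻ʷ) r v))) (≋-++ʳ v (⁻ʷ-inverseˡ r)))))))
    transport (~-sym u~v) = proj₂ (transport u~v) , proj₁ (transport u~v)
    transport (~-trans {M} {N} t~u u~v) =
      (λ K → Area≤-weaken (ℕₚ.≤-reflexive (≡.sym (ℕₚ.+-assoc M N K)))
             ∘ proj₁ (transport t~u) (N ℕ.+ K) ∘ proj₁ (transport u~v) K) ,
      (λ K → Area≤-weaken (ℕₚ.≤-reflexive (≡.trans (≡.sym (ℕₚ.+-assoc N M K)) (≡.cong (ℕ._+ K) (ℕₚ.+-comm N M))))
             ∘ proj₂ (transport u~v) (M ℕ.+ K) ∘ proj₂ (transport t~u) K)
    transport (weaken M≤N u~v) =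
      (λ K → Area≤-weaken (ℕₚ.+-monoˡ-≤ K M≤N) ∘ proj₁ (transport u~v) K) ,
      (λ K → Area≤-weaken (ℕₚ.+-monoˡ-≤ K M≤N) ∘ proj₂ (transport u~v) K)

  ~[]⇒area : ∀ {N w} → w ~[ N ] [] → ∃ λ A → A ℕ.≤ N × ProductOfConjugates A w
  ~[]⇒area {N} w~[] = Area≤-weaken (ℕₚ.≤-reflexive (ℕₚ.+-identityʳ N))
    (proj₁ (transport w~[]) 0 (0 , ℕ.z≤n , [] , ≡.refl , [] , ≋-refl))

-- The group of families of words.

module Families (I : Set ι) (G : I → Group γ ℓ) (S : ∀ i → Pred (Group.Carrier (G i)) σ)
                (S-inv : ∀ i {g} → S i g → S i (Group._⁻¹ (G i) g))
                (R : ∀ i → Pred (Words.Word (G i) (S i) (S-inv i)) ρ) where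

  private
    module W (i : I) = Words (G i) (S i) (S-inv i)
    module A (i : I) = WordArea (G i) (S i) (S-inv i) (R i)

  infix 4 _≈_
  _≈_ : (∀ i → W.Word i) → (∀ i → W.Word i) → Set _
  u ≈ v = ∃ λ N → ∀ i → A._~[_]_ i (u i) N (v i)

  free : ∀ {u v} → (∀ i → W._≋_ i (u i) (v i)) → u ≈ v
  free u≋v = 0 , λ i → A.free (u≋v i)

  Γ : Group _ _
  Γ = record
    { Carrier = ∀ i → W.Word i
    ; _≈_     = _≈_
    ; _∙_     = λ u v i → u i ++ v i
    ; ε       = λ i → []
    ; _⁻¹     = λ u i → W._⁻ʷ i (u i)
    ; isGroup = record
      { isMonoid = record
        { isSemigroup = record
          { isMagma = record
            { isEquivalence = record
              { refl  = free λ i → A.≋-refl i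
              ; sym   = λ (N , p) → N , λ i → A.~-sym (p i)
              ; trans = λ (M , p) (N , q) → M ℕ.+ N , λ i → A.~-trans (p i) (q i)
              }
            ; ∙-cong = λ (M , p) (N , q) → M ℕ.+ N , λ i → A.~-++ i (p i) (q i)
            }
          ; assoc = λ u v w → free λ i → A.≋-reflexive i (Listₚ.++-assoc (u i) (v i) (w i))
          }
        ; identity = (λ u → free λ i → A.≋-refl i)
                   , (λ u → free λ i → A.≋-reflexive i (Listₚ.++-identityʳ (u i)))
        }
      ; inverse = (λ u → free λ i → A.⁻ʷ-inverseˡ i (u i)) , (λ u → free λ i → A.⁻ʷ-inverseʳ i (u i))
      ; ⁻¹-cong = λ (N , p) → N , λ i → A.~-⁻ʷ i (p i)
      }
    }

-- One half in a finite field of odd order.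

module FiniteFields {q : ℕ} (F : FiniteField q) where
  open FiniteField F hiding (inverse)
  open CommutativeRing commutativeRing using (+-identityˡ; +-identityʳ; +-assoc; -‿inverseʳ; -‿inverseˡ; semiring; +-monoid; +-group; distribʳ; *-identityˡ)
  open Inverse cardinality using (to; from; strictlyInverseˡ; strictlyInverseʳ)
  open Sum semiring
  open Mult +-monoid using () renaming (_×_ to _×ⁿ_)

  _≟_ : DecidableEquality Carrier
  _≟_ = via-injection (↔⇒↣ cardinality) Finₚ._≟_

  -- Translation by 1 permutes the field, so the sum of all elements does not change when q ones are
  -- added to it.
  q×1≡0 : q ×ⁿ 1# ≡ 0#
  q×1≡0 = identityʳ-unique (sum from) (q ×ⁿ 1#) (≡.sym (begin
    sum from                     ≡⟨ sum-permute from shift ⟩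
    sum (λ i → from (to (from i + 1#)))  ≡⟨ sum-cong-≗ (λ i → strictlyInverseʳ (from i + 1#)) ⟩
    sum (λ i → from i + 1#)      ≡⟨ ∑-distrib-+ from (λ _ → 1#) ⟩
    sum from + sum {q} (λ _ → 1#)    ≡⟨ ≡.cong (sum from +_) (sum-replicate q) ⟩
    sum from + q ×ⁿ 1#           ∎))
    where
    open ≡.≡-Reasoning
    open GroupProperties +-group using (identityʳ-unique)

    cancelʳ : ∀ x y z → y + z ≡ 0# → x + y + z ≡ x
    cancelʳ x y z y+z≡0 = ≡.trans (+-assoc x y z) (≡.trans (≡.cong (x +_) y+z≡0) (+-identityʳ x))

    shift : Permutation q q
    shift = permutation (λ i → to (from i + 1#)) (λ i → to (from i + - 1#))
      (λ i → ≡.trans (≡.cong (λ x → to (x + 1#)) (strictlyInverseʳ _))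
               (≡.trans (≡.cong to (cancelʳ (from i) (- 1#) 1# (-‿inverseˡ 1#))) (strictlyInverseˡ i)))
      (λ i → ≡.trans (≡.cong (λ x → to (x + - 1#)) (strictlyInverseʳ _))
               (≡.trans (≡.cong to (cancelʳ (from i) 1# (- 1#) (-‿inverseʳ 1#))) (strictlyInverseˡ i)))

  -- If 2 = 0, multiples of 1 depend only on parity, and an odd one equals 1.
  1+1≡0⇒even : 1# + 1# ≡ 0# → ∀ n → n ×ⁿ 1# ≡ 0# → 2 ∣ n
  1+1≡0⇒even 2≡0 zero          _     = 2 ∣0
  1+1≡0⇒even 2≡0 (suc zero)    1≡0   = contradiction (≡.trans (≡.sym 1≡0) (+-identityʳ 1#)) 0≢1
  1+1≡0⇒even 2≡0 (suc (suc n)) n+2≡0 = ∣m∣n⇒∣m+n ∣-refl (1+1≡0⇒even 2≡0 n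
    (≡.trans (≡.sym (+-identityˡ _)) (≡.trans (≡.cong (_+ n ×ⁿ 1#) (≡.sym 2≡0)) (≡.trans (+-assoc 1# 1# _) n+2≡0))))

  half : ¬ (2 ∣ q) → ∃ λ ½ → ½ + ½ ≡ 1#
  half q-odd with FiniteField.inverse F (1# + 1#) (λ 2≡0 → q-odd (1+1≡0⇒even 2≡0 q q×1≡0))
  ... | ½ , 2*½≡1 = ½ , ≡.trans (≡.sym (≡.trans (distribʳ ½ 1# 1#)
                          (≡.cong₂ _+_ (*-identityˡ ½) (*-identityˡ ½)))) 2*½≡1

-- Words for the elements of the block subgroups.

module Letters (n : ℕ) {q : ℕ} (F : FiniteField q) where
  open FiniteFields F
  open Matrices (FiniteField.commutativeRing F)
  open Unitriangular
  open UnipPresentation n F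
  open Linear (FiniteField.commutativeRing F)
  open Generation (FiniteField.commutativeRing F)
  open WordArea G S S-inv (λ w → ∃ λ i → R i w)
  private
    module G = Group G
  open G using (_≈_; ε; _∙_; _⁻¹)

  Blocked : G.Carrier → Set
  Blocked g = ∃ λ (κ : Fin n) → Block (toℕ κ) (matrix g)

  trivial? : ∀ g → Dec (g ≈ ε)
  trivial? g = Finₚ.all? λ i → Finₚ.all? λ j → matrix g i j ≟ 1ᴹ i j

  blocked? : ∀ g → Dec (Blocked g)
  blocked? g = Finₚ.any? λ κ → Finₚ.all? λ i → Finₚ.all? λ j →
    (toℕ i ℕₚ.≤? toℕ κ) →-dec ((toℕ κ ℕₚ.<? toℕ j) →-dec (matrix g i j ≟ FiniteField.0# F))

  Block⇒K : ∀ κ g → Block (toℕ κ) (matrix g) → K κ g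
  Block⇒K κ g b = Block⇒generated κ g b

  private
    -- The decisions are arguments so that the lemmas below can split on them. The κ that is found
    -- may differ between equal elements; this is harmless, as letters are compared by their group
    -- elements.
    letter? : ∀ g → Dec (g ≈ ε) → Dec (Blocked g) → Word
    letter? g (yes _)  _             = []
    letter? g (no _)   (no _)        = []
    letter? g (no g≉ε) (yes (κ , b)) = (g , (κ , Block⇒K κ g b) , g≉ε) ∷ []

    trivial-case : ∀ g → g ≈ ε → ∀ p b → letter? g p b ≡ []
    trivial-case g g≈ε (yes _)  _ = ≡.refl
    trivial-case g g≈ε (no g≉ε) _ = contradiction g≈ε g≉ε

    nontrivial-case : ∀ g → Blocked g → ¬ (g ≈ ε) → ∀ p b → ∃ λ s → letter? g p b ≡ (g , s) ∷ []
    nontrivial-case g b g≉ε (yes g≈ε) _             = contradiction g≈ε g≉ε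
    nontrivial-case g b g≉ε (no _)    (no ¬b)       = contradiction b ¬b
    nontrivial-case g b g≉ε (no g≉ε′) (yes (κ , b′)) = ((κ , Block⇒K κ g b′) , g≉ε′) , ≡.refl

    cong-case : ∀ g h → g ≈ h → ∀ p b p′ b′ → letter? g p b ≋ letter? h p′ b′
    cong-case g h g≈h (yes _)   _             (yes _)   _             = ≋-refl
    cong-case g h g≈h (yes g≈ε) _             (no h≉ε)  _             =
      contradiction (G.trans {h} {g} {ε} (G.sym {g} {h} g≈h) g≈ε) h≉ε
    cong-case g h g≈h (no g≉ε)  _             (yes h≈ε) _             =
      contradiction (G.trans {g} {h} {ε} g≈h h≈ε) g≉ε
    cong-case g h g≈h (no _)    (no _)        (no _)    (no _)        = ≋-refl
    cong-case g h g≈h (no _)    (yes (κ , b)) (no _)    (no ¬b)       =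
      contradiction (κ , Block-cong g≈h b) ¬b
    cong-case g h g≈h (no _)    (no ¬b)       (no _)    (yes (κ , b)) =
      contradiction (κ , Block-cong (G.sym {g} {h} g≈h) b) ¬b
    cong-case g h g≈h (no _)    (yes _)       (no _)    (yes _)       = letters (g≈h ∷ [])

  abstract
    -- Junk value [] outside ⋃ K_{i}.
    letter : G.Carrier → Word
    letter g = letter? g (trivial? g) (blocked? g)

    letter-trivial : ∀ g → g ≈ ε → letter g ≡ []
    letter-trivial g g≈ε = trivial-case g g≈ε (trivial? g) (blocked? g)

    letter-nontrivial : ∀ g → Blocked g → ¬ (g ≈ ε) → ∃ λ s → letter g ≡ (g , s) ∷ []
    letter-nontrivial g b g≉ε = nontrivial-case g b g≉ε (trivial? g) (blocked? g)

    letter-cong : ∀ g h → g ≈ h → letter g ≋ letter h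
    letter-cong g h g≈h = cong-case g h g≈h (trivial? g) (blocked? g) (trivial? h) (blocked? h)

  letter-∈S : (x : Letter) → letter (proj₁ x) ≋ x ∷ []
  letter-∈S (g , (κ , Kg) , g≉ε) =
    trans≋ (≋-reflexive (proj₂ (letter-nontrivial g (κ , generated⇒Block κ Kg) g≉ε)))
           (letters (G.refl {g} ∷ []))

  triangle : ∀ κ (x y z : Letter) → K κ (proj₁ x) → K κ (proj₁ y) → proj₁ z ≈ proj₁ x ∙ proj₁ y →
             z ∷ [] ~[ 1 ] x ∷ y ∷ []
  triangle κ x@(g , _) y@(h , _) z@(k , _) Kg Kh k≈gh = ~-sym (free-trans
    -- The pair z⁻¹ z is inserted after x y to expose the relator x y z⁻¹; `cancel` produces the
    -- double inverse of z in place of z.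
    (sym≋ (trans≋ (letters (G.refl {g} ∷ G.refl {h} ∷ G.refl {k ⁻¹} ∷ G.sym {k ⁻¹ ⁻¹} {k} (⁻¹-involutive k) ∷ []))
                  (cancel (x ∷ y ∷ []) (inv z) [])))
    (relator [] {x ∷ y ∷ inv z ∷ []} (z ∷ []) (κ , ≡.refl , Kg ∷ Kh ∷ inverse Kk ∷ [] , relation)))
    where
    open GroupProperties G using (⁻¹-involutive)

    Kk : K κ k
    Kk = respects {g = g ∙ h} {k} (G.sym {k} {g ∙ h} k≈gh) (product Kg Kh)

    relation : g ∙ (h ∙ (k ⁻¹ ∙ ε)) ≈ ε
    relation = begin
      g ∙ (h ∙ (k ⁻¹ ∙ ε))   ≈⟨ G.assoc g h (k ⁻¹ ∙ ε) ⟨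
      g ∙ h ∙ (k ⁻¹ ∙ ε)     ≈⟨ G.∙-cong {g ∙ h} {k} {k ⁻¹ ∙ ε} {k ⁻¹} (G.sym {k} {g ∙ h} k≈gh) (G.identityʳ (k ⁻¹)) ⟩
      k ∙ k ⁻¹               ≈⟨ G.inverseʳ k ⟩
      ε                      ∎
      where open import Relation.Binary.Reasoning.Setoid G.setoid

  -- As ε is not a letter, there is a relator only if g, h and g ∙ h are all nontrivial. The other
  -- cases hold already in Free(S): if g ∙ h is trivial, the two letters cancel.
  letter-homo : ∀ (κ : Fin n) g h → Block (toℕ κ) (matrix g) → Block (toℕ κ) (matrix h) →
                letter (g ∙ h) ~[ 1 ] letter g ++ letter h
  letter-homo κ g h bg bh = split (trivial? g) (trivial? h) (trivial? (g ∙ h))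
    where
    open GroupProperties G using (inverseʳ-unique)

    split : Dec (g ≈ ε) → Dec (h ≈ ε) → Dec (g ∙ h ≈ ε) → letter (g ∙ h) ~[ 1 ] letter g ++ letter h
    split (yes g≈ε) _ _ = weaken ℕ.z≤n (free (trans≋
      (letter-cong (g ∙ h) h (G.trans {g ∙ h} {ε ∙ h} {h} (G.∙-congʳ {h} {g} {ε} g≈ε) (G.identityˡ h)))
      (≋-reflexive (≡.cong (_++ letter h) (≡.sym (letter-trivial g g≈ε))))))
    split (no _) (yes h≈ε) _ = weaken ℕ.z≤n (free (trans≋
      (letter-cong (g ∙ h) g (G.trans {g ∙ h} {g ∙ ε} {g} (G.∙-congˡ {g} {h} {ε} h≈ε) (G.identityʳ g)))
      (≋-reflexive (≡.trans (≡.sym (Listₚ.++-identityʳ (letter g)))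
        (≡.cong (letter g ++_) (≡.sym (letter-trivial h h≈ε)))))))
    split (no g≉ε) (no h≉ε) gh? =
      trans-free (product-case gh?) (≋-reflexive (≡.cong₂ _++_ (≡.sym (proj₂ lg)) (≡.sym (proj₂ lh))))
      where
      lg = letter-nontrivial g (κ , bg) g≉ε
      lh = letter-nontrivial h (κ , bh) h≉ε

      product-case : Dec (g ∙ h ≈ ε) → letter (g ∙ h) ~[ 1 ] (g , proj₁ lg) ∷ (h , proj₁ lh) ∷ []
      product-case (yes gh≈ε) = weaken ℕ.z≤n (free (trans≋ (≋-reflexive (letter-trivial (g ∙ h) gh≈ε))
        (sym≋ (trans≋ (letters (G.refl {g} ∷ inverseʳ-unique g h gh≈ε ∷ [])) (cancel [] (g , proj₁ lg) [])))))
      product-case (no gh≉ε) = free-trans (≋-reflexive (proj₂ lgh))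
        (triangle κ (g , proj₁ lg) (h , proj₁ lh) (g ∙ h , proj₁ lgh)
          (Block⇒K κ g bg) (Block⇒K κ h bh) (G.refl {g ∙ h}))
        where
        lgh = letter-nontrivial (g ∙ h) (κ , Block-* (toℕ κ) bg bh) gh≉ε

  R-trivial : ∀ {w} → ∃ (λ i → R i w) → Trivial w
  R-trivial (_ , _ , _ , w≈ε) = w≈ε

  -- Words are indexed by the list of their κ because a family of letters is a block matrix over the
  -- product ring only if κ is the same in all instances. For a given word, `kinds` reads the list
  -- off its membership proofs.
  LetterIn : Fin n → Set
  LetterIn κ = Σ Letter (K κ ∘ proj₁)

  toWord : ∀ {ks} → All LetterIn ks → Word
  toWord {[]}     xs = []
  toWord {κ ∷ ks} xs = proj₁ (All.head xs) ∷ toWord (All.tail xs)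

  kinds : Word → List (Fin n)
  kinds = map (λ x → proj₁ (proj₁ (proj₂ x)))

  annotate : ∀ w → All LetterIn (kinds w)
  annotate []      = []
  annotate (x ∷ w) = (x , proj₂ (proj₁ (proj₂ x))) ∷ annotate w

  toWord-annotate : ∀ w → toWord (annotate w) ≡ w
  toWord-annotate []      = ≡.refl
  toWord-annotate (x ∷ w) = ≡.cong (x ∷_) (toWord-annotate w)

-- Generation of the unitriangular group by letters.

module Generators (d : ℕ) {q : ℕ} (F : FiniteField q) where
  open Letters (suc (suc d)) F
  open Matrices (FiniteField.commutativeRing F)
  open UnipPresentation (suc (suc d)) F
  open Generation (FiniteField.commutativeRing F)
  open WordArea G S S-inv (λ w → ∃ λ i → R i w)
  private
    module G = Group G

  simple-word : ∀ j x → ∃ λ w → eval w G.≈ simple j x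
  simple-word j x = by-cases (trivial? (simple j x))
    where
    other : Fin (suc (suc d)) → Fin (suc (suc d))
    other zero    = suc zero
    other (suc _) = zero

    j≢other : ∀ j → j ≢ other j
    j≢other zero    ()
    j≢other (suc _) ()

    by-cases : Dec (simple j x G.≈ G.ε) → ∃ λ w → eval w G.≈ simple j x
    by-cases (yes ≈ε) = [] , G.sym {simple j x} {G.ε} ≈ε
    by-cases (no  ≉ε) =
      (simple j x , (other j , generator (j , x , j≢other j , G.refl {simple j x})) , ≉ε) ∷ [] ,
      G.identityʳ (simple j x)

  generated-word : ∀ {g} → ⟨ (λ (_ : Fin (suc (suc d))) → ⊤) ⟩ g → ∃ λ w → eval w G.≈ g
  generated-word (generator {g} (j , x , _ , g≈)) =
    proj₁ (simple-word j x) ,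
    G.trans {eval (proj₁ (simple-word j x))} {simple j x} {g} (proj₂ (simple-word j x)) (G.sym {g} {simple j x} g≈)
  generated-word unit = [] , G.refl {G.ε}
  generated-word (product {g} {h} Jg Jh) = u ++ v ,
    G.trans {eval (u ++ v)} {eval u G.∙ eval v} {g G.∙ h} (eval-++ u v)
      (G.∙-cong {eval u} {g} {eval v} {h} (proj₂ (generated-word Jg)) (proj₂ (generated-word Jh)))
    where
    u = proj₁ (generated-word Jg)
    v = proj₁ (generated-word Jh)
  generated-word (inverse {g} Jg) = u ⁻ʷ ,
    G.trans {eval (u ⁻ʷ)} {eval u G.⁻¹} {g G.⁻¹} (eval-⁻ʷ u)
      (G.⁻¹-cong {eval u} {g} (proj₂ (generated-word Jg)))
    where u = proj₁ (generated-word Jg)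
  generated-word (respects {g} {h} g≈h Jg) = u , G.trans {eval u} {g} {h} (proj₂ (generated-word Jg)) g≈h
    where u = proj₁ (generated-word Jg)

  generate : ∀ g → ∃ λ w → eval w G.≈ g
  generate g = generated-word (compatible⇒generated (λ _ → ⊤) g (λ _ _ _ → inj₂ (λ _ _ _ → tt)))

-- Matrices over a product of rings.

productRing : (I : Set ι) → (I → CommutativeRing ρ ℓ) → CommutativeRing (ι ⊔ ρ) (ι ⊔ ℓ)
productRing I A = record
  { Carrier = ∀ i → A.Carrier i
  ; _≈_     = λ x y → ∀ i → A._≈_ i (x i) (y i)
  ; _+_     = λ x y i → A._+_ i (x i) (y i)
  ; _*_     = λ x y i → A._*_ i (x i) (y i)
  ; -_      = λ x i → A.-_ i (x i)
  ; 0#      = λ i → A.0# i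
  ; 1#      = λ i → A.1# i
  ; isCommutativeRing = record
    { isRing = record
      { +-isAbelianGroup = record
        { isGroup = record
          { isMonoid = record
            { isSemigroup = record
              { isMagma = record
                { isEquivalence = record
                  { refl  = λ i → A.refl i
                  ; sym   = λ x≈y i → A.sym i (x≈y i)
                  ; trans = λ x≈y y≈z i → A.trans i (x≈y i) (y≈z i)
                  }
                ; ∙-cong = λ x≈ y≈ i → A.+-cong i (x≈ i) (y≈ i)
                }
              ; assoc = λ x y z i → A.+-assoc i (x i) (y i) (z i)
              }
            ; identity = (λ x i → A.+-identityˡ i (x i)) , (λ x i → A.+-identityʳ i (x i))
            }
          ; inverse = (λ x i → A.-‿inverseˡ i (x i)) , (λ x i → A.-‿inverseʳ i (x i))
          ; ⁻¹-cong = λ x≈ i → A.-‿cong i (x≈ i)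
          }
        ; comm = λ x y i → A.+-comm i (x i) (y i)
        }
      ; *-cong = λ x≈ y≈ i → A.*-cong i (x≈ i) (y≈ i)
      ; *-assoc = λ x y z i → A.*-assoc i (x i) (y i) (z i)
      ; *-identity = (λ x i → A.*-identityˡ i (x i)) , (λ x i → A.*-identityʳ i (x i))
      ; distrib = (λ x y z i → A.distribˡ i (x i) (y i) (z i)) , (λ x y z i → A.distribʳ i (x i) (y i) (z i))
      }
    ; *-comm = λ x y i → A.*-comm i (x i) (y i)
    }
  }
  where module A (i : I) = CommutativeRing (A i)

module FamilyMatrices (I : Set ι) (A : I → CommutativeRing ρ ℓ) where
  private
    module ΠA = CommutativeRing (productRing I A)
    module M (i : I) = Matrices (A i)
    module ΠM = Matrices (productRing I A)
    module A (i : I) = CommutativeRing (A i)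

  sum-at : ∀ {d} (f : Fin d → ΠA.Carrier) i →
           Sum.sum ΠA.semiring f i ≡ Sum.sum (A.semiring i) (λ l → f l i)
  sum-at {zero}  f i = ≡.refl
  sum-at {suc d} f i = ≡.cong (A._+_ i (f zero i)) (sum-at (f ∘ suc) i)

  1ᴹ-at : ∀ {d} (r c : Fin d) i → ΠM.1ᴹ r c i ≡ M.1ᴹ i r c
  1ᴹ-at r c i = if-at (does (r Finₚ.≟ c))
    where
    if-at : ∀ b → (if b then ΠA.1# else ΠA.0#) i ≡ (if b then A.1# i else A.0# i)
    if-at false = ≡.refl
    if-at true  = ≡.refl

  at : ∀ {d} → ΠM.Unitriangular d → ∀ i → M.Unitriangular i d
  at g i = M._,ᵁ_ (λ r c → ΠM.Unitriangular.matrix g r c i) record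
    { diagonal = λ r → ΠM.IsUnitriangular.diagonal (ΠM.Unitriangular.isUnitriangular g) r i
    ; lower    = λ c<r → ΠM.IsUnitriangular.lower (ΠM.Unitriangular.isUnitriangular g) c<r i
    }

  family : ∀ {d} → (∀ i → M.Unitriangular i d) → ΠM.Unitriangular d
  family g = (λ r c i → M.Unitriangular.matrix (g i) r c) ΠM.,ᵁ record
    { diagonal = λ r i → M.IsUnitriangular.diagonal (M.Unitriangular.isUnitriangular (g i)) r
    ; lower    = λ c<r i → M.IsUnitriangular.lower (M.Unitriangular.isUnitriangular (g i)) c<r
    }

  *ᴹ-at : ∀ {d} (M N : ΠM.Mat d) i r c →
          ΠM._*ᴹ_ M N r c i ≡ M._*ᴹ_ i (λ r c → M r c i) (λ r c → N r c i) r c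
  *ᴹ-at M N i r c = sum-at (λ l → M r l ΠA.* N l c) i

  at-∙ : ∀ {d} (g h : ΠM.Unitriangular d) i →
         Group._≈_ (M.Unip i d) (at (Group._∙_ (ΠM.Unip d) g h) i) (Group._∙_ (M.Unip i d) (at g i) (at h i))
  at-∙ g h i r c = A.reflexive i
    (*ᴹ-at (ΠM.Unitriangular.matrix g) (ΠM.Unitriangular.matrix h) i r c)

  family-∙ : ∀ {d} (g h : ∀ i → M.Unitriangular i d) →
             Group._≈_ (ΠM.Unip d) (family (λ i → Group._∙_ (M.Unip i d) (g i) (h i)))
                                   (Group._∙_ (ΠM.Unip d) (family g) (family h))
  family-∙ g h r c i = A.reflexive i (≡.sym
    (*ᴹ-at (ΠM.Unitriangular.matrix (family g)) (ΠM.Unitriangular.matrix (family h)) i r c))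

  family-ε : ∀ {d} (g : ∀ i → M.Unitriangular i d) → (∀ i → Group._≈_ (M.Unip i d) (g i) (Group.ε (M.Unip i d))) →
             Group._≈_ (ΠM.Unip d) (family g) (Group.ε (ΠM.Unip d))
  family-ε g g≈ε r c i = A.trans i (g≈ε i r c) (A.reflexive i (≡.sym (1ᴹ-at r c i)))

-- The uniform bound for words of prescribed kinds.

module Uniform (d : ℕ) (I : Set ι) (q : I → ℕ) (F : ∀ i → FiniteField (q i))
  (n≥4⊎odd : (i : I) → 4 ≤ suc (suc (suc d)) ⊎ ¬ (2 ∣ q i)) where

  private
    module P (i : I) = UnipPresentation (suc (suc (suc d))) (F i)
    module L (i : I) = Letters (suc (suc (suc d))) (F i)
    module W (i : I) = WordArea (P.G i) (P.S i) (P.S-inv i) (λ w → ∃ λ κ → P.R i κ w)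
    module G (i : I) = Group (P.G i)

    A : CommutativeRing _ _
    A = productRing I (λ i → FiniteField.commutativeRing (F i))

    open Families I P.G P.S P.S-inv (λ i w → ∃ λ κ → P.R i κ w) using (Γ)
    module Γ = Group Γ
    module Aₘ = Matrices A
    open FamilyMatrices I (λ i → FiniteField.commutativeRing (F i))

    -- Outside the blocks the values are junk, but there `Extension` asks only for compatibility
    -- with equality, which `letter-cong` gives for all elements.
    φ : Aₘ.Unitriangular (suc (suc (suc (suc d)))) → Γ.Carrier
    φ g i = L.letter i (at g i)

    φ-cong : ∀ {g h} → Aₘ.Unitriangular.matrix g Aₘ.≈ᴹ Aₘ.Unitriangular.matrix h → φ g Γ.≈ φ h
    φ-cong {g} {h} g≈h = 0 , λ i → W.free (L.letter-cong i (at g i) (at h i) (λ r c → g≈h r c i))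

    φ-homo : ∀ κ → κ ≤ suc (suc d) → ∀ g h →
             Linear.Block A κ (Aₘ.Unitriangular.matrix g) →
             Linear.Block A κ (Aₘ.Unitriangular.matrix h) →
             φ (Group._∙_ (Aₘ.Unip (suc (suc (suc (suc d))))) g h) Γ.≈ (φ g Γ.∙ φ h)
    φ-homo κ κ≤d g h bg bh = 1 , λ i → W.free-trans i
      (L.letter-cong i (at (Group._∙_ (Aₘ.Unip (suc (suc (suc (suc d))))) g h) i) (G._∙_ i (at g i) (at h i)) (at-∙ g h i))
      (L.letter-homo i κ′ (at g i) (at h i)
        (λ r c r≤κ κ<c → bg r c (≡.subst (toℕ r ≤_) κ′≡κ r≤κ) (≡.subst (ℕ._< toℕ c) κ′≡κ κ<c) i)
        (λ r c r≤κ κ<c → bh r c (≡.subst (toℕ r ≤_) κ′≡κ r≤κ) (≡.subst (ℕ._< toℕ c) κ′≡κ κ<c) i))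
      where
      κ′ : Fin (suc (suc (suc d)))
      κ′ = fromℕ< (ℕ.s≤s κ≤d)

      κ′≡κ : toℕ κ′ ≡ κ
      κ′≡κ = Finₚ.toℕ-fromℕ< (ℕ.s≤s κ≤d)

  open Core A Γ using (Action; OffDiagonal; off-diagonal₂; off-diagonal₃)

  private
    -- For e = 0, that is n = 3, the first alternative is absurd in every instance; so each field
    -- has a half, and together these halves are one in the product ring.
    off-diagonal : ∀ e → (∀ i → 4 ≤ suc (suc (suc e)) ⊎ ¬ (2 ∣ q i)) →
                   (𝒜 : Action (suc (suc e))) → OffDiagonal 𝒜
    off-diagonal (suc e) _   = off-diagonal₃
    off-diagonal zero    odd = off-diagonal₂ (proj₁ ∘ ½) (proj₂ ∘ ½)
      where
      ½ : ∀ i → ∃ λ x → FiniteField._+_ (F i) x x ≡ FiniteField.1# (F i)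
      ½ i = FiniteFields.half (F i) ([ (λ { (ℕ.s≤s (ℕ.s≤s (ℕ.s≤s ()))) }) , (λ 2∤q → 2∤q) ]′ (odd i))

  open ExtensionHomomorphism A Γ d φ φ-cong φ-homo (off-diagonal d n≥4⊎odd)

  -- In each position the letters of all instances form one block matrix over the product ring.
  -- There Ψ agrees with φ, whose value is that family of letters.
  toWord≈Ψ : ∀ ks (w : ∀ i → All (L.LetterIn i) ks) →
             (λ i → L.toWord i (w i)) Γ.≈ Ψ (family (λ i → P.eval i (L.toWord i (w i))))
  toWord≈Ψ [] w = Γ.sym (Γ.trans
    (Ψ-cong {family (λ i → G.ε i)} {Group.ε (Aₘ.Unip (suc (suc (suc (suc d)))))} (family-ε (λ i → G.ε i) (λ i → G.refl i {G.ε i})))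
    Ψ-ε)
  toWord≈Ψ (κ ∷ ks) w = begin
    (λ i → x i ∷ rest i)
      ≈⟨ (0 , λ i → W.free (W.≋-++ʳ i (rest i) (P.sym≋ (L.letter-∈S i (x i))))) ⟩
    φ (family (λ i → proj₁ (x i))) Γ.∙ rest
      ≈⟨ Γ.∙-cong (Γ.sym (Ψ≈φ (toℕ κ) (ℕ.s≤s⁻¹ (Finₚ.toℕ<n κ)) _ block)) (toWord≈Ψ ks (λ i → All.tail (w i))) ⟩
    Ψ (family (λ i → proj₁ (x i))) Γ.∙ Ψ (family (λ i → P.eval i (rest i)))
      ≈⟨ Ψ-homo (family (λ i → proj₁ (x i))) (family (λ i → P.eval i (rest i))) ⟨
    Ψ (Group._∙_ (Aₘ.Unip (suc (suc (suc (suc d))))) (family (λ i → proj₁ (x i))) (family (λ i → P.eval i (rest i))))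
      ≈⟨ Ψ-cong {family (λ i → P.eval i (x i ∷ rest i))}
                {Group._∙_ (Aₘ.Unip (suc (suc (suc (suc d))))) (family (λ i → proj₁ (x i))) (family (λ i → P.eval i (rest i)))}
           (family-∙ (λ i → proj₁ (x i)) (λ i → P.eval i (rest i))) ⟨
    Ψ (family (λ i → P.eval i (x i ∷ rest i))) ∎
    where
    open import Relation.Binary.Reasoning.Setoid Γ.setoid

    x : ∀ i → P.Letter i
    x i = proj₁ (All.head (w i))

    rest : ∀ i → P.Word i
    rest i = L.toWord i (All.tail (w i))

    block : Linear.Block A (toℕ κ) (Aₘ.Unitriangular.matrix (family (λ i → proj₁ (x i))))
    block r c r≤κ κ<c i = Generation.generated⇒Block (FiniteField.commutativeRing (F i)) κ
      {proj₁ (x i)} (proj₂ (All.head (w i))) r c r≤κ κ<c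

  uniform-area : ∀ ks (w : ∀ i → All (L.LetterIn i) ks) → (∀ i → P.Trivial i (L.toWord i (w i))) →
                 ∃ λ N → ∀ i → W._~[_]_ i (L.toWord i (w i)) N []
  uniform-area ks w w≈ε = Γ.trans (toWord≈Ψ ks w) (Γ.trans
    (Ψ-cong {family (λ i → P.eval i (L.toWord i (w i)))} {Group.ε (Aₘ.Unip (suc (suc (suc (suc d)))))}
      (family-ε (λ i → P.eval i (L.toWord i (w i))) w≈ε))
    Ψ-ε)

-- From lists of kinds to the Dehn function.

module _ {n : ℕ} where
  -- The maximum of `f` over the finitely many lists of length at most m.
  longest : ℕ → (List (Fin n) → ℕ) → ℕ
  longest zero    f = f []
  longest (suc m) f = f [] ℕ.⊔ max 0 (map (λ k → longest m (f ∘ (k ∷_))) (allFin n))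

  ≤-longest : ∀ m (f : List (Fin n) → ℕ) ks → length ks ≤ m → f ks ≤ longest m f
  ≤-longest zero    f []       _           = ℕₚ.≤-refl
  ≤-longest (suc m) f []       _           = ℕₚ.m≤m⊔n (f []) _
  ≤-longest (suc m) f (k ∷ ks) (ℕ.s≤s len) = ℕₚ.≤-trans (≤-longest m (f ∘ (k ∷_)) ks len)
    (ℕₚ.≤-trans (All.lookup (xs≤max 0 _) (∈-map⁺ (λ k → longest m (f ∘ (k ∷_))) (∈-allFin k)))
                (ℕₚ.m≤n⊔m (f []) _))

-- The index set of the tautological family. The field and its order are components of the index, so
-- the bound depends only on d and `ks`.
record TrivialWord (d : ℕ) (ks : List (Fin (suc (suc (suc d))))) : Set₁ where
  field
    {q}     : ℕ
    F       : FiniteField q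
    n≥4⊎odd : 4 ≤ suc (suc (suc d)) ⊎ ¬ (2 ∣ q)
    word    : All (Letters.LetterIn (suc (suc (suc d))) F) ks
    trivial : UnipPresentation.Trivial (suc (suc (suc d))) F (Letters.toWord (suc (suc (suc d))) F word)

open TrivialWord

module Conclusion (d : ℕ) where

  uniform : ∀ ks → ∃ λ N → ∀ (t : TrivialWord d ks) →
            WordArea._~[_]_ (UnipPresentation.G (suc (suc (suc d))) (F t)) (UnipPresentation.S (suc (suc (suc d))) (F t))
              (UnipPresentation.S-inv (suc (suc (suc d))) (F t)) (λ w → ∃ λ κ → UnipPresentation.R (suc (suc (suc d))) (F t) κ w)
              (Letters.toWord (suc (suc (suc d))) (F t) (word t)) N []
  uniform ks = Uniform.uniform-area d (TrivialWord d ks) q F n≥4⊎odd ks word trivial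

  bound : List (Fin (suc (suc (suc d)))) → ℕ
  bound ks = proj₁ (uniform ks)

  module _ {q : ℕ} (F : FiniteField q) (n≥4⊎odd : 4 ≤ (suc (suc (suc d))) ⊎ ¬ (2 ∣ q)) where
    open UnipPresentation (suc (suc (suc d))) F
    open Letters (suc (suc (suc d))) F
    open WordArea G S S-inv (λ w → ∃ λ κ → R κ w)
    open Group G using (_≈_)

    area≤bound : ∀ w → Trivial w → ∃ λ A → A ≤ bound (kinds w) × ProductOfConjugates A w
    area≤bound w w≈ε = ~[]⇒area (≡.subst (λ u → u ~[ bound (kinds w) ] []) (toWord-annotate w)
      (proj₂ (uniform (kinds w)) record
        { F       = F
        ; n≥4⊎odd = n≥4⊎odd
        ; word    = annotate w
        ; trivial = ≡.subst Trivial (≡.sym (toWord-annotate w)) w≈ε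
        }))

    area : ∀ w → Trivial w → ∃ λ N → ProductOfConjugates N w
    area w w≈ε = proj₁ (area≤bound w w≈ε) , proj₂ (proj₂ (area≤bound w w≈ε))

    trivial-of-area : ∀ w → (∃ λ N → ProductOfConjugates N w) → Trivial w
    trivial-of-area w (N , p) = product-trivial (λ {r} → R-trivial {r}) {N} {w} p

    generated : ∀ g → ∃ λ w → eval w ≈ g
    generated = Generators.generate (suc d) F

    relations : ∀ w → Trivial w ⇔ (∃ λ N → ProductOfConjugates N w)
    relations w = mk⇔ (area w) (trivial-of-area w)

    isPresentation : IsPresentation
    isPresentation = generated , relations

    dehn≤ : ∀ m → Dehn[ m ]≤ longest m bound
    dehn≤ m w (_ , w≈ε , len) = let A , A≤ , p = area≤bound w w≈ε in
      A , ℕₚ.≤-trans A≤ (≤-longest m bound (kinds w)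
            (≡.subst (_≤ m) (≡.sym (Listₚ.length-map _ w)) len)) , p

theorem7p7 : (n : ℕ) → 3 ≤ n →
    Σ (ℕ → ℕ) λ N →
    ∀ (q : ℕ) → PrimePower q → (F : FiniteField q) →
    4 ≤ n ⊎ ¬ (2 ∣ q) →
    UnipPresentation.IsPresentation n F
    × (∀ m → UnipPresentation.Dehn[_]≤_ n F m (N m))
theorem7p7 (suc (suc (suc d))) (ℕ.s≤s (ℕ.s≤s (ℕ.s≤s ℕ.z≤n))) =
  (λ m → longest m bound) , λ q _ F n≥4⊎odd → isPresentation F n≥4⊎odd , dehn≤ F n≥4⊎odd
  where open Conclusion d
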